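{- Fix $p\in[0,1]$ and set $x=p/2$, $y=1-p/2$, $q=1-p$. For $n\ge1$ let $\vec G(n,p)$ be the random directed graph on $[n]$ obtained by including each edge independently with probability $p$ and then orienting each included edge independently in either direction with probability $1/2$. For a vertex $v$, the out-cluster $\overrightarrow{C}_v$ is the set of vertices $u$ such that there is a directed path from $v$ to $u$, and the in-cluster $\overleftarrow{C}_v$ is the set of vertices $u$ such that there is a directed path from $u$ to $v$; by convention $v\in\overrightarrow{C}_v\cap\overleftarrow{C}_v$. For $s\in S\subseteq[n]$ with $|S|=k$ let $d_p(n,k)=\mathbb{P}(\overrightarrow{C}_s=S)$ (this depends only on $n,k$; $d_p(1,1)=1$). For $n\ge2$, distinct $a,t\in[n]$, $t\in T\subseteq[n]$, $a\in A\subseteq[n]$ with $|T|=\tau$, $|A|=\alpha$, $|[n]\setminus(A\cup T)|=r$, let $N_p(n,\tau,\alpha,r)=\mathbb{P}(\overrightarrow{C}_t=T,\ \overleftarrow{C}_a=A)$ (this depends only on $n,\tau,\alpha,r$; $N_p(2,2,2,0)=x$, $N_p(2,1,1,0)=y$), and write $j=\tau+\alpha-(n-r)=|A\cap T|$. Then, for $\tau,\alpha\ge1$ and $\tau+\alpha\ge n-r\ge\tau,\alpha$: (i) for $r>0$: $N_p(n,\tau,\alpha,r)=N_p(n-r,\tau,\alpha,0)\,q^{r(r+\tau+\alpha-n)}\,y^{r(2n-2r-\tau-\alpha)}$; (ii) $N_p(n,\tau,\alpha,r)=N_p(n,\alpha,\tau,r)$; (iii) for $n>\tau$, $n\ge\alpha\ge2$,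 $j\ge2$ (with $r=0$): $$N_p(n,\tau,\alpha,0)=\sum_{\zeta=1}^{n-\tau}\binom{n-\tau-1}{\zeta-1}N_p(n-\zeta,\tau,\alpha-\zeta,0)\,d_p(\zeta,\zeta)\,q^{(\zeta-1)(\alpha+\tau-n)}\,y^{(\zeta-1)(2n-\tau-\alpha-\zeta)}\left(y^{\tau}-y^{2n-\alpha-\tau-\zeta}q^{\alpha+\tau-n}\right);$$ (iv) for $\alpha\ge2$ and $j=0$, i.e. $n=\tau+\alpha$: $$N_p(n,\tau,\alpha,0)=\sum_{\zeta=1}^{\alpha-1}\binom{\alpha-2}{\zeta-1}N_p(n-\zeta,\tau,\alpha-\zeta,0)\,d_p(\zeta,\zeta)\,y^{(\zeta-1)(\tau+\alpha-\zeta)}\,y^{\tau}\left(1-y^{\alpha-\zeta}\right);$$ (v) $$N_p(n,n,n,0)=1-\sum_{j=2}^{n-1}\binom{n-2}{j-2}\sum_{\tau=j}^{n}\binom{n-j}{\tau-j}\sum_{\alpha=j}^{n-\tau+j}\binom{n-\tau}{\alpha-j}N_p(n,\tau,\alpha,n-\alpha-\tau+j)-\sum_{\tau=1}^{n}\binom{n-2}{\tau-1}\sum_{\alpha=1}^{n-\tau}\binom{n-\tau-1}{\alpha-1}N_p(n,\tau,\alpha,n-\alpha-\tau).$$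
   Context: Probabilities are in the joint space of the random graph and the random orientations. The value $j=1$ never occurs, since if $A\cap T\neq\emptyset$ then $a,t\in A\cap T$.
   Formalization: The probability p ranges over rationals in [0,1] rather than reals; d_p and N_p are defined on one canonical choice of vertices and sets, and the parenthetical invariance and initial values (d_p(1,1)=1, N_p(2,2,2,0)=x, N_p(2,1,1,0)=y) are not restated. -}

module Defs where

open import Data.Nat as ℕ using (ℕ; zero; suc; _∸_; _≤ᵇ_; _<ᵇ_; _≡ᵇ_)
open import Data.Bool using (Bool; true; false; _∧_; _∨_; not; if_then_else_)
open import Data.Product using (_×_; _,_)
open import Data.List using (List; []; _∷_; map; concatMap; upTo; zip; foldr; length)
open import Data.Bool.ListAction using (any; all)
open import Data.Integer using (+_)
open import Data.Nat.Combinatorics using (_C_)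
open import Data.Rational using (ℚ; _/_; 0ℚ; 1ℚ; ½; _+_; _*_; _-_)

ℕ→ℚ : ℕ → ℚ
ℕ→ℚ n = + n / 1

infixr 8 _^ℚ_
_^ℚ_ : ℚ → ℕ → ℚ
b ^ℚ zero  = 1ℚ
b ^ℚ suc k = b * (b ^ℚ k)

-- Σ_{i = lo}^{hi} f i  (empty, i.e. 0, when hi < lo)
sumFromTo : ℕ → ℕ → (ℕ → ℚ) → ℚ
sumFromTo lo hi f = foldr (λ i acc → f (lo ℕ.+ i) + acc) 0ℚ (upTo (suc hi ∸ lo))

binom : ℕ → ℕ → ℚ
binom n k = ℕ→ℚ (n C k)

-- The random oriented graph G⃗(n,p) on vertex set [n] = {0,…,n-1}.
-- For each unordered pair {i,j} (i<j) exactly one of three things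
-- happens: no edge (prob. q = 1-p), edge oriented i→j (prob. p/2),
-- edge oriented j→i (prob. p/2).

data Dir : Set where
  none fwd bwd : Dir

allDirs : List Dir
allDirs = none ∷ fwd ∷ bwd ∷ []

pairs : ℕ → List (ℕ × ℕ)
pairs n = concatMap (λ j → map (λ i → (i , j)) (upTo j)) (upTo n)

dirLists : ℕ → List (List Dir)
dirLists zero    = [] ∷ []
dirLists (suc m) = concatMap (λ d → map (d ∷_) (dirLists m)) allDirs

Outcome : Set
Outcome = List ((ℕ × ℕ) × Dir)

outcomes : ℕ → List Outcome
outcomes n = map (zip (pairs n)) (dirLists (length (pairs n)))

isFwd : Dir → Bool
isFwd fwd = true
isFwd _   = false

isBwd : Dir → Bool
isBwd bwd = true
isBwd _   = false

arc : Outcome → ℕ → ℕ → Bool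
arc o u v = any step o
  where
  step : (ℕ × ℕ) × Dir → Bool
  step ((i , j) , d) = ((i ≡ᵇ u) ∧ (j ≡ᵇ v) ∧ isFwd d) ∨ ((i ≡ᵇ v) ∧ (j ≡ᵇ u) ∧ isBwd d)

xOf : ℚ → ℚ
xOf p = p * ½

yOf : ℚ → ℚ
yOf p = 1ℚ - p * ½

qOf : ℚ → ℚ
qOf p = 1ℚ - p

weightDir : ℚ → Dir → ℚ
weightDir p none = qOf p
weightDir p fwd  = xOf p
weightDir p bwd  = xOf p

weight : ℚ → Outcome → ℚ
weight p o = foldr (λ e acc → weightDir p (Data.Product.proj₂ e) * acc) 1ℚ o
  where import Data.Product

Prob : ℚ → ℕ → (Outcome → Bool) → ℚ
Prob p n E = foldr (λ o acc → (if E o then weight p o else 0ℚ) + acc) 0ℚ (outcomes n)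

-- Clusters. A subset of [n] is a membership predicate ℕ → Bool,
-- only consulted on 0,…,n-1.

reachWithin : (ℕ → ℕ → Bool) → ℕ → ℕ → ℕ → ℕ → Bool
reachWithin e n zero    v u = u ≡ᵇ v
reachWithin e n (suc k) v u =
  reachWithin e n k v u ∨ any (λ w → reachWithin e n k v w ∧ e w u) (upTo n)

-- out-cluster C⃗_v : u such that there is a directed path v ⇝ u
-- (a directed path in an n-vertex graph has length ≤ n - 1 ≤ n; v ∈ C⃗_v)
outCluster : ℕ → Outcome → ℕ → (ℕ → Bool)
outCluster n o v = reachWithin (arc o) n n v

inCluster : ℕ → Outcome → ℕ → (ℕ → Bool)
inCluster n o v = reachWithin (λ a b → arc o b a) n n v

eqBool : Bool → Bool → Bool
eqBool true  b = b
eqBool false b = not b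

sameSet : ℕ → (ℕ → Bool) → (ℕ → Bool) → Bool
sameSet n S T = all (λ u → eqBool (S u) (T u)) (upTo n)

-- d_p(n,k) = P(C⃗_s = S) for s ∈ S ⊆ [n], |S| = k.
-- Canonical choice: s = 0, S = {0,…,k-1}.

dP : ℚ → ℕ → ℕ → ℚ
dP p n k = Prob p n (λ o → sameSet n (outCluster n o 0) (λ u → u <ᵇ k))

-- N_p(n,τ,α,r) = P(C⃗_t = T , C⃖_a = A) for distinct a,t ∈ [n],
-- t ∈ T, a ∈ A, |T| = τ, |A| = α, |[n] ∖ (A ∪ T)| = r.
-- Canonical configuration, with j = τ + α - (n - r) = |A ∩ T|:
--   A ∩ T = {0,…,j-1},  T ∖ A = {j,…,τ-1},
--   A ∖ T = {τ,…,τ+α-j-1},  rest = {τ+α-j,…,n-1} (r vertices).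
-- Choice of t, a (both in A ∩ T whenever j ≥ 2):
--   j ≥ 2 : t = 0, a = 1
--   j = 0 : t = 0, a = τ
--   j = 1 : t = 0, a = τ if α ≥ 2; t = 1, a = 0 if α = 1, τ ≥ 2.

jOf : ℕ → ℕ → ℕ → ℕ → ℕ
jOf n τ α r = (τ ℕ.+ α) ∸ (n ∸ r)

validN : ℕ → ℕ → ℕ → ℕ → Bool
validN n τ α r =
  (2 ≤ᵇ n) ∧ (1 ≤ᵇ τ) ∧ (1 ≤ᵇ α) ∧ (r <ᵇ n) ∧ (τ ≤ᵇ (n ∸ r)) ∧ (α ≤ᵇ (n ∸ r))
  ∧ ((n ∸ r) ≤ᵇ (τ ℕ.+ α))
  ∧ not ((jOf n τ α r ≡ᵇ 1) ∧ (τ ≡ᵇ 1) ∧ (α ≡ᵇ 1))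

tOf : ℕ → ℕ → ℕ → ℕ → ℕ
tOf n τ α r = if (jOf n τ α r ≡ᵇ 1) ∧ (α ≡ᵇ 1) then 1 else 0

aOf : ℕ → ℕ → ℕ → ℕ → ℕ
aOf n τ α r =
  if 2 ≤ᵇ jOf n τ α r then 1
  else if (jOf n τ α r ≡ᵇ 1) ∧ (α ≡ᵇ 1) then 0
  else τ

TOf : ℕ → ℕ → ℕ → ℕ → (ℕ → Bool)
TOf n τ α r u = u <ᵇ τ

AOf : ℕ → ℕ → ℕ → ℕ → (ℕ → Bool)
AOf n τ α r u = (u <ᵇ jOf n τ α r) ∨ ((τ ≤ᵇ u) ∧ (u <ᵇ (τ ℕ.+ α) ∸ jOf n τ α r))

-- N_p(n,τ,α,r); set to 0 for parameters admitting no configuration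
NP : ℚ → ℕ → ℕ → ℕ → ℕ → ℚ
NP p n τ α r =
  if validN n τ α r
  then Prob p n (λ o → sameSet n (outCluster n o (tOf n τ α r)) (TOf n τ α r)
                     ∧ sameSet n (inCluster n o (aOf n τ α r)) (AOf n τ α r))
  else 0ℚ

{-# OPTIONS --safe #-}

-- The random digraph is revealed pair by pair: 𝔼 iterates the mean over the three states of a pair.  Reordering,
-- relabelling and reversing the digraph, and independence over disjoint sets of pairs, are then formal, so the
-- probability of a cluster event depends only on the word of vertex classes (in T? in A? equal to t? to a?) up to
-- permutation.
--
-- (i) A vertex outside A ∪ T only forbids arcs between it and the rest, independently of the rest.
-- (ii) Reversing all arcs exchanges (t, T) and (a, A).
-- (iii), (iv) Fix v ∈ A ∖ (T ∪ {a}) and let Z consist of v and of the vertices whose paths to a all pass through v.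
-- Then Z ⊆ A ∖ T, and the event says: it holds for (T, A ∖ Z) on the complement of Z; Z is the in-cluster of v inside Z;
-- no arc leads from T into Z ∖ {v} or from Z ∖ {v} into A ∖ Z; and v is not entered from T but has an arc into A ∖ Z.
-- These conditions concern disjoint sets of pairs.  The last is "not entered from T" minus "neither entered from T nor
-- left into A", whence the difference in the formula.
-- (v) The events partition the space.  If t reaches a then a, t ∈ A ∩ T; otherwise A ∩ T = ∅.
module Submission where

open import Defs
open import Data.Nat using (ℕ; _∸_; _≤_; _<_) renaming (_+_ to _+ℕ_; _*_ to _*ℕ_)
open import Data.Rational using (ℚ; 0ℚ; 1ℚ; _+_; _*_; _-_) renaming (_≤_ to _≤ℚ_)
open import Data.Product using (_×_)
open import Relation.Binary.PropositionalEquality using (_≡_)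

open import Algebra.Structures using (IsCommutativeRing)
open import Data.Bool using (Bool; true; false; _∧_; _∨_; not; if_then_else_; T)
open import Data.Bool.ListAction using (and; or; any; all)
open import Data.Bool.Properties using (∧-assoc; ∧-comm; ∧-identityʳ; ∧-zeroʳ; ∨-assoc; ∨-comm; ∨-identityʳ; ∨-zeroʳ)
open import Data.Empty using (⊥; ⊥-elim)
import Data.Integer as ℤ
import Data.Integer.Properties as ℤ
open import Data.List using (List; []; _∷_; _++_; map; concatMap; foldr; zip; length; upTo; applyUpTo; replicate)
open import Data.List.Membership.Propositional using (_∈_; _∉_)
open import Data.List.Membership.Propositional.Properties using (∈-map⁺; ∈-map⁻; ∈-++⁺ˡ; ∈-++⁺ʳ; ∈-++⁻)
open import Data.List.Properties using
  ( ∷-injectiveˡ; ∷-injectiveʳ; ++-assoc; ++-identityʳ; map-++; map-id; map-∘; map-cong; map-replicate; map-upTo; map-applyUpTo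
  ; concatMap-++; length-map; length-replicate; length-upTo; upTo-∷ʳ )
open import Data.List.Relation.Binary.Permutation.Propositional
open import Data.List.Relation.Binary.Permutation.Propositional.Properties as ↭ using (∈-resp-↭; ↭-map-inv)
open import Data.List.Relation.Binary.Permutation.Setoid.Properties using (Unique-resp-↭)
open import Data.List.Relation.Unary.All as All using (All; []; _∷_)
open import Data.List.Relation.Unary.AllPairs as AllPairs using ([]; _∷_)
open import Data.List.Relation.Unary.Any using (here; there)
open import Data.List.Relation.Unary.Unique.Propositional using (Unique)
open import Data.List.Relation.Unary.Unique.Propositional.Properties using (upTo⁺)
import Data.Nat as ℕ
open import Data.Nat using (zero; suc; _≡ᵇ_; _≤ᵇ_; _<ᵇ_; z≤n; s≤s)
open import Data.Nat.Combinatorics using (_C_; nCk+nC[k+1]≡[n+1]C[k+1]; k>n⇒nCk≡0; nCn≡1)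
import Data.Nat.Properties as ℕ
open import Data.Nat.Tactic.RingSolver using (solve-∀)
open import Data.Product using (_,_; proj₁; proj₂; ∃; map₁)
open import Data.Rational using (½; -_; toℚᵘ; fromℚᵘ)
import Data.Rational.Properties as ℚ
open import Data.Rational.Unnormalised as ℚᵘ using (mkℚᵘ; *≡*)
import Data.Rational.Unnormalised.Properties as ℚᵘ
open import Data.Sum using (_⊎_; inj₁; inj₂; [_,_]′)
open import Data.Unit using (⊤; tt)
open import Function using (_∘_; id)
open import Relation.Binary.PropositionalEquality as ≡
  using (_≢_; refl; sym; cong; cong₂; subst; subst₂; setoid; module ≡-Reasoning)
open import Relation.Nullary using (¬_)

-- The constants come from counting. With `r = 0` and `j = |A ∩ T|`, the removed set Z has ζ
-- elements, one of them the fixed `v`. For `j ≥ 2` the other ζ - 1 come from n - τ - 1 vertices of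
-- A ∖ T; for `j = 0` the vertex `a` is kept too, which leaves α - 2. Each of these ζ - 1 vertices
-- is sealed off from the n - ζ kept ones: a kept vertex of A ∩ T forbids both arcs and costs `q`,
-- one in exactly one of the sets forbids one arc and costs `y`. There are j of the first kind and
-- 2n - τ - α - ζ of the second. The factor d_p(ζ, ζ) is the in-cluster of `v` with all arcs
-- reversed.
--
-- The obstacle is that Z depends on the digraph. So the event is first multiplied by a sum of
-- indicators equal to one, over all splits of the candidates into those that can bypass `v` and
-- those that cannot; for a fixed split the conditions concern disjoint sets of pairs and
-- independence applies.
--
-- There `NP` is zero, because the event is impossible or the parameters are rejected, and this has
-- to be shown separately.

private variable
  X Y : Set

-- Lists of vertex pairs

star : X → List X → List (X × X)
star v = map (v ,_)

cross : List X → List X → List (X × X)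
cross vs ws = concatMap (λ v → star v ws) vs

edges : List X → List (X × X)
edges []      = []
edges (v ∷ V) = star v V ++ edges V

star-∈ : ∀ {v a b : X} W → (a , b) ∈ star v W → a ≡ v × b ∈ W
star-∈ W i with _ , j , refl ← ∈-map⁻ _ i = refl , j

cross-∈ : ∀ {a b : X} U W → (a , b) ∈ cross U W → a ∈ U × b ∈ W
cross-∈ (u ∷ U) W i with ∈-++⁻ (star u W) i
... | inj₁ j with refl , k ← star-∈ W j = here refl , k
... | inj₂ j = map₁ there (cross-∈ U W j)

edges-∈ : ∀ {a b : X} V → (a , b) ∈ edges V → a ∈ V × b ∈ V
edges-∈ (v ∷ V) i with ∈-++⁻ (star v V) i
... | inj₁ j with refl , k ← star-∈ V j = here refl , there k
... | inj₂ j with k , l ← edges-∈ V j = there k , there l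

-- Pairs inside `U`, pairs across and pairs inside `W`: this division is what later yields
-- independence.
edges-++ : (U W : List X) → edges (U ++ W) ↭ edges U ++ (cross U W ++ edges W)
edges-++ []      W = ↭-refl
edges-++ (u ∷ U) W = begin
  star u (U ++ W) ++ edges (U ++ W)
    ≡⟨ cong (_++ edges (U ++ W)) (map-++ (u ,_) U W) ⟩
  (star u U ++ star u W) ++ edges (U ++ W)
    ↭⟨ ↭.++⁺ˡ _ (edges-++ U W) ⟩
  (star u U ++ star u W) ++ (edges U ++ (cross U W ++ edges W))
    ≡⟨ ++-assoc (star u U) (star u W) _ ⟩
  star u U ++ (star u W ++ (edges U ++ (cross U W ++ edges W)))
    ↭⟨ ↭.++⁺ˡ (star u U) (↭.shifts (star u W) (edges U)) ⟩
  star u U ++ (edges U ++ (star u W ++ (cross U W ++ edges W)))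
    ≡⟨ cong (λ E → star u U ++ (edges U ++ E)) (++-assoc (star u W) (cross U W) _) ⟨
  star u U ++ (edges U ++ (cross (u ∷ U) W ++ edges W))
    ≡⟨ ++-assoc (star u U) (edges U) _ ⟨
  edges (u ∷ U) ++ (cross (u ∷ U) W ++ edges W) ∎
  where open PermutationReasoning

map-edges : (φ : X → Y) (V : List X) →
  map (λ uv → φ (proj₁ uv) , φ (proj₂ uv)) (edges V) ≡ edges (map φ V)
map-edges φ []      = refl
map-edges φ (v ∷ V) = ≡.trans (map-++ _ (star v V) (edges V)) (cong₂ _++_ (lem V) (map-edges φ V))
  where
  lem : ∀ W → map (λ uv → φ (proj₁ uv) , φ (proj₂ uv)) (star v W) ≡ star (φ v) (map φ W)
  lem []      = refl
  lem (w ∷ W) = cong (_ ∷_) (lem W)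

-- Digraphs as arc functions, built by revealing pairs

Digraph : Set
Digraph = ℕ → ℕ → Bool

∅ : Digraph
∅ _ _ = false

arrow : ℕ × ℕ → Dir → Digraph
arrow (i , j) d u v = ((i ≡ᵇ u) ∧ (j ≡ᵇ v) ∧ isFwd d) ∨ ((i ≡ᵇ v) ∧ (j ≡ᵇ u) ∧ isBwd d)

-- Arcs are added, never overwritten, so updates commute even when pairs repeat.
link : ℕ × ℕ → Dir → Digraph → Digraph
link a d e u v = e u v ∨ arrow a d u v

opposite : Dir → Dir
opposite none = none
opposite fwd  = bwd
opposite bwd  = fwd

arrow-flip : ∀ i j d u v → arrow (i , j) d u v ≡ arrow (j , i) (opposite d) u v
arrow-flip i j d u v = ≡.trans (∨-comm ((i ≡ᵇ u) ∧ (j ≡ᵇ v) ∧ isFwd d) _)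
  (cong₂ _∨_ (lem (i ≡ᵇ v) (j ≡ᵇ u) (bwd-opposite d)) (lem (i ≡ᵇ u) (j ≡ᵇ v) (fwd-opposite d)))
  where
  lem : ∀ a b {k l} → k ≡ l → a ∧ b ∧ k ≡ b ∧ a ∧ l
  lem true  true  p = p
  lem true  false p = refl
  lem false true  p = refl
  lem false false p = refl
  bwd-opposite : ∀ d → isBwd d ≡ isFwd (opposite d)
  bwd-opposite none = refl
  bwd-opposite fwd  = refl
  bwd-opposite bwd  = refl
  fwd-opposite : ∀ d → isFwd d ≡ isBwd (opposite d)
  fwd-opposite none = refl
  fwd-opposite fwd  = refl
  fwd-opposite bwd  = refl

≡ᵇ-true : ∀ m n → (m ≡ᵇ n) ≡ true → m ≡ n
≡ᵇ-true m n p = ℕ.≡ᵇ⇒≡ m n (subst T (sym p) tt)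

≡ᵇ-refl : ∀ n → (n ≡ᵇ n) ≡ true
≡ᵇ-refl zero    = refl
≡ᵇ-refl (suc n) = ≡ᵇ-refl n

≡ᵇ-false : ∀ {m n} → m ≢ n → (m ≡ᵇ n) ≡ false
≡ᵇ-false {m} {n} m≢n with m ≡ᵇ n in eq
... | true  = ⊥-elim (m≢n (≡ᵇ-true m n eq))
... | false = refl

arrow-elsewhere : ∀ i j u v d → ¬ (i ≡ u × j ≡ v) → ¬ (i ≡ v × j ≡ u) → arrow (i , j) d u v ≡ false
arrow-elsewhere i j u v d h k = cong₂ _∨_ (lem i u j v (isFwd d) h) (lem i v j u (isBwd d) k)
  where
  lem : ∀ a b c d z → ¬ (a ≡ b × c ≡ d) → (a ≡ᵇ b) ∧ (c ≡ᵇ d) ∧ z ≡ false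
  lem a b c d z n with a ≡ᵇ b in eq | c ≡ᵇ d in eq′
  ... | false | _     = refl
  ... | true  | false = refl
  ... | true  | true  = ⊥-elim (n (≡ᵇ-true a b eq , ≡ᵇ-true c d eq′))

Support : Set₁
Support = ℕ → ℕ → Set

Everywhere : Support
Everywhere _ _ = ⊤

Agree : Support → Digraph → Digraph → Set
Agree S e e′ = ∀ u v → S u v → e u v ≡ e′ u v

-- Both orders are excluded, since revealing a listed pair may set the arc in either direction.
Avoids : Support → List (ℕ × ℕ) → Set
Avoids S L = ∀ u v → (u , v) ∈ L → ¬ S u v × ¬ S v u

link-Agree : ∀ {S e e′} a d → Agree S e e′ → Agree S (link a d e) (link a d e′)
link-Agree a d h u v s = cong (_∨ arrow a d u v) (h u v s)

link-avoids : ∀ {S} i j d e → ¬ S i j → ¬ S j i → Agree S (link (i , j) d e) e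
link-avoids i j d e h k u v s =
  ≡.trans (cong (e u v ∨_) (arrow-elsewhere i j u v d (λ { (refl , refl) → h s }) (λ { (refl , refl) → k s })))
          (∨-identityʳ (e u v))

link-comm : ∀ a d b d′ e → Agree Everywhere (link a d (link b d′ e)) (link b d′ (link a d e))
link-comm a d b d′ e u v _ = begin
  (e u v ∨ arrow b d′ u v) ∨ arrow a d u v  ≡⟨ ∨-assoc (e u v) _ _ ⟩
  e u v ∨ (arrow b d′ u v ∨ arrow a d u v)  ≡⟨ cong (e u v ∨_) (∨-comm (arrow b d′ u v) _) ⟩
  e u v ∨ (arrow a d u v ∨ arrow b d′ u v)  ≡⟨ ∨-assoc (e u v) _ _ ⟨
  (e u v ∨ arrow a d u v) ∨ arrow b d′ u v  ∎
  where open ≡-Reasoning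

link-flip : ∀ i j d e → Agree Everywhere (link (i , j) d e) (link (j , i) (opposite d) e)
link-flip i j d e u v _ = cong (e u v ∨_) (arrow-flip i j d u v)

-- Two namings of one index list, instead of a map between vertex sets: the notion is symmetric and
-- no inverse has to be constructed.
Iso : ∀ {Z : Set} → (Z → ℕ) → (Z → ℕ) → List Z → Digraph → Digraph → Set
Iso φ ψ zs e e′ = ∀ z z′ → z ∈ zs → z′ ∈ zs → e (φ z) (φ z′) ≡ e′ (ψ z) (ψ z′)

-- Boolean tests and their logical meaning

true≢false : ∀ {b} → b ≡ true → b ≡ false → ⊥
true≢false refl ()

≡true-ext : ∀ {a b} → (a ≡ true → b ≡ true) → (b ≡ true → a ≡ true) → a ≡ b
≡true-ext {true}  {b}     f g = sym (f refl)
≡true-ext {false} {true}  f g = g refl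
≡true-ext {false} {false} f g = refl

∧-true⁻ : ∀ {a b} → a ∧ b ≡ true → a ≡ true × b ≡ true
∧-true⁻ {true} p = refl , p

∧-true⁺ : ∀ {a b} → a ≡ true → b ≡ true → a ∧ b ≡ true
∧-true⁺ refl refl = refl

∨-true⁻ : ∀ {a b} → a ∨ b ≡ true → a ≡ true ⊎ b ≡ true
∨-true⁻ {true}  p = inj₁ refl
∨-true⁻ {false} p = inj₂ p

∨-true⁺ˡ : ∀ {a b} → a ≡ true → a ∨ b ≡ true
∨-true⁺ˡ refl = refl

∨-true⁺ʳ : ∀ {a b} → b ≡ true → a ∨ b ≡ true
∨-true⁺ʳ {a} refl = ∨-zeroʳ a

not-true⁻ : ∀ {a} → not a ≡ true → ¬ a ≡ true
not-true⁻ {false} _ ()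

not-true⁺ : ∀ {a} → ¬ a ≡ true → not a ≡ true
not-true⁺ {true}  n = ⊥-elim (n refl)
not-true⁺ {false} n = refl

true-or-not : ∀ a → a ≡ true ⊎ ¬ a ≡ true
true-or-not true  = inj₁ refl
true-or-not false = inj₂ λ ()

any-true⁻ : ∀ (p : X → Bool) V → any p V ≡ true → ∃ λ w → w ∈ V × p w ≡ true
any-true⁻ p (v ∷ V) h with ∨-true⁻ {p v} h
... | inj₁ pv = v , here refl , pv
... | inj₂ h′ with w , i , pw ← any-true⁻ p V h′ = w , there i , pw

any-true⁺ : ∀ (p : X → Bool) {V w} → w ∈ V → p w ≡ true → any p V ≡ true
any-true⁺ p (here refl) pw = ∨-true⁺ˡ pw
any-true⁺ p (there i)   pw = ∨-true⁺ʳ {p _} (any-true⁺ p i pw)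

all-true⁻ : ∀ (p : X → Bool) {V w} → all p V ≡ true → w ∈ V → p w ≡ true
all-true⁻ p h (here refl) = proj₁ (∧-true⁻ h)
all-true⁻ p h (there i)   = all-true⁻ p (proj₂ (∧-true⁻ {p _} h)) i

all-true⁺ : ∀ (p : X → Bool) V → (∀ w → w ∈ V → p w ≡ true) → all p V ≡ true
all-true⁺ p []      h = refl
all-true⁺ p (v ∷ V) h = ∧-true⁺ (h v (here refl)) (all-true⁺ p V (λ w i → h w (there i)))

eqBool-true⁻ : ∀ {a b} → eqBool a b ≡ true → a ≡ b
eqBool-true⁻ {true}  p = sym p
eqBool-true⁻ {false} {false} p = refl

eqBool-true⁺ : ∀ {a b} → a ≡ b → eqBool a b ≡ true
eqBool-true⁺ {true}  refl = refl
eqBool-true⁺ {false} refl = refl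

-- Directed reachability and its decision by bounded iteration

-- The source is a predicate so that it may be empty, as for a piece that does not contain `t`. Only
-- the vertices that a path leaves must lie in `V`; membership of the endpoint is supplied where it
-- matters.
data Reach (e : Digraph) (V : List ℕ) (s : ℕ → Bool) : ℕ → Set where
  base : ∀ {u} → s u ≡ true → Reach e V s u
  step : ∀ {w u} → Reach e V s w → w ∈ V → e w u ≡ true → Reach e V s u

Reach-mono : ∀ {e V W s} → (∀ {w} → w ∈ V → w ∈ W) → ∀ {u} → Reach e V s u → Reach e W s u
Reach-mono i (base p)     = base p
Reach-mono i (step r j a) = step (Reach-mono i r) (i j) a

within : Digraph → List ℕ → (ℕ → Bool) → ℕ → ℕ → Bool
within e V s zero    u = s u
within e V s (suc k) u = within e V s k u ∨ any (λ w → within e V s k w ∧ e w u) V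

reach : Digraph → List ℕ → (ℕ → Bool) → ℕ → Bool
reach e V s = within e V s (length V)

count : (ℕ → Bool) → List ℕ → ℕ
count p []      = 0
count p (v ∷ V) with p v
... | true  = suc (count p V)
... | false = count p V

count≤length : ∀ p V → count p V ≤ length V
count≤length p []      = z≤n
count≤length p (v ∷ V) with p v
... | true  = s≤s (count≤length p V)
... | false = ℕ.m≤n⇒m≤1+n (count≤length p V)

count-full : ∀ p V → length V ≤ count p V → ∀ {u} → u ∈ V → p u ≡ true
count-full p (v ∷ V) h i with p v in eq
count-full p (v ∷ V) h         (here refl) | true  = eq
count-full p (v ∷ V) (s≤s h)   (there i)   | true  = count-full p V h i
count-full p (v ∷ V) h         i           | false = ⊥-elim (ℕ.<⇒≱ h (count≤length p V))

count-mono : ∀ p p′ → (∀ u → p u ≡ true → p′ u ≡ true) → ∀ V → count p V ≤ count p′ V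
count-mono p p′ m []      = z≤n
count-mono p p′ m (v ∷ V) with p v in eq | p′ v in eq′
... | true  | true  = s≤s (count-mono p p′ m V)
... | false | true  = ℕ.m≤n⇒m≤1+n (count-mono p p′ m V)
... | false | false = count-mono p p′ m V
... | true  | false with () ← ≡.trans (sym (m v eq)) eq′

count-compare : ∀ p p′ → (∀ u → p u ≡ true → p′ u ≡ true) → ∀ V →
  (∀ {u} → u ∈ V → p′ u ≡ true → p u ≡ true) ⊎ count p V < count p′ V
count-compare p p′ m []      = inj₁ λ ()
count-compare p p′ m (v ∷ V) with p v in eq | p′ v in eq′ | count-compare p p′ m V
... | false | true  | _      = inj₂ (s≤s (count-mono p p′ m V))
... | true  | false | _      with () ← ≡.trans (sym (m v eq)) eq′
... | true  | true  | inj₂ l = inj₂ (s≤s l)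
... | false | false | inj₂ l = inj₂ l
... | true  | true  | inj₁ h = inj₁ λ { (here refl) _ → eq ; (there i) → h i }
... | false | false | inj₁ h =
  inj₁ λ { (here refl) k → ⊥-elim (true≢false k eq′) ; (there i) → h i }

module _ (e : Digraph) (V : List ℕ) (s : ℕ → Bool) where

  private
    Stable : ℕ → Set
    Stable k = ∀ {u} → u ∈ V → within e V s (suc k) u ≡ true → within e V s k u ≡ true

  within-suc : ∀ k u → within e V s k u ≡ true → within e V s (suc k) u ≡ true
  within-suc k u = ∨-true⁺ˡ

  within-step : ∀ k {w u} → within e V s k w ≡ true → w ∈ V → e w u ≡ true → within e V s (suc k) u ≡ true
  within-step k {w} {u} h i a = ∨-true⁺ʳ {within e V s k u} (any-true⁺ _ i (∧-true⁺ h a))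

  within-step⁻ : ∀ k {u} → within e V s (suc k) u ≡ true →
    within e V s k u ≡ true ⊎ ∃ λ w → w ∈ V × within e V s k w ≡ true × e w u ≡ true
  within-step⁻ k {u} h with ∨-true⁻ {within e V s k u} h
  ... | inj₁ p = inj₁ p
  ... | inj₂ p with w , i , pq ← any-true⁻ _ V p with l , r ← ∧-true⁻ {within e V s k w} pq = inj₂ (w , i , l , r)

  within⇒Reach : ∀ k {u} → within e V s k u ≡ true → Reach e V s u
  within⇒Reach zero    h = base h
  within⇒Reach (suc k) h with within-step⁻ k h
  ... | inj₁ p               = within⇒Reach k p
  ... | inj₂ (w , i , p , a) = step (within⇒Reach k p) i a

  stable-suc : ∀ k → Stable k → Stable (suc k)
  stable-suc k st i h with within-step⁻ (suc k) h
  ... | inj₁ p               = p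
  ... | inj₂ (w , j , p , a) = within-step k (st j p) j a

  -- A round that still changes something adds at least one vertex of `V`, so `k` unstable rounds
  -- account for `k` vertices.
  stable-or-large : ∀ k → Stable k ⊎ k ≤ count (within e V s k) V
  stable-or-large zero    = inj₂ z≤n
  stable-or-large (suc k) with stable-or-large k
  ... | inj₁ st = inj₁ (stable-suc k st)
  ... | inj₂ l  with count-compare (within e V s k) (within e V s (suc k)) (within-suc k) V
  ...   | inj₁ st = inj₁ (stable-suc k st)
  ...   | inj₂ l′ = inj₂ (ℕ.≤-<-trans l l′)

  -- In the second alternative all of `V` has been reached, so again nothing can be added.
  stable-length : Stable (length V)
  stable-length i h with stable-or-large (length V)
  ... | inj₁ st = st i h
  ... | inj₂ l  = count-full _ V l i

  within-zero : ∀ k u → s u ≡ true → within e V s k u ≡ true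
  within-zero zero    u p = p
  within-zero (suc k) u p = within-suc k u (within-zero k u p)

  reach⇒Reach : ∀ {u} → reach e V s u ≡ true → Reach e V s u
  reach⇒Reach = within⇒Reach (length V)

  Reach⇒reach : ∀ {u} → u ∈ V → Reach e V s u → reach e V s u ≡ true
  Reach⇒reach {u} i (base p)   = within-zero (length V) u p
  Reach⇒reach i (step r j a) = stable-length i (within-step (length V) (Reach⇒reach j r) j a)

-- Vertex classes and the cluster event

-- inT and inA record membership in T and A; isS and isK mark t and a.
record Cls : Set where
  constructor cls
  field inT inA isS isK : Bool
open Cls public

reversed : Digraph → Digraph
reversed e u v = e v u

record Cluster (e : Digraph) (V : List ℕ) (s T : ℕ → Bool) : Set where
  constructor cluster
  field
    reached : ∀ {u} → u ∈ V → Reach e V s u → T u ≡ true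
    reaches : ∀ {u} → u ∈ V → T u ≡ true → Reach e V s u
open Cluster public

isCluster : Digraph → List ℕ → (ℕ → Bool) → (ℕ → Bool) → Bool
isCluster e V s T = all (λ u → eqBool (reach e V s u) (T u)) V

isCluster⁻ : ∀ e V s T → isCluster e V s T ≡ true → Cluster e V s T
isCluster⁻ e V s T h = cluster
  (λ i r → ≡.trans (sym (eq i)) (Reach⇒reach e V s i r))
  (λ i p → reach⇒Reach e V s (≡.trans (eq i) p))
  where
  eq : ∀ {u} → u ∈ V → reach e V s u ≡ T u
  eq i = eqBool-true⁻ (all-true⁻ _ h i)

isCluster⁺ : ∀ e V s T → Cluster e V s T → isCluster e V s T ≡ true
isCluster⁺ e V s T cl = all-true⁺ _ V λ u i → eqBool-true⁺
  (≡true-ext (λ p → reached cl i (reach⇒Reach e V s p)) (λ p → Reach⇒reach e V s i (reaches cl i p)))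

Event : List ℕ → (ℕ → Cls) → Digraph → Set
Event V c e = Cluster e V (isS ∘ c) (inT ∘ c) × Cluster (reversed e) V (isK ∘ c) (inA ∘ c)

opaque
  -- Opaque, so that arguments about it pass through `Event` and never unfold the bounded iteration;
  -- `event-def` is the one door to the concrete definition.
  event : List ℕ → (ℕ → Cls) → Digraph → Bool
  event V c e = isCluster e V (isS ∘ c) (inT ∘ c) ∧ isCluster (reversed e) V (isK ∘ c) (inA ∘ c)

  event-def : ∀ V c e → event V c e ≡ isCluster e V (isS ∘ c) (inT ∘ c) ∧ isCluster (reversed e) V (isK ∘ c) (inA ∘ c)
  event-def V c e = refl

  event⁻ : ∀ V c e → event V c e ≡ true → Event V c e
  event⁻ V c e h with p , r ← ∧-true⁻ {isCluster e V (isS ∘ c) (inT ∘ c)} h =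
    isCluster⁻ e V _ _ p , isCluster⁻ (reversed e) V _ _ r

  event⁺ : ∀ V c e → Event V c e → event V c e ≡ true
  event⁺ V c e (p , r) = ∧-true⁺ (isCluster⁺ e V _ _ p) (isCluster⁺ (reversed e) V _ _ r)

event-ext : ∀ {V c e V′ c′ e′} → (Event V c e → Event V′ c′ e′) → (Event V′ c′ e′ → Event V c e) →
  event V c e ≡ event V′ c′ e′
event-ext {V} {c} {e} {V′} {c′} {e′} f g =
  ≡true-ext (λ h → event⁺ V′ c′ e′ (f (event⁻ V c e h))) (λ h → event⁺ V c e (g (event⁻ V′ c′ e′ h)))

module _ {Z : Set} (φ ψ : Z → ℕ) (zs : List Z) where

  Reach-relabel : ∀ {e e′ s s′} → Iso φ ψ zs e e′ → (∀ z → z ∈ zs → s (φ z) ≡ s′ (ψ z)) →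
    ∀ {u} → Reach e (map φ zs) s u → ∀ z → z ∈ zs → u ≡ φ z → Reach e′ (map ψ zs) s′ (ψ z)
  Reach-relabel h k (base p) z i refl = base (≡.trans (sym (k z i)) p)
  Reach-relabel h k (step r j a) z i refl with z′ , i′ , refl ← ∈-map⁻ φ j =
    step (Reach-relabel h k r z′ i′ refl) (∈-map⁺ ψ i′) (≡.trans (sym (h z′ z i′ i)) a)

module _ {Z : Set} (φ ψ : Z → ℕ) (zs : List Z) where

  Cluster-relabel : ∀ {e e′ s s′ T T′} → Iso φ ψ zs e e′ →
    (∀ z → z ∈ zs → s (φ z) ≡ s′ (ψ z)) → (∀ z → z ∈ zs → T (φ z) ≡ T′ (ψ z)) →
    Cluster e (map φ zs) s T → Cluster e′ (map ψ zs) s′ T′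
  Cluster-relabel {e} {e′} {s} {s′} {T} {T′} h k l cl = cluster to from
    where
    to : ∀ {u} → u ∈ map ψ zs → Reach e′ (map ψ zs) s′ u → T′ u ≡ true
    to i r with z , j , refl ← ∈-map⁻ ψ i = ≡.trans (sym (l z j)) (reached cl (∈-map⁺ φ j)
      (Reach-relabel ψ φ zs (λ z z′ i i′ → sym (h z z′ i i′)) (λ z i → sym (k z i)) r z j refl))
    from : ∀ {u} → u ∈ map ψ zs → T′ u ≡ true → Reach e′ (map ψ zs) s′ u
    from i p with z , j , refl ← ∈-map⁻ ψ i =
      Reach-relabel φ ψ zs h k (reaches cl (∈-map⁺ φ j) (≡.trans (l z j) p)) z j refl

  Event-relabel : ∀ {e e′ c c′} → Iso φ ψ zs e e′ → (∀ z → z ∈ zs → c (φ z) ≡ c′ (ψ z)) →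
    Event (map φ zs) c e → Event (map ψ zs) c′ e′
  Event-relabel h k (p , r) =
    Cluster-relabel h (λ z i → cong isS (k z i)) (λ z i → cong inT (k z i)) p ,
    Cluster-relabel (λ z z′ i i′ → h z′ z i′ i) (λ z i → cong isK (k z i)) (λ z i → cong inA (k z i)) r

event-relabel : ∀ {Z : Set} (φ ψ : Z → ℕ) zs {e e′ c c′} → Iso φ ψ zs e e′ → (∀ z → z ∈ zs → c (φ z) ≡ c′ (ψ z)) →
  event (map φ zs) c e ≡ event (map ψ zs) c′ e′
event-relabel φ ψ zs h k = event-ext (Event-relabel φ ψ zs h k)
  (Event-relabel ψ φ zs (λ z z′ i i′ → sym (h z z′ i i′)) (λ z i → sym (k z i)))

Cluster-resp : ∀ {e V W s T} → (∀ {w} → w ∈ V → w ∈ W) → (∀ {w} → w ∈ W → w ∈ V) → Cluster e V s T → Cluster e W s T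
Cluster-resp f g cl = cluster (λ i r → reached cl (g i) (Reach-mono g r)) (λ i p → Reach-mono f (reaches cl (g i) p))

-- The iteration bound depends on `length V`, but the meaning of the test mentions `V` only through
-- membership.
event-resp : ∀ {V W} c e → (∀ {w} → w ∈ V → w ∈ W) → (∀ {w} → w ∈ W → w ∈ V) → event V c e ≡ event W c e
event-resp c e f g = event-ext
  (λ (p , r) → Cluster-resp f g p , Cluster-resp f g r)
  (λ (p , r) → Cluster-resp g f p , Cluster-resp g f r)

Inside : List ℕ → Support
Inside V u v = u ∈ V × v ∈ V

event-Local : ∀ V c e e′ → Agree (Inside V) e e′ → event V c e ≡ event V c e′
event-Local V c e e′ h = subst (λ L → event L c e ≡ event L c e′) (map-id V)
  (event-relabel id id V (λ z z′ i i′ → h z z′ (i , i′)) (λ _ _ → refl))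

-- Removing the vertices cut off from a by the removal of v

plainA : Cls
plainA = cls false true false false

-- In A, such a vertex reaches a without leaving T ∪ {a}, so no vertex of A ∖ T cuts it off.
Core : Cls → Set
Core k = inT k ≡ true ⊎ isK k ≡ true

-- Either arc would pull `z` into a cluster by way of `w`: the first lets `z` reach `a`, the second
-- lets `t` reach `z`.
record Sealed (e : Digraph) (c : ℕ → Cls) (z w : ℕ) : Set where
  constructor seal
  field
    noExit  : ¬ (e z w ≡ true × inA (c w) ≡ true)
    noEntry : ¬ (e w z ≡ true × inT (c w) ≡ true)
open Sealed public

-- Inside the piece `v` takes the role of `a` and everything must reach it. No vertex is marked as
-- `t` or lies in `T`, which makes the out-cluster half of the event trivial.
pieceCls : ℕ → ℕ → Cls
pieceCls v u = cls false true false (u ≡ᵇ v)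

-- As sets, `V` is `v` together with `U`, and `U` is `Z` together with `W`. So `Bypass` means
-- reaching `a` in the digraph without `v`, and `W` is what remains after the removal. Working with
-- membership alone keeps the order of the lists out of the argument.
module Peel
  (e : Digraph) (c : ℕ → Cls) (v : ℕ) {V U Z W : List ℕ}
  (V⊆ : ∀ {u} → u ∈ V → u ≡ v ⊎ u ∈ U) (v∈V : v ∈ V) (U⊆V : ∀ {u} → u ∈ U → u ∈ V)
  (U⊆ : ∀ {u} → u ∈ U → u ∈ Z ⊎ u ∈ W) (Z⊆U : ∀ {u} → u ∈ Z → u ∈ U) (W⊆U : ∀ {u} → u ∈ W → u ∈ U)
  (cZ : ∀ {z} → z ∈ v ∷ Z → c z ≡ plainA) (cW : ∀ {w} → w ∈ W → c w ≡ plainA ⊎ Core (c w))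
  where

  private
    Bypass : ℕ → Set
    Bypass = Reach (reversed e) U (isK ∘ c)

    ToV : ℕ → Set
    ToV = Reach (reversed e) (v ∷ Z) (isK ∘ pieceCls v)

    V⊆′ : ∀ {u} → u ∈ V → u ∈ v ∷ Z ⊎ u ∈ W
    V⊆′ i with V⊆ i
    ... | inj₁ refl = inj₁ (here refl)
    ... | inj₂ j with U⊆ j
    ...   | inj₁ k = inj₁ (there k)
    ...   | inj₂ k = inj₂ k

    W⊆V : ∀ {u} → u ∈ W → u ∈ V
    W⊆V i = U⊆V (W⊆U i)

    Z⊆V : ∀ {u} → u ∈ v ∷ Z → u ∈ V
    Z⊆V (here refl) = v∈V
    Z⊆V (there i)   = U⊆V (Z⊆U i)

    Z∉T : ∀ {u} → u ∈ v ∷ Z → inT (c u) ≡ true → ⊥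
    Z∉T i p = true≢false p (cong inT (cZ i))

    Z∉S : ∀ {u} → u ∈ v ∷ Z → isS (c u) ≡ true → ⊥
    Z∉S i p = true≢false p (cong isS (cZ i))

    Z∉K : ∀ {u} → u ∈ v ∷ Z → isK (c u) ≡ true → ⊥
    Z∉K i p = true≢false p (cong isK (cZ i))

    Z∈A : ∀ {u} → u ∈ v ∷ Z → inA (c u) ≡ true
    Z∈A i = cong inA (cZ i)

    T⊆W : ∀ {u} → u ∈ V → inT (c u) ≡ true → u ∈ W
    T⊆W i p with V⊆′ i
    ... | inj₁ j = ⊥-elim (Z∉T j p)
    ... | inj₂ j = j

  -- `exit` denies sealing instead of exhibiting an arc, because its probability is computed as that
  -- of a difference of events. Given `entry`, it amounts to an arc from `v` to a vertex of `A` in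
  -- `W`.
  record Pieces : Set where
    constructor pieces
    field
      rest  : Event W c e
      piece : Event (v ∷ Z) (pieceCls v) e
      sealZ : ∀ z w → z ∈ Z → w ∈ W → Sealed e c z w
      entry : ∀ w → w ∈ W → ¬ (e w v ≡ true × inT (c w) ≡ true)
      exit  : ¬ (∀ w → w ∈ W → Sealed e c v w)
  open Pieces public

  module Forward (ev : Event V c e)
    (¬b : ∀ z → z ∈ Z → ¬ Bypass z) (b : ∀ w → w ∈ W → c w ≡ plainA → Bypass w) where

    private
      outs = proj₁ ev
      ins  = proj₂ ev

      -- All vertices on a path from `t` are themselves in `T`, hence in `W`.
      T⇒W-Reach : ∀ {u} → u ∈ V → Reach e V (isS ∘ c) u → Reach e W (isS ∘ c) u
      T⇒W-Reach i (base p)     = base p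
      T⇒W-Reach i (step r j a) = step (T⇒W-Reach j r) (T⊆W j (reached outs j r)) a

      -- From a vertex of `T`, each further vertex on the path to `a` is again reached from `t`. The
      -- path therefore stays in `T` and never meets `v` or `Z`.
      coreBypass : ∀ {u} → u ∈ V → inT (c u) ≡ true → Reach (reversed e) V (isK ∘ c) u → Bypass u
      coreBypass i t (base p) = base p
      coreBypass i t (step r j a) =
        let t′ = reached outs j (step (reaches outs i t) i a)
        in  step (coreBypass j t′ r) (W⊆U (T⊆W j t′)) a

      bW : ∀ w → w ∈ W → inA (c w) ≡ true → Bypass w
      bW w i p with cW i
      ... | inj₁ q        = b w i q
      ... | inj₂ (inj₁ t) = coreBypass (W⊆V i) t (reaches ins (W⊆V i) p)
      ... | inj₂ (inj₂ k) = base k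

      Bypass⇒W : ∀ {u} → u ∈ U → Bypass u → u ∈ W
      Bypass⇒W i p with U⊆ i
      ... | inj₁ j = ⊥-elim (¬b _ j p)
      ... | inj₂ j = j

      Bypass⇒W-Reach : ∀ {u} → Bypass u → Reach (reversed e) W (isK ∘ c) u
      Bypass⇒W-Reach (base p)     = base p
      Bypass⇒W-Reach (step r j a) = step (Bypass⇒W-Reach r) (Bypass⇒W j r) a

      -- Follow the path towards `a`. It cannot step from `Z` into `W`: the vertex entered would lie
      -- in `A`, hence have a bypass, and would hand it on to its predecessor in `Z`. So the path
      -- meets `v` first.
      toV : ∀ {u} → u ∈ v ∷ Z → Reach (reversed e) V (isK ∘ c) u → ToV u
      toV (here refl) _        = base (≡ᵇ-refl v)
      toV i@(there _) (base p) = ⊥-elim (Z∉K i p)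
      toV {u} (there i) (step {w} r j a) with V⊆′ j
      ... | inj₁ k = step (toV k r) k a
      ... | inj₂ k = ⊥-elim (¬b u i (step (bW w k (reached ins j r)) (W⊆U k) a))

      -- Were `v` sealed as well, no path to `a` could leave `v ∷ Z`; yet `v` lies in `A`.
      stuck : (∀ w → w ∈ W → Sealed e c v w) → ∀ {u} → u ∈ v ∷ Z → ¬ Reach (reversed e) V (isK ∘ c) u
      stuck s i (base p) = Z∉K i p
      stuck s i (step {w} r j a) with V⊆′ j
      stuck s i           (step {w} r j a) | inj₁ k = stuck s k r
      stuck s (here refl) (step {w} r j a) | inj₂ k = noExit (s w k) (a , reached ins j r)
      stuck s (there i)   (step {w} r j a) | inj₂ k = ¬b _ i (step (bW w k (reached ins j r)) (W⊆U k) a)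

    forward : Pieces
    forward = record
      { rest  = cluster (λ i r → reached outs (W⊆V i) (Reach-mono W⊆V r))
                        (λ i p → T⇒W-Reach (W⊆V i) (reaches outs (W⊆V i) p))
              , cluster (λ i r → reached ins (W⊆V i) (Reach-mono W⊆V r))
                        (λ i p → Bypass⇒W-Reach (bW _ i p))
      ; piece = cluster (λ i r → ⊥-elim (noSource r)) (λ _ ())
              , cluster (λ _ _ → refl) (λ i _ → toV i (reaches ins (Z⊆V i) (Z∈A i)))
      ; sealZ = λ z w i j → seal
          (λ (a , p) → ¬b z i (step (bW w j p) (W⊆U j) a))
          (λ (a , p) → Z∉T (there i) (reached outs (U⊆V (Z⊆U i)) (step (reaches outs (W⊆V j) p) (W⊆V j) a)))
      ; entry = λ w j (a , p) → Z∉T (here refl) (reached outs v∈V (step (reaches outs (W⊆V j) p) (W⊆V j) a))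
      ; exit  = λ s → stuck s (here refl) (reaches ins v∈V (Z∈A (here refl)))
      }
      where
      noSource : ∀ {u} → ¬ Reach e (v ∷ Z) (isS ∘ pieceCls v) u
      noSource (step r _ _) = noSource r

  module Backward (ps : Pieces) where

    private
      outs = proj₁ (rest ps)
      ins  = proj₂ (rest ps)

      noEntryZ : ∀ {z w} → z ∈ v ∷ Z → w ∈ W → e w z ≡ true → inT (c w) ≡ true → ⊥
      noEntryZ (here refl) j a t = entry ps _ j (a , t)
      noEntryZ (there i)   j a t = noEntry (sealZ ps _ _ i j) (a , t)

      -- The first step of a path from `t` into `v ∷ Z` would start at a vertex of `T` in `W`, and
      -- no such arc exists.
      V⇒W-out : ∀ {u} → u ∈ V → Reach e V (isS ∘ c) u → u ∈ W × Reach e W (isS ∘ c) u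
      V⇒W-out i (base p) with V⊆′ i
      ... | inj₁ j = ⊥-elim (Z∉S j p)
      ... | inj₂ j = j , base p
      V⇒W-out i (step r j a) with k , r′ ← V⇒W-out j r with V⊆′ i
      ... | inj₁ l = ⊥-elim (noEntryZ l k a (reached outs k r′))
      ... | inj₂ l = l , step r′ k a

      -- A path to `a` may dip into `v ∷ Z`, so it need not stay in `W`. But a vertex of `T` has no
      -- arc into `v ∷ Z`, and a plain vertex of `W` or `a` itself lies in `A` anyway.
      V⇒W-in : ∀ {u} → u ∈ W → Reach (reversed e) V (isK ∘ c) u → inA (c u) ≡ true
      V⇒W-in i (base p) = reached ins i (base p)
      V⇒W-in i (step {w} r j a) with V⊆′ j
      ... | inj₂ k = reached ins i (step (reaches ins k (V⇒W-in k r)) k a)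
      ... | inj₁ k with cW i
      ...   | inj₁ q        = cong inA q
      ...   | inj₂ (inj₁ t) = ⊥-elim (noEntryZ k i a t)
      ...   | inj₂ (inj₂ q) = reached ins i (base q)

      V-in : ∀ {u} → u ∈ V → Reach (reversed e) V (isK ∘ c) u → inA (c u) ≡ true
      V-in i r with V⊆′ i
      ... | inj₁ j = Z∈A j
      ... | inj₂ j = V⇒W-in j r

      W⇒V-in : ∀ {u} → u ∈ W → inA (c u) ≡ true → Reach (reversed e) V (isK ∘ c) u
      W⇒V-in i p = Reach-mono W⊆V (reaches ins i p)

      module _ {w} (w∈W : w ∈ W) (w∈A : inA (c w) ≡ true) (a : e v w ≡ true) where
        via : ∀ {u} → u ∈ v ∷ Z → ToV u → Reach (reversed e) V (isK ∘ c) u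
        via {u} i (base p) with refl ← ≡ᵇ-true u v p = step (W⇒V-in w∈W w∈A) (W⊆V w∈W) a
        via i (step r j b) = step (via j r) (Z⊆V j) b

      exitVia : ∀ {u} → (¬ (∀ w → w ∈ W → ¬ (e v w ≡ true × inA (c w) ≡ true))) →
        u ∈ v ∷ Z → ToV u → Reach (reversed e) V (isK ∘ c) u
      -- The hypothesis is only a negation; an actual arc is found by searching the finite list `W`.
      exitVia {u} h i r with search W (λ w → e v w ∧ inA (c w))
        where
        search : ∀ L p → (∃ λ w → w ∈ L × p w ≡ true) ⊎ (∀ w → w ∈ L → ¬ p w ≡ true)
        search []      p = inj₂ λ _ ()
        search (w ∷ L) p with true-or-not (p w) | search L p
        ... | inj₁ h | _                = inj₁ (w , here refl , h)
        ... | inj₂ n | inj₁ (w′ , i , h) = inj₁ (w′ , there i , h)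
        ... | inj₂ n | inj₂ h           = inj₂ λ { _ (here refl) → n ; _ (there i) → h _ i }
      ... | inj₁ (w , j , p) with a , q ← ∧-true⁻ {e v w} p = via j q a i r
      ... | inj₂ n = ⊥-elim (h λ w j (a , q) → n w j (∧-true⁺ a q))

    backward : Event V c e
    backward =
        cluster (λ i r → let k , r′ = V⇒W-out i r in reached outs k r′)
                (λ i p → Reach-mono W⊆V (reaches outs (T⊆W i p) p))
      , cluster V-in complete
      where
      complete : ∀ {u} → u ∈ V → inA (c u) ≡ true → Reach (reversed e) V (isK ∘ c) u
      complete i p with V⊆′ i
      ... | inj₂ j = W⇒V-in j p
      -- Without an arc from `v` into `A`, the condition `entry` would make `v` sealed, against
      -- `exit`.
      ... | inj₁ j = exitVia (λ n → exit ps λ w k → seal (n w k) (entry ps w k)) j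
                       (reaches (proj₂ (piece ps)) j refl)

    -- Together with `bypass-W` this recovers from the pieces which vertices can bypass `v`, so a
    -- digraph satisfies the factored conditions for at most one split.
    bypass-Z : ∀ z → z ∈ Z → ¬ Bypass z
    bypass-Z z i (base p) = Z∉K (there i) p
    bypass-Z z i (step {w} r j a) with U⊆ j
    ... | inj₁ k = bypass-Z w k r
    ... | inj₂ k = noExit (sealZ ps z w i k) (a , V⇒W-in k (Reach-mono U⊆V r))

    bypass-W : ∀ w → w ∈ W → c w ≡ plainA → Bypass w
    bypass-W w i p = Reach-mono W⊆U (reaches ins i (cong inA p))

-- A vertex outside A ∪ T

module Isolate
  (e : Digraph) (c : ℕ → Cls) (v : ℕ) (W : List ℕ) (cv : c v ≡ cls false false false false) where

  isolate : Event (v ∷ W) c e → Event W c e × (∀ w → w ∈ W → Sealed e c v w)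
  isolate (outs , ins) =
      ( cluster (λ i r → reached outs (there i) (Reach-mono there r))
                (λ i p → inW-out (reaches outs (there i) p))
      , cluster (λ i r → reached ins (there i) (Reach-mono there r))
                (λ i p → inW-in (reaches ins (there i) p)) )
    , λ w i → seal
        (λ (a , p) → true≢false (reached ins (here refl) (step (reaches ins (there i) p) (there i) a)) (cong inA cv))
        (λ (a , p) → true≢false (reached outs (here refl) (step (reaches outs (there i) p) (there i) a)) (cong inT cv))
    where
    inW-out : ∀ {u} → Reach e (v ∷ W) (isS ∘ c) u → Reach e W (isS ∘ c) u
    inW-out (base p)               = base p
    inW-out (step r (here refl) a) = ⊥-elim (true≢false (reached outs (here refl) r) (cong inT cv))
    inW-out (step r (there i) a)   = step (inW-out r) i a
    inW-in : ∀ {u} → Reach (reversed e) (v ∷ W) (isK ∘ c) u → Reach (reversed e) W (isK ∘ c) u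
    inW-in (base p)               = base p
    inW-in (step r (here refl) a) = ⊥-elim (true≢false (reached ins (here refl) r) (cong inA cv))
    inW-in (step r (there i) a)   = step (inW-in r) i a

  unisolate : Event W c e → (∀ w → w ∈ W → Sealed e c v w) → Event (v ∷ W) c e
  unisolate (outs , ins) s =
      cluster (λ { (here refl) r → ⊥-elim (v-unreached r) ; (there i) r → reached outs i (inW-out r) })
              (λ { (here refl) p → ⊥-elim (true≢false p (cong inT cv)) ; (there i) p → Reach-mono there (reaches outs i p) })
    , cluster (λ { (here refl) r → ⊥-elim (v-unreaching r) ; (there i) r → reached ins i (inW-in r) })
              (λ { (here refl) p → ⊥-elim (true≢false p (cong inA cv)) ; (there i) p → Reach-mono there (reaches ins i p) })
    where
    -- A simultaneous induction: a path from `t` does not run through `v` since `v` is never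
    -- reached, and `v` is never reached since its predecessor would be a vertex of `T` in `W`.
    -- Towards `a` the argument is the mirror image.
    inW-out : ∀ {u} → Reach e (v ∷ W) (isS ∘ c) u → Reach e W (isS ∘ c) u
    v-unreached : ¬ Reach e (v ∷ W) (isS ∘ c) v
    inW-out (base p)               = base p
    inW-out (step r (here refl) a) = ⊥-elim (v-unreached r)
    inW-out (step r (there i) a)   = step (inW-out r) i a
    v-unreached (base p)               = true≢false p (cong isS cv)
    v-unreached (step r (here refl) a) = v-unreached r
    v-unreached (step r (there i) a)   = noEntry (s _ i) (a , reached outs i (inW-out r))
    inW-in : ∀ {u} → Reach (reversed e) (v ∷ W) (isK ∘ c) u → Reach (reversed e) W (isK ∘ c) u
    v-unreaching : ¬ Reach (reversed e) (v ∷ W) (isK ∘ c) v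
    inW-in (base p)               = base p
    inW-in (step r (here refl) a) = ⊥-elim (v-unreaching r)
    inW-in (step r (there i) a)   = step (inW-in r) i a
    v-unreaching (base p)               = true≢false p (cong isK cv)
    v-unreaching (step r (here refl) a) = v-unreaching r
    v-unreaching (step r (there i) a)   = noExit (s _ i) (a , reached ins i (inW-in r))

-- Lists without repetition, and words of classes

Unique-↭ : {xs ys : List X} → xs ↭ ys → Unique xs → Unique ys
Unique-↭ p = Unique-resp-↭ (setoid _) (↭⇒↭ₛ p)

Unique-++ˡ : ∀ (xs : List X) {ys} → Unique (xs ++ ys) → Unique xs
Unique-++ˡ []       u       = []
Unique-++ˡ (x ∷ xs) (a ∷ u) = All.tabulate (λ i → All.lookup a (∈-++⁺ˡ i)) ∷ Unique-++ˡ xs u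

Unique-++ʳ : ∀ (xs : List X) {ys} → Unique (xs ++ ys) → Unique ys
Unique-++ʳ []       u       = u
Unique-++ʳ (x ∷ xs) (_ ∷ u) = Unique-++ʳ xs u

Unique-disjoint : ∀ (xs : List X) {ys z} → Unique (xs ++ ys) → z ∈ xs → z ∈ ys → ⊥
Unique-disjoint (x ∷ xs) (a ∷ u) (here refl) j = All.lookup a (∈-++⁺ʳ xs j) refl
Unique-disjoint (x ∷ xs) (a ∷ u) (there i)   j = Unique-disjoint xs u i j

Unique-map-injective : ∀ {Y : Set} (φ : X → Y) {zs} → Unique (map φ zs) →
  ∀ {z z′} → z ∈ zs → z′ ∈ zs → φ z ≡ φ z′ → z ≡ z′
Unique-map-injective φ (a ∷ u) (here refl) (here refl) p = refl
Unique-map-injective φ (a ∷ u) (here refl) (there j)   p = ⊥-elim (All.lookup a (∈-map⁺ φ j) p)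
Unique-map-injective φ (a ∷ u) (there i)   (here refl) p = ⊥-elim (All.lookup a (∈-map⁺ φ i) (sym p))
Unique-map-injective φ (a ∷ u) (there i)   (there j)   p = Unique-map-injective φ u i j p

-- Pairs the two lists position by position, which produces the common index list for `Iso`.
align : ∀ {Y Z : Set} (f : X → Z) (g : Y → Z) xs ys → map f xs ≡ map g ys →
  ∃ λ (zs : List (X × Y)) → map proj₁ zs ≡ xs × map proj₂ zs ≡ ys × (∀ z → z ∈ zs → f (proj₁ z) ≡ g (proj₂ z))
align f g []       []       p = [] , refl , refl , λ _ ()
align f g (x ∷ xs) (y ∷ ys) p with zs , refl , refl , h ← align f g xs ys (∷-injectiveʳ p) =
  (x , y) ∷ zs , refl , refl , λ { _ (here refl) → ∷-injectiveˡ p ; z (there i) → h z i }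

nowhere : Cls
nowhere = cls false false false false

-- The default carries no mark, so statements about the marks of a word hold at every natural number
-- and not just at its positions.
nth : List Cls → ℕ → Cls
nth []      _       = nowhere
nth (k ∷ w) zero    = k
nth (k ∷ w) (suc n) = nth w n

map-nth : ∀ w → map (nth w) (upTo (length w)) ≡ w
map-nth w = ≡.trans (map-upTo (nth w) (length w)) (lem w)
  where
  lem : ∀ w → applyUpTo (nth w) (length w) ≡ w
  lem []      = refl
  lem (k ∷ w) = cong (k ∷_) (lem w)

transpose : Cls → Cls
transpose k = cls (inA k) (inT k) (isK k) (isS k)

arrow-reversed : ∀ i j d u v → arrow (i , j) d v u ≡ arrow (i , j) (opposite d) u v
arrow-reversed i j d u v = ≡.trans (arrow-flip i j d v u)
  (cong₂ _∨_ (lem (j ≡ᵇ v) (i ≡ᵇ u) _) (lem (j ≡ᵇ u) (i ≡ᵇ v) _))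
  where
  lem : ∀ a b k → a ∧ b ∧ k ≡ b ∧ a ∧ k
  lem a b k = ≡.trans (sym (∧-assoc a b k)) (≡.trans (cong (_∧ k) (∧-comm a b)) (∧-assoc b a k))

-- Conditions on the arcs between disjoint vertex sets

sealed unfed : Cls → Bool → Bool → Bool
sealed k out inn = not (out ∧ inA k) ∧ not (inn ∧ inT k)
unfed  k out inn = not (inn ∧ inT k)

-- The test `g` receives the class of the other endpoint, the arc from `v` to it, and the arc from
-- it to `v`.
onStar : (Cls → Bool → Bool → Bool) → (ℕ → Cls) → ℕ → List ℕ → Digraph → Bool
onStar g c v W e = all (λ w → g (c w) (e v w) (e w v)) W

onCross : (Cls → Bool → Bool → Bool) → (ℕ → Cls) → List ℕ → List ℕ → Digraph → Bool
onCross g c Z W e = all (λ z → onStar g c z W e) Z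

Between : List ℕ → List ℕ → Support
Between Z W a b = (a ∈ Z × b ∈ W) ⊎ (b ∈ Z × a ∈ W)

all-cong : ∀ (p p′ : X → Bool) V → (∀ v → v ∈ V → p v ≡ p′ v) → all p V ≡ all p′ V
all-cong p p′ []      h = refl
all-cong p p′ (v ∷ V) h = cong₂ _∧_ (h v (here refl)) (all-cong p p′ V (λ w i → h w (there i)))

onCross-Local : ∀ g c Z W e e′ → Agree (Between Z W) e e′ → onCross g c Z W e ≡ onCross g c Z W e′
onCross-Local g c Z W e e′ h = all-cong _ _ Z λ z i → all-cong _ _ W λ w j →
  cong₂ (g (c w)) (h z w (inj₁ (i , j))) (h w z (inj₂ (i , j)))

onStar-Local : ∀ g c v W e e′ → Agree (Between (v ∷ []) W) e e′ → onStar g c v W e ≡ onStar g c v W e′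
onStar-Local g c v W e e′ h = all-cong _ _ W λ w j →
  cong₂ (g (c w)) (h v w (inj₁ (here refl , j))) (h w v (inj₂ (here refl , j)))

sealed-true⁻ : ∀ {e c v} w → sealed (c w) (e v w) (e w v) ≡ true → Sealed e c v w
sealed-true⁻ {e} {c} {v} w h with p , r ← ∧-true⁻ {not (e v w ∧ inA (c w))} h = seal
  (λ (a , b) → not-true⁻ p (∧-true⁺ a b)) (λ (a , b) → not-true⁻ r (∧-true⁺ a b))

sealed-true⁺ : ∀ {e c v} w → Sealed e c v w → sealed (c w) (e v w) (e w v) ≡ true
sealed-true⁺ {e} {c} {v} w s = ∧-true⁺
  (not-true⁺ λ h → noExit s (∧-true⁻ {e v w} h)) (not-true⁺ λ h → noEntry s (∧-true⁻ {e w v} h))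

map-split : ∀ {Y : Set} (f : X → Y) xs ys {zs} → map f xs ≡ ys ++ zs →
  ∃ λ xs₁ → ∃ λ xs₂ → xs ≡ xs₁ ++ xs₂ × map f xs₁ ≡ ys × map f xs₂ ≡ zs
map-split f xs       []       p = [] , xs , refl , refl , p
map-split f (x ∷ xs) (y ∷ ys) p with xs₁ , xs₂ , refl , h₁ , h₂ ← map-split f xs ys (∷-injectiveʳ p) =
  x ∷ xs₁ , xs₂ , refl , cong₂ _∷_ (∷-injectiveˡ p) h₁ , h₂

map-const : ∀ {Y : Set} (f : X → Y) y xs → (∀ {x} → x ∈ xs → f x ≡ y) → map f xs ≡ replicate (length xs) y
map-const f y []       h = refl
map-const f y (x ∷ xs) h = cong₂ _∷_ (h (here refl)) (map-const f y xs (h ∘ there))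

∈-replicate : ∀ n {x y : X} → x ∈ replicate n y → x ≡ y
∈-replicate (suc n) (here p)  = p
∈-replicate (suc n) (there i) = ∈-replicate n i

bothB plainT sourceB sinkB sourceT sinkA : Cls
bothB   = cls true  true  false false
plainT  = cls true  false false false
sourceB = cls true  true  true  false
sinkB   = cls true  true  false true
sourceT = cls true  false true  false
sinkA   = cls false true  false true

-- All classes without a mark, that is, all that a vertex other than `t` and `a` can have.
letters : List Cls
letters = bothB ∷ plainT ∷ plainA ∷ nowhere ∷ []

onWord : (ℕ → Cls → Bool) → List Cls → Bool
onWord g []      = true
onWord g (k ∷ w) = g 0 k ∧ onWord (g ∘ suc) w

all-onWord : ∀ g w → all (λ u → g u (nth w u)) (upTo (length w)) ≡ onWord g w
all-onWord g []      = refl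
all-onWord g (k ∷ w) = cong (g 0 k ∧_) (≡.trans (cong and shift) (all-onWord (g ∘ suc) w))
  where
  shift : map (λ u → g u (nth (k ∷ w) u)) (applyUpTo suc (length w)) ≡ map (λ u → g (suc u) (nth w u)) (upTo (length w))
  shift = ≡.trans (map-applyUpTo suc _ (length w)) (sym (map-upTo (λ u → g (suc u) (nth w u)) (length w)))

Reach-cong : ∀ {e V s s′} → (∀ u → s u ≡ s′ u) → ∀ {u} → Reach e V s u → Reach e V s′ u
Reach-cong h (base p)     = base (≡.trans (sym (h _)) p)
Reach-cong h (step r i a) = step (Reach-cong h r) i a

Reach-reversed : ∀ e V s t → t ∈ V → Reach e V (_≡ᵇ s) t → Reach (reversed e) V (_≡ᵇ t) s
Reach-reversed e V s t t∈V r = go r (base (≡ᵇ-refl t)) t∈V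
  where
  go : ∀ {u} → Reach e V (_≡ᵇ s) u → Reach (reversed e) V (_≡ᵇ t) u → u ∈ V → Reach (reversed e) V (_≡ᵇ t) s
  go {u} (base p) r′ i with refl ← ≡ᵇ-true u s p = r′
  go (step r j a) r′ i = go r (step r′ i a) j

-- With one condition per vertex, a sum over all words of classes can be carried out letter by
-- letter.
event-pointwise : ∀ V c e s t → (∀ u → isS (c u) ≡ (u ≡ᵇ s)) → (∀ u → isK (c u) ≡ (u ≡ᵇ t)) →
  event V c e ≡ all (λ u → eqBool (reach e V (_≡ᵇ s) u) (inT (c u)) ∧ eqBool (reach (reversed e) V (_≡ᵇ t) u) (inA (c u))) V
event-pointwise V c e s t hs ht = ≡true-ext
  (λ h → let p , r = event⁻ V c e h in all-true⁺ _ V λ u i → ∧-true⁺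
    (eqBool-true⁺ (≡true-ext (λ k → reached p i (Reach-cong (sym ∘ hs) (reach⇒Reach e V _ k)))
                             (λ k → Reach⇒reach e V _ i (Reach-cong hs (reaches p i k)))))
    (eqBool-true⁺ (≡true-ext (λ k → reached r i (Reach-cong (sym ∘ ht) (reach⇒Reach (reversed e) V _ k)))
                             (λ k → Reach⇒reach (reversed e) V _ i (Reach-cong ht (reaches r i k))))))
  (λ h → event⁺ V c e
    ( cluster (λ i r → ≡.trans (sym (out h i)) (Reach⇒reach e V _ i (Reach-cong hs r)))
              (λ i k → Reach-cong (sym ∘ hs) (reach⇒Reach e V _ (≡.trans (out h i) k)))
    , cluster (λ i r → ≡.trans (sym (inn h i)) (Reach⇒reach (reversed e) V _ i (Reach-cong ht r)))
              (λ i k → Reach-cong (sym ∘ ht) (reach⇒Reach (reversed e) V _ (≡.trans (inn h i) k))) ))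
  where
  ρ κ : ℕ → Bool
  ρ = reach e V (_≡ᵇ s)
  κ = reach (reversed e) V (_≡ᵇ t)
  E : ℕ → Bool
  E u = eqBool (ρ u) (inT (c u)) ∧ eqBool (κ u) (inA (c u))
  out : all E V ≡ true → ∀ {u} → u ∈ V → ρ u ≡ inT (c u)
  out h {u} i = eqBool-true⁻ (proj₁ (∧-true⁻ {eqBool (ρ u) (inT (c u))} (all-true⁻ E h i)))
  inn : all E V ≡ true → ∀ {u} → u ∈ V → κ u ≡ inA (c u)
  inn h {u} i = eqBool-true⁻ (proj₂ (∧-true⁻ {eqBool (ρ u) (inT (c u))} (all-true⁻ E h i)))

-- A vertex of `A ∩ T` has a path to `a`. This path prolongs a path from `t`, so all of it lies in
-- `T`, including `a`, which the hypothesis places outside `T`.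
event-impossible : ∀ {V c u} e → (∀ {z} → z ∈ V → isK (c z) ≡ true → inT (c z) ≡ false) →
  u ∈ V → inT (c u) ≡ true → inA (c u) ≡ true → event V c e ≡ false
event-impossible {V} {c} {u} e hK i t a with event V c e in eq
... | false = refl
... | true  = ⊥-elim (absurd i t (reaches (proj₂ ev) i a))
  where
  ev = event⁻ V c e eq
  absurd : ∀ {z} → z ∈ V → inT (c z) ≡ true → Reach (reversed e) V (isK ∘ c) z → ⊥
  absurd i t (base p)     = true≢false t (hK i p)
  absurd i t (step r j a) = absurd j (reached (proj₁ ev) j (step (reaches (proj₁ ev) i t) i a)) r

-- Expectation over independently revealed pairs

module Expectation
  {R : Set} {add mul : R → R → R} {neg : R → R} {𝟘 𝟙 : R}
  (isCR : IsCommutativeRing _≡_ add mul neg 𝟘 𝟙)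
  (q x : R) (total : add q (add x x) ≡ 𝟙)
  where

  open IsCommutativeRing isCR public
    using (+-assoc; +-comm; +-identityˡ; +-identityʳ; *-assoc; *-comm; *-identityˡ; *-identityʳ;
           distribˡ; distribʳ; +-cong; +-congˡ; +-congʳ; *-cong; *-congˡ; *-congʳ; zeroˡ; zeroʳ; -‿inverseʳ; -‿inverseˡ)
  open ≡-Reasoning

  infixl 6 _⊕_
  infixl 7 _⊗_

  _⊕_ _⊗_ : R → R → R
  _⊕_ = add
  _⊗_ = mul

  ⊕-interchange : ∀ a b c d → (a ⊕ b) ⊕ (c ⊕ d) ≡ (a ⊕ c) ⊕ (b ⊕ d)
  ⊕-interchange a b c d = begin
    (a ⊕ b) ⊕ (c ⊕ d)  ≡⟨ +-assoc a b _ ⟩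
    a ⊕ (b ⊕ (c ⊕ d))  ≡⟨ cong (a ⊕_) (+-assoc b c d) ⟨
    a ⊕ ((b ⊕ c) ⊕ d)  ≡⟨ cong (λ z → a ⊕ (z ⊕ d)) (+-comm b c) ⟩
    a ⊕ ((c ⊕ b) ⊕ d)  ≡⟨ cong (a ⊕_) (+-assoc c b d) ⟩
    a ⊕ (c ⊕ (b ⊕ d))  ≡⟨ +-assoc a c _ ⟨
    (a ⊕ c) ⊕ (b ⊕ d)  ∎

  ⊗-swap : ∀ a b c → a ⊗ (b ⊗ c) ≡ b ⊗ (a ⊗ c)
  ⊗-swap a b c = begin
    a ⊗ (b ⊗ c)  ≡⟨ *-assoc a b c ⟨
    (a ⊗ b) ⊗ c  ≡⟨ cong (_⊗ c) (*-comm a b) ⟩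
    (b ⊗ a) ⊗ c  ≡⟨ *-assoc b a c ⟩
    b ⊗ (a ⊗ c)  ∎

  opaque
    mean : (Dir → R) → R
    mean g = q ⊗ g none ⊕ (x ⊗ g fwd ⊕ x ⊗ g bwd)

    mean-expand : ∀ g → mean g ≡ q ⊗ g none ⊕ (x ⊗ g fwd ⊕ x ⊗ g bwd)
    mean-expand g = refl

    mean-cong : ∀ {g h} → (∀ d → g d ≡ h d) → mean g ≡ mean h
    mean-cong p = +-cong (*-congˡ (p none)) (+-cong (*-congˡ (p fwd)) (*-congˡ (p bwd)))

    mean-⊕ : ∀ g h → mean (λ d → g d ⊕ h d) ≡ mean g ⊕ mean h
    mean-⊕ g h = begin
      q ⊗ (g none ⊕ h none) ⊕ (x ⊗ (g fwd ⊕ h fwd) ⊕ x ⊗ (g bwd ⊕ h bwd))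
        ≡⟨ +-cong (distribˡ _ _ _) (+-cong (distribˡ _ _ _) (distribˡ _ _ _)) ⟩
      (q ⊗ g none ⊕ q ⊗ h none) ⊕ ((x ⊗ g fwd ⊕ x ⊗ h fwd) ⊕ (x ⊗ g bwd ⊕ x ⊗ h bwd))
        ≡⟨ +-congˡ (⊕-interchange _ _ _ _) ⟩
      (q ⊗ g none ⊕ q ⊗ h none) ⊕ ((x ⊗ g fwd ⊕ x ⊗ g bwd) ⊕ (x ⊗ h fwd ⊕ x ⊗ h bwd))
        ≡⟨ ⊕-interchange _ _ _ _ ⟩
      mean g ⊕ mean h ∎

    mean-⊗ˡ : ∀ k g → mean (λ d → k ⊗ g d) ≡ k ⊗ mean g
    mean-⊗ˡ k g = begin
      q ⊗ (k ⊗ g none) ⊕ (x ⊗ (k ⊗ g fwd) ⊕ x ⊗ (k ⊗ g bwd))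
        ≡⟨ +-cong (⊗-swap _ _ _) (+-cong (⊗-swap _ _ _) (⊗-swap _ _ _)) ⟩
      k ⊗ (q ⊗ g none) ⊕ (k ⊗ (x ⊗ g fwd) ⊕ k ⊗ (x ⊗ g bwd))
        ≡⟨ +-congˡ (distribˡ _ _ _) ⟨
      k ⊗ (q ⊗ g none) ⊕ k ⊗ (x ⊗ g fwd ⊕ x ⊗ g bwd)
        ≡⟨ distribˡ _ _ _ ⟨
      k ⊗ mean g ∎

    mean-const : ∀ k → mean (λ _ → k) ≡ k
    mean-const k = begin
      q ⊗ k ⊕ (x ⊗ k ⊕ x ⊗ k)  ≡⟨ +-congˡ (distribʳ _ _ _) ⟨
      q ⊗ k ⊕ (x ⊕ x) ⊗ k      ≡⟨ distribʳ _ _ _ ⟨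
      (q ⊕ (x ⊕ x)) ⊗ k        ≡⟨ cong (_⊗ k) total ⟩
      𝟙 ⊗ k                    ≡⟨ *-identityˡ k ⟩
      k                        ∎

    mean-opposite : ∀ g → mean (g ∘ opposite) ≡ mean g
    mean-opposite g = +-congˡ (+-comm _ _)

    -- A mean is a fixed linear combination, and linear combinations pass through another mean.
    mean-swap : ∀ (g : Dir → Dir → R) → mean (λ d → mean (g d)) ≡ mean (λ d′ → mean (λ d → g d d′))
    mean-swap g = begin
      mean (λ d → q ⊗ g d none ⊕ (x ⊗ g d fwd ⊕ x ⊗ g d bwd))
        ≡⟨ mean-⊕ (λ d → q ⊗ g d none) (λ d → x ⊗ g d fwd ⊕ x ⊗ g d bwd) ⟩
      mean (λ d → q ⊗ g d none) ⊕ mean (λ d → x ⊗ g d fwd ⊕ x ⊗ g d bwd)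
        ≡⟨ +-congˡ (mean-⊕ (λ d → x ⊗ g d fwd) (λ d → x ⊗ g d bwd)) ⟩
      mean (λ d → q ⊗ g d none) ⊕ (mean (λ d → x ⊗ g d fwd) ⊕ mean (λ d → x ⊗ g d bwd))
        ≡⟨ +-cong (mean-⊗ˡ q (λ d → g d none)) (+-cong (mean-⊗ˡ x (λ d → g d fwd)) (mean-⊗ˡ x (λ d → g d bwd))) ⟩
      mean (λ d′ → mean (λ d → g d d′)) ∎

  -- The last argument accumulates the arcs revealed so far; probabilities start from `∅`.
  𝔼 : List (ℕ × ℕ) → (Digraph → R) → Digraph → R
  𝔼 []      f e = f e
  𝔼 (a ∷ L) f e = mean (λ d → 𝔼 L f (link a d e))

  Local : Support → (Digraph → R) → Set
  Local S f = ∀ e e′ → Agree S e e′ → f e ≡ f e′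

  Ext : (Digraph → R) → Set
  Ext = Local Everywhere

  Local⇒Ext : ∀ {S f} → Local S f → Ext f
  Local⇒Ext l e e′ h = l e e′ (λ u v _ → h u v tt)

  𝔼-cong : ∀ L {f g} → (∀ e → f e ≡ g e) → ∀ e → 𝔼 L f e ≡ 𝔼 L g e
  𝔼-cong []      p e = p e
  𝔼-cong (a ∷ L) p e = mean-cong (λ d → 𝔼-cong L p (link a d e))

  𝔼-⊕ : ∀ L f g e → 𝔼 L (λ e → f e ⊕ g e) e ≡ 𝔼 L f e ⊕ 𝔼 L g e
  𝔼-⊕ []      f g e = refl
  𝔼-⊕ (a ∷ L) f g e = ≡.trans (mean-cong (λ d → 𝔼-⊕ L f g (link a d e))) (mean-⊕ _ _)

  𝔼-const : ∀ L k e → 𝔼 L (λ _ → k) e ≡ k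
  𝔼-const []      k e = refl
  𝔼-const (a ∷ L) k e = ≡.trans (mean-cong (λ d → 𝔼-const L k (link a d e))) (mean-const k)

  𝔼-++ : ∀ L M f e → 𝔼 (L ++ M) f e ≡ 𝔼 L (𝔼 M f) e
  𝔼-++ []      M f e = refl
  𝔼-++ (a ∷ L) M f e = mean-cong (λ d → 𝔼-++ L M f (link a d e))

  𝔼-Local : ∀ {S f} L → Local S f → Local S (𝔼 L f)
  𝔼-Local []      l e e′ h = l e e′ h
  𝔼-Local (a ∷ L) l e e′ h = mean-cong (λ d → 𝔼-Local L l _ _ (link-Agree a d h))

  -- No pair of `L` affects `f`, so `f e` is a constant for every one of the nested means.
  𝔼-factorˡ : ∀ {S f} L g e → Local S f → Avoids S L → 𝔼 L (λ e → f e ⊗ g e) e ≡ f e ⊗ 𝔼 L g e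
  𝔼-factorˡ []      g e l av = refl
  𝔼-factorˡ {f = f} (a@(u , v) ∷ L) g e l av with av₁ , av₂ ← av u v (here refl) = begin
    mean (λ d → 𝔼 L (λ e → f e ⊗ g e) (link a d e))
      ≡⟨ mean-cong (λ d → 𝔼-factorˡ L g (link a d e) l (λ u v i → av u v (there i))) ⟩
    mean (λ d → f (link a d e) ⊗ 𝔼 L g (link a d e))
      ≡⟨ mean-cong (λ d → *-congʳ (l (link a d e) e (link-avoids u v d e av₁ av₂))) ⟩
    mean (λ d → f e ⊗ 𝔼 L g (link a d e))
      ≡⟨ mean-⊗ˡ (f e) (λ d → 𝔼 L g (link a d e)) ⟩
    f e ⊗ mean (λ d → 𝔼 L g (link a d e)) ∎

  𝔼-independent : ∀ {S S′ f g} L M e → Local S f → Local S′ g → Avoids S M → Avoids S′ L →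
    𝔼 (L ++ M) (λ e → f e ⊗ g e) e ≡ 𝔼 L f e ⊗ 𝔼 M g e
  𝔼-independent {f = f} {g} L M e l l′ av av′ = begin
    𝔼 (L ++ M) (λ e → f e ⊗ g e) e    ≡⟨ 𝔼-++ L M _ e ⟩
    𝔼 L (𝔼 M (λ e → f e ⊗ g e)) e     ≡⟨ 𝔼-cong L (λ e → 𝔼-factorˡ M g e l av) e ⟩
    𝔼 L (λ e → f e ⊗ 𝔼 M g e) e       ≡⟨ 𝔼-cong L (λ e → *-comm (f e) _) e ⟩
    𝔼 L (λ e → 𝔼 M g e ⊗ f e) e       ≡⟨ 𝔼-factorˡ L f e (𝔼-Local M l′) av′ ⟩
    𝔼 M g e ⊗ 𝔼 L f e                 ≡⟨ *-comm _ _ ⟩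
    𝔼 L f e ⊗ 𝔼 M g e                 ∎

  infix 4 _≋_
  -- Only functions that respect pointwise equality of digraphs are compared; this stands in for
  -- function extensionality.
  record _≋_ (L M : List (ℕ × ℕ)) : Set where
    constructor mk≋
    field ≋⇒≡ : ∀ {f} → Ext f → ∀ e → 𝔼 L f e ≡ 𝔼 M f e
  open _≋_ public

  ≋-refl : ∀ {L} → L ≋ L
  ≋-refl = mk≋ (λ h e → refl)

  ≋-trans : ∀ {L M N} → L ≋ M → M ≋ N → L ≋ N
  ≋-trans (mk≋ p) (mk≋ r) = mk≋ (λ h e → ≡.trans (p h e) (r h e))

  ≋-∷ : ∀ a {L M} → L ≋ M → a ∷ L ≋ a ∷ M
  ≋-∷ a (mk≋ p) = mk≋ (λ h e → mean-cong (λ d → p h (link a d e)))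

  ≋-++ : ∀ {L M L′ M′} → L ≋ L′ → M ≋ M′ → L ++ M ≋ L′ ++ M′
  ≋-++ {L} {M} {L′} {M′} (mk≋ p) (mk≋ r) = mk≋ λ {f} h e → begin
    𝔼 (L ++ M) f e    ≡⟨ 𝔼-++ L M f e ⟩
    𝔼 L (𝔼 M f) e     ≡⟨ 𝔼-cong L (r h) e ⟩
    𝔼 L (𝔼 M′ f) e    ≡⟨ p (𝔼-Local M′ h) e ⟩
    𝔼 L′ (𝔼 M′ f) e   ≡⟨ 𝔼-++ L′ M′ f e ⟨
    𝔼 (L′ ++ M′) f e  ∎

  ≋-swap : ∀ a b L → a ∷ b ∷ L ≋ b ∷ a ∷ L
  ≋-swap a b L = mk≋ λ {f} h e → begin
    mean (λ d → mean (λ d′ → 𝔼 L f (link b d′ (link a d e))))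
      ≡⟨ mean-cong (λ d → mean-cong (λ d′ → 𝔼-Local L h _ _ (link-comm b d′ a d e))) ⟩
    mean (λ d → mean (λ d′ → 𝔼 L f (link a d (link b d′ e))))
      ≡⟨ mean-swap (λ d d′ → 𝔼 L f (link a d (link b d′ e))) ⟩
    mean (λ d′ → mean (λ d → 𝔼 L f (link a d (link b d′ e)))) ∎

  ↭⇒≋ : ∀ {L M} → L ↭ M → L ≋ M
  ↭⇒≋ refl         = ≋-refl
  ↭⇒≋ (prep a p)   = ≋-∷ a (↭⇒≋ p)
  ↭⇒≋ (swap a b p) = ≋-trans (≋-swap a b _) (≋-∷ b (≋-∷ a (↭⇒≋ p)))
  ↭⇒≋ (trans p r)  = ≋-trans (↭⇒≋ p) (↭⇒≋ r)

  ≋-flip : ∀ u v L → (u , v) ∷ L ≋ (v , u) ∷ L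
  ≋-flip u v L = mk≋ λ {f} h e → begin
    mean (λ d → 𝔼 L f (link (u , v) d e))
      ≡⟨ mean-cong (λ d → 𝔼-Local L h _ _ (link-flip u v d e)) ⟩
    mean (λ d → 𝔼 L f (link (v , u) (opposite d) e))
      ≡⟨ mean-opposite (λ d → 𝔼 L f (link (v , u) d e)) ⟩
    mean (λ d → 𝔼 L f (link (v , u) d e)) ∎

  star-flip : ∀ v W → star v W ≋ map (_, v) W
  star-flip v []      = ≋-refl
  star-flip v (w ∷ W) = ≋-trans (≋-∷ (v , w) (star-flip v W)) (≋-flip v w _)

  -- Not a mere permutation of pairs: exchanging two vertices also reverses the pair that they form.
  -- The equal weight of the two orientations absorbs this.
  edges-↭ : ∀ {V W} → V ↭ W → edges V ≋ edges W
  edges-↭ refl         = ≋-refl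
  edges-↭ (prep v p)   = ≋-++ (↭⇒≋ (↭.map⁺ (v ,_) p)) (edges-↭ p)
  edges-↭ {_ ∷ _ ∷ V} {_ ∷ _ ∷ W} (swap u v p) =
    ≋-trans (≋-flip u v _) (≋-∷ (v , u)
      (≋-trans (↭⇒≋ (↭.shifts (star u V) (star v V)))
               (≋-++ (↭⇒≋ (↭.map⁺ (v ,_) p)) (≋-++ (↭⇒≋ (↭.map⁺ (u ,_) p)) (edges-↭ p)))))
  edges-↭ (trans p r)  = ≋-trans (edges-↭ p) (edges-↭ r)

  edges-++-≋ : ∀ U W → edges (U ++ W) ≋ edges U ++ (cross U W ++ edges W)
  edges-++-≋ U W = ↭⇒≋ (edges-++ U W)

  module _ {Z : Set} (φ ψ : Z → ℕ) (zs : List Z)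
    (φ≈ψ : ∀ z z′ → z ∈ zs → z′ ∈ zs → (φ z ≡ᵇ φ z′) ≡ (ψ z ≡ᵇ ψ z′)) where

    link-Iso : ∀ a b e e′ d → a ∈ zs → b ∈ zs → Iso φ ψ zs e e′ →
      Iso φ ψ zs (link (φ a , φ b) d e) (link (ψ a , ψ b) d e′)
    link-Iso a b e e′ d da db h z z′ dz dz′
      rewrite h z z′ dz dz′ | φ≈ψ a z da dz | φ≈ψ a z′ da dz′ | φ≈ψ b z db dz | φ≈ψ b z′ db dz′ = refl

    module _ {f g : Digraph → R} (fg : ∀ e e′ → Iso φ ψ zs e e′ → f e ≡ g e′) where

      𝔼-relabel : ∀ L → (∀ a b → (a , b) ∈ L → a ∈ zs × b ∈ zs) → ∀ e e′ → Iso φ ψ zs e e′ →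
        𝔼 (map (λ ab → φ (proj₁ ab) , φ (proj₂ ab)) L) f e ≡ 𝔼 (map (λ ab → ψ (proj₁ ab) , ψ (proj₂ ab)) L) g e′
      𝔼-relabel []            dom e e′ h = fg e e′ h
      𝔼-relabel ((a , b) ∷ L) dom e e′ h with da , db ← dom a b (here refl) =
        mean-cong (λ d → 𝔼-relabel L (λ a b i → dom a b (there i)) _ _ (link-Iso a b e e′ d da db h))

      𝔼-edges-relabel : 𝔼 (edges (map φ zs)) f ∅ ≡ 𝔼 (edges (map ψ zs)) g ∅
      𝔼-edges-relabel rewrite sym (map-edges φ zs) | sym (map-edges ψ zs) =
        𝔼-relabel (edges zs) (λ _ _ → edges-∈ zs) ∅ ∅ (λ _ _ _ _ → refl)

  -- Probabilities of events, and their dependence on the word alone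

  ⟦_⟧ : Bool → R
  ⟦ true ⟧  = 𝟙
  ⟦ false ⟧ = 𝟘

  ⟦∧⟧ : ∀ a b → ⟦ a ∧ b ⟧ ≡ ⟦ a ⟧ ⊗ ⟦ b ⟧
  ⟦∧⟧ true  b = sym (*-identityˡ _)
  ⟦∧⟧ false b = sym (zeroˡ _)

  ℙ : List (ℕ × ℕ) → (Digraph → Bool) → R
  ℙ L E = 𝔼 L (λ e → ⟦ E e ⟧) ∅

  Local-⟦⟧ : ∀ {S} {E : Digraph → Bool} → (∀ e e′ → Agree S e e′ → E e ≡ E e′) → Local S (λ e → ⟦ E e ⟧)
  Local-⟦⟧ l e e′ h = cong ⟦_⟧ (l e e′ h)

  ℙ-cong : ∀ L {E E′ : Digraph → Bool} → (∀ e → E e ≡ E′ e) → ℙ L E ≡ ℙ L E′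
  ℙ-cong L h = 𝔼-cong L (λ e → cong ⟦_⟧ (h e)) ∅

  ℙ-independent : ∀ {S S′ E E′} L M →
    (∀ e e′ → Agree S e e′ → E e ≡ E e′) → (∀ e e′ → Agree S′ e e′ → E′ e ≡ E′ e′) →
    Avoids S M → Avoids S′ L → ℙ (L ++ M) (λ e → E e ∧ E′ e) ≡ ℙ L E ⊗ ℙ M E′
  ℙ-independent {E = E} {E′} L M l l′ av av′ =
    ≡.trans (𝔼-cong (L ++ M) (λ e → ⟦∧⟧ (E e) (E′ e)) ∅)
            (𝔼-independent L M ∅ (Local-⟦⟧ l) (Local-⟦⟧ l′) av av′)

  P : List ℕ → (ℕ → Cls) → R
  P V c = ℙ (edges V) (event V c)

  event-Ext : ∀ V c → Ext (λ e → ⟦ event V c e ⟧)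
  event-Ext V c = Local⇒Ext {S = Inside V} (Local-⟦⟧ (event-Local V c))

  P-↭ : ∀ {V W} c → V ↭ W → P V c ≡ P W c
  P-↭ {V} {W} c p = ≡.trans (≋⇒≡ (edges-↭ p) (event-Ext V c) ∅)
    (ℙ-cong (edges W) (λ e → event-resp c e (∈-resp-↭ p) (∈-resp-↭ (↭-sym p))))

  P-relabel : ∀ {V V′ c c′} → Unique V → Unique V′ → map c V ≡ map c′ V′ → P V c ≡ P V′ c′
  P-relabel {V} {V′} {c} {c′} u u′ p with zs , refl , refl , h ← align c c′ V V′ p =
    𝔼-edges-relabel proj₁ proj₂ zs
      (λ z z′ i j → ≡true-ext
        (λ k → subst (λ y → (proj₂ z ≡ᵇ proj₂ y) ≡ true)
                 (Unique-map-injective proj₁ u i j (≡ᵇ-true _ _ k)) (≡ᵇ-refl (proj₂ z)))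
        (λ k → subst (λ y → (proj₁ z ≡ᵇ proj₁ y) ≡ true)
                 (Unique-map-injective proj₂ u′ i j (≡ᵇ-true _ _ k)) (≡ᵇ-refl (proj₁ z))))
      (λ e e′ iso → cong ⟦_⟧ (event-relabel proj₁ proj₂ zs iso h))

  Q : List Cls → R
  Q w = P (upTo (length w)) (nth w)

  -- Reordering the vertices and then renaming them changes nothing, so only the multiset of classes
  -- counts. This makes every choice of representative vertices harmless.
  P≡Q : ∀ {V c w} → Unique V → map c V ↭ w → P V c ≡ Q w
  P≡Q {V} {c} {w} u p with V′ , refl , p′ ← ↭-map-inv c p =
    ≡.trans (P-↭ c p′) (P-relabel (Unique-↭ p′ u) (upTo⁺ _) (sym (map-nth (map c V′))))

  Q-↭ : ∀ {w w′} → w ↭ w′ → Q w ≡ Q w′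
  Q-↭ {w} p = P≡Q (upTo⁺ (length w)) (subst (_↭ _) (sym (map-nth w)) p)

  𝔼-reversed : ∀ L {f} → Ext f → ∀ e → 𝔼 L (f ∘ reversed) e ≡ 𝔼 L f (reversed e)
  𝔼-reversed []            h e = refl
  𝔼-reversed ((i , j) ∷ L) {f} h e = begin
    mean (λ d → 𝔼 L (f ∘ reversed) (link (i , j) d e))
      ≡⟨ mean-cong (λ d → 𝔼-reversed L h (link (i , j) d e)) ⟩
    mean (λ d → 𝔼 L f (reversed (link (i , j) d e)))
      ≡⟨ mean-cong (λ d → 𝔼-Local L h _ _ (λ u v _ → cong (e v u ∨_) (arrow-reversed i j d u v))) ⟩
    mean (λ d → 𝔼 L f (link (i , j) (opposite d) (reversed e)))
      ≡⟨ mean-opposite (λ d → 𝔼 L f (link (i , j) d (reversed e))) ⟩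
    mean (λ d → 𝔼 L f (link (i , j) d (reversed e))) ∎

  P-transpose : ∀ V c → P V (transpose ∘ c) ≡ P V c
  P-transpose V c = ≡.trans
    (ℙ-cong (edges V) {event V (transpose ∘ c)} {λ e → event V c (reversed e)} (λ e → event-ext (λ (p , r) → r , p) (λ (p , r) → r , p)))
    (𝔼-reversed (edges V) (event-Ext V c) ∅)

  Q-transpose : ∀ w → Q (map transpose w) ≡ Q w
  Q-transpose w = ≡.trans (sym (P≡Q (upTo⁺ (length w))
      (↭-reflexive (≡.trans (map-∘ (upTo (length w))) (cong (map transpose) (map-nth w))))))
    (P-transpose (upTo (length w)) (nth w))

  -- Independence over stars, products and blocks

  ∏ : List R → R
  ∏ []       = 𝟙
  ∏ (a ∷ as) = a ⊗ ∏ as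

  _^_ : R → ℕ → R
  a ^ zero  = 𝟙
  a ^ suc n = a ⊗ (a ^ n)

  chance : (Cls → Bool → Bool → Bool) → Cls → R
  chance g k = mean (λ d → ⟦ g k (isFwd d) (isBwd d) ⟧)

  chances : (Cls → Bool → Bool → Bool) → List Cls → R
  chances g ks = ∏ (map (chance g) ks)

  ℙ-arc : ∀ g c v w → v ≢ w → ℙ ((v , w) ∷ []) (onStar g c v (w ∷ [])) ≡ chance g (c w)
  ℙ-arc g c v w v≢w = mean-cong λ d → cong ⟦_⟧ (≡.trans (∧-identityʳ _) (cong₂ (g (c w)) (out d) (inn d)))
    where
    out : ∀ d → arrow (v , w) d v w ≡ isFwd d
    out d rewrite ≡ᵇ-refl v | ≡ᵇ-refl w | ≡ᵇ-false v≢w = ∨-identityʳ (isFwd d)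
    inn : ∀ d → arrow (v , w) d w v ≡ isBwd d
    inn d rewrite ≡ᵇ-refl v | ≡ᵇ-refl w | ≡ᵇ-false v≢w = refl

  ℙ-star : ∀ g c v W → Unique (v ∷ W) → ℙ (star v W) (onStar g c v W) ≡ chances g (map c W)
  ℙ-star g c v []      u = refl
  ℙ-star g c v (w ∷ W) u@((v≢w ∷ v∉) ∷ (w∉ ∷ u′)) = begin
    ℙ ((v , w) ∷ star v W) (onStar g c v (w ∷ W))
      ≡⟨ ℙ-cong ((v , w) ∷ star v W) (λ e → cong (_∧ onStar g c v W e) (sym (∧-identityʳ _))) ⟩
    ℙ (((v , w) ∷ []) ++ star v W) (λ e → onStar g c v (w ∷ []) e ∧ onStar g c v W e)
      ≡⟨ ℙ-independent ((v , w) ∷ []) (star v W) (onStar-Local g c v (w ∷ [])) (onStar-Local g c v W) av av′ ⟩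
    ℙ ((v , w) ∷ []) (onStar g c v (w ∷ [])) ⊗ ℙ (star v W) (onStar g c v W)
      ≡⟨ *-cong (ℙ-arc g c v w v≢w) (ℙ-star g c v W (v∉ ∷ u′)) ⟩
    chance g (c w) ⊗ chances g (map c W) ∎
    where
    v∉W : v ∉ W
    v∉W i = All.lookup v∉ i refl
    w∉W : w ∉ W
    w∉W i = All.lookup w∉ i refl
    av : Avoids (Between (v ∷ []) (w ∷ [])) (star v W)
    av a b i with refl , j ← star-∈ W i =
        (λ { (inj₁ (_ , here refl)) → w∉W j ; (inj₂ (here refl , _)) → v∉W j })
      , (λ { (inj₁ (here refl , _)) → v∉W j ; (inj₂ (_ , here refl)) → w∉W j })
    av′ : Avoids (Between (v ∷ []) W) ((v , w) ∷ [])
    av′ a b (here refl) =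
        (λ { (inj₁ (_ , j)) → w∉W j ; (inj₂ (here refl , _)) → v≢w refl })
      , (λ { (inj₁ (here refl , _)) → v≢w refl ; (inj₂ (_ , j)) → w∉W j })

  star-avoids : ∀ z Z W → Unique (z ∷ Z ++ W) →
    Avoids (Between (z ∷ []) W) (cross Z W) × Avoids (Between Z W) (star z W)
  star-avoids z Z W u@(z∉ ∷ _) = av , av′
    where
    disjoint : ∀ {y} → y ∈ z ∷ Z → y ∈ W → ⊥
    disjoint = Unique-disjoint (z ∷ Z) u
    z∉Z : z ∉ Z
    z∉Z i = All.lookup z∉ (∈-++⁺ˡ i) refl
    av : Avoids (Between (z ∷ []) W) (cross Z W)
    av a b i with j , k ← cross-∈ Z W i =
        (λ { (inj₁ (here refl , _)) → z∉Z j ; (inj₂ (here refl , l)) → disjoint (here refl) k })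
      , (λ { (inj₁ (here refl , l)) → disjoint (here refl) k ; (inj₂ (here refl , _)) → z∉Z j })
    av′ : Avoids (Between Z W) (star z W)
    av′ a b i with refl , k ← star-∈ W i =
        (λ { (inj₁ (l , _)) → z∉Z l ; (inj₂ (l , _)) → disjoint (there l) k })
      , (λ { (inj₁ (l , _)) → disjoint (there l) k ; (inj₂ (l , _)) → z∉Z l })

  Unique-drop-middle : ∀ (z : ℕ) Z W → Unique (z ∷ Z ++ W) → Unique (z ∷ W)
  Unique-drop-middle z Z W (z∉ ∷ u) = All.tabulate (λ i → All.lookup z∉ (∈-++⁺ʳ Z i)) ∷ Unique-++ʳ Z u

  ℙ-cross : ∀ g c Z W → Unique (Z ++ W) → ℙ (cross Z W) (onCross g c Z W) ≡ chances g (map c W) ^ length Z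
  ℙ-cross g c []      W u = refl
  ℙ-cross g c (z ∷ Z) W u@(_ ∷ u′) with av , av′ ← star-avoids z Z W u = ≡.trans
    (ℙ-independent (star z W) (cross Z W) (onStar-Local g c z W) (onCross-Local g c Z W) av av′)
    (*-cong (ℙ-star g c z W (Unique-drop-middle z Z W u)) (ℙ-cross g c Z W u′))

  Inside-avoids : ∀ U W → (∀ {y} → y ∈ U → y ∈ W → ⊥) →
    Avoids (Inside U) (cross U W ++ edges W) × Avoids (Inside W) (edges U ++ cross U W)
  Inside-avoids U W dis = av , av′
    where
    av : Avoids (Inside U) (cross U W ++ edges W)
    av a b i with ∈-++⁻ (cross U W) i
    ... | inj₁ j with _ , k ← cross-∈ U W j = (λ (_ , l) → dis l k) , (λ (l , _) → dis l k)
    ... | inj₂ j with _ , k ← edges-∈ W j = (λ (_ , l) → dis l k) , (λ (l , _) → dis l k)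
    av′ : Avoids (Inside W) (edges U ++ cross U W)
    av′ a b i with ∈-++⁻ (edges U) i
    ... | inj₁ j with k , _ ← edges-∈ U j = (λ (l , _) → dis k l) , (λ (_ , l) → dis k l)
    ... | inj₂ j with k , _ ← cross-∈ U W j = (λ (l , _) → dis k l) , (λ (_ , l) → dis k l)

  Between-avoids : ∀ U W → (∀ {y} → y ∈ U → y ∈ W → ⊥) →
    Avoids (Between U W) (edges U) × Avoids (Between U W) (edges W)
  Between-avoids U W dis = av , av′
    where
    av : Avoids (Between U W) (edges U)
    av a b i with j , k ← edges-∈ U i =
        (λ { (inj₁ (_ , l)) → dis k l ; (inj₂ (_ , l)) → dis j l })
      , (λ { (inj₁ (_ , l)) → dis j l ; (inj₂ (_ , l)) → dis k l })
    av′ : Avoids (Between U W) (edges W)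
    av′ a b i with j , k ← edges-∈ W i =
        (λ { (inj₁ (l , _)) → dis l j ; (inj₂ (l , _)) → dis l k })
      , (λ { (inj₁ (l , _)) → dis l k ; (inj₂ (l , _)) → dis l j })

  ℙ-blocks : ∀ {E F G} U W → Unique (U ++ W) →
    (∀ e e′ → Agree (Inside U) e e′ → E e ≡ E e′) →
    (∀ e e′ → Agree (Between U W) e e′ → F e ≡ F e′) →
    (∀ e e′ → Agree (Inside W) e e′ → G e ≡ G e′) →
    ℙ (edges (U ++ W)) (λ e → E e ∧ (F e ∧ G e)) ≡ ℙ (edges U) E ⊗ (ℙ (cross U W) F ⊗ ℙ (edges W) G)
  ℙ-blocks {E} {F} {G} U W u lE lF lG = begin
    ℙ (edges (U ++ W)) (λ e → E e ∧ (F e ∧ G e))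
      ≡⟨ ≋⇒≡ (edges-++-≋ U W) (λ e e′ h → cong ⟦_⟧ (cong₂ _∧_ (lE e e′ (λ u v _ → h u v _))
           (cong₂ _∧_ (lF e e′ (λ u v _ → h u v _)) (lG e e′ (λ u v _ → h u v _))))) ∅ ⟩
    ℙ (edges U ++ (cross U W ++ edges W)) (λ e → E e ∧ (F e ∧ G e))
      ≡⟨ ℙ-independent {S′ = Touching} (edges U) (cross U W ++ edges W) lE
           (λ e e′ h → cong₂ _∧_ (lF e e′ (λ u v s → h u v (inj₁ s))) (lG e e′ (λ u v s → h u v (inj₂ s))))
           (proj₁ (Inside-avoids U W dis)) touching ⟩
    ℙ (edges U) E ⊗ ℙ (cross U W ++ edges W) (λ e → F e ∧ G e)
      ≡⟨ *-congˡ (ℙ-independent (cross U W) (edges W) lF lG (proj₂ (Between-avoids U W dis))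
           (λ a b i → proj₂ (Inside-avoids U W dis) a b (∈-++⁺ʳ (edges U) i))) ⟩
    ℙ (edges U) E ⊗ (ℙ (cross U W) F ⊗ ℙ (edges W) G) ∎
    where
    dis : ∀ {y} → y ∈ U → y ∈ W → ⊥
    dis = Unique-disjoint U u
    -- The joint support of the last two events, so that the first can be split off from both at
    -- once.
    Touching : Support
    Touching a b = Between U W a b ⊎ Inside W a b
    touching : Avoids Touching (edges U)
    touching a b i with p , r ← proj₁ (Between-avoids U W dis) a b i
                   with p′ , r′ ← proj₂ (Inside-avoids U W dis) a b (∈-++⁺ˡ i) = [ p , p′ ]′ , [ r , r′ ]′

  -- Splitting off a vertex outside A ∪ T

  P-isolate : ∀ v W c → Unique (v ∷ W) → c v ≡ nowhere → P (v ∷ W) c ≡ P W c ⊗ chances sealed (map c W)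
  P-isolate v W c u cv = begin
    ℙ (star v W ++ edges W) (event (v ∷ W) c)
      ≡⟨ ℙ-cong (edges (v ∷ W)) pointwise ⟩
    ℙ (star v W ++ edges W) (λ e → onStar sealed c v W e ∧ event W c e)
      ≡⟨ ℙ-independent (star v W) (edges W) (onStar-Local sealed c v W) (event-Local W c)
           (proj₂ (Between-avoids (v ∷ []) W dis))
           (λ a b i → proj₂ (Inside-avoids (v ∷ []) W dis) a b (∈-++⁺ˡ i)) ⟩
    ℙ (star v W) (onStar sealed c v W) ⊗ P W c
      ≡⟨ *-congʳ (ℙ-star sealed c v W u) ⟩
    chances sealed (map c W) ⊗ P W c
      ≡⟨ *-comm _ _ ⟩
    P W c ⊗ chances sealed (map c W) ∎
    where
    dis : ∀ {y} → y ∈ v ∷ [] → y ∈ W → ⊥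
    dis = Unique-disjoint (v ∷ []) u
    pointwise : ∀ e → event (v ∷ W) c e ≡ onStar sealed c v W e ∧ event W c e
    pointwise e = ≡true-ext
      (λ h → let ev , s = isolate (event⁻ (v ∷ W) c e h) in
        ∧-true⁺ (all-true⁺ _ W λ w i → sealed-true⁺ w (s w i)) (event⁺ W c e ev))
      (λ h → let s , ev = ∧-true⁻ {onStar sealed c v W e} h in
        event⁺ (v ∷ W) c e (unisolate (event⁻ W c e ev) (λ w i → sealed-true⁻ w (all-true⁻ _ s i))))
      where open Isolate e c v W cv

  Q-isolate : ∀ w → Q (nowhere ∷ w) ≡ Q w ⊗ chances sealed w
  Q-isolate w = begin
    Q (nowhere ∷ w)
      ≡⟨ P-isolate 0 (applyUpTo suc n) (nth (nowhere ∷ w)) (upTo⁺ (suc n)) refl ⟩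
    P (applyUpTo suc n) (nth (nowhere ∷ w)) ⊗ chances sealed (map (nth (nowhere ∷ w)) (applyUpTo suc n))
      ≡⟨ cong₂ (λ a b → a ⊗ chances sealed b)
           (P≡Q (AllPairs.tail (upTo⁺ (suc n))) (↭-reflexive shift)) shift ⟩
    Q w ⊗ chances sealed w ∎
    where
    n = length w
    shift : map (nth (nowhere ∷ w)) (applyUpTo suc n) ≡ w
    shift = ≡.trans (map-applyUpTo suc (nth (nowhere ∷ w)) n) (≡.trans (sym (map-upTo (nth w) n)) (map-nth w))

  -- Conditioning on the set cut off by a vertex

  Σsplit : List ℕ → (List ℕ → List ℕ → R) → R
  Σsplit []      F = F [] []
  Σsplit (m ∷ M) F = Σsplit M (λ Z W → F (m ∷ Z) W) ⊕ Σsplit M (λ Z W → F Z (m ∷ W))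

  Σsplit-cong : ∀ M {F G} → (∀ Z W → Z ++ W ↭ M → F Z W ≡ G Z W) → Σsplit M F ≡ Σsplit M G
  Σsplit-cong []      h = h [] [] ↭-refl
  Σsplit-cong (m ∷ M) h = +-cong
    (Σsplit-cong M λ Z W p → h (m ∷ Z) W (prep m p))
    (Σsplit-cong M λ Z W p → h Z (m ∷ W) (↭-trans (↭.shift m Z W) (prep m p)))

  Σsplit-zero : ∀ M → Σsplit M (λ _ _ → 𝟘) ≡ 𝟘
  Σsplit-zero []      = refl
  Σsplit-zero (m ∷ M) = ≡.trans (+-cong (Σsplit-zero M) (Σsplit-zero M)) (+-identityˡ 𝟘)

  𝔼-Σsplit : ∀ L M (F : List ℕ → List ℕ → Digraph → R) e → 𝔼 L (λ e → Σsplit M (λ Z W → F Z W e)) e ≡ Σsplit M (λ Z W → 𝔼 L (F Z W) e)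
  𝔼-Σsplit L []      F e = refl
  𝔼-Σsplit L (m ∷ M) F e = ≡.trans (𝔼-⊕ L _ _ e)
    (+-cong (𝔼-Σsplit L M (λ Z W → F (m ∷ Z) W) e) (𝔼-Σsplit L M (λ Z W → F Z (m ∷ W)) e))

  -- Exactly one split is the one prescribed by `b`. Inserting this sum therefore leaves an
  -- indicator unchanged while recording which vertices have a bypass.
  Σsplit-unique : ∀ b k M → Σsplit M (λ Z W → ⟦ k ∧ (all (not ∘ b) Z ∧ all b W) ⟧) ≡ ⟦ k ⟧
  Σsplit-unique b k [] = cong ⟦_⟧ (∧-identityʳ k)
    where open import Data.Bool.Properties using (∧-identityʳ)
  Σsplit-unique b k (m ∷ M) with b m
  ... | true  = ≡.trans (+-cong (≡.trans (Σsplit-cong M (λ Z W _ → cong ⟦_⟧ (∧-zeroʳ k))) (Σsplit-zero M))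
                                (Σsplit-unique b k M)) (+-identityˡ _)
  ... | false = ≡.trans (+-cong (Σsplit-unique b k M)
                  (≡.trans (Σsplit-cong M (λ Z W _ → cong ⟦_⟧
                     (≡.trans (cong (k ∧_) (∧-zeroʳ (all (not ∘ b) Z))) (∧-zeroʳ k)))) (Σsplit-zero M)))
                  (+-identityʳ _)

  escape : (ℕ → Cls) → ℕ → List ℕ → Digraph → Bool
  escape c v W e = onStar unfed c v W e ∧ not (onStar sealed c v W e)

  ⊖-unique : ∀ {a b k} → a ⊕ b ≡ k → a ≡ k ⊕ neg b
  ⊖-unique {a} {b} {k} h = begin
    a                ≡⟨ +-identityʳ a ⟨
    a ⊕ 𝟘            ≡⟨ +-congˡ (-‿inverseʳ b) ⟨
    a ⊕ (b ⊕ neg b)  ≡⟨ +-assoc a b (neg b) ⟨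
    (a ⊕ b) ⊕ neg b  ≡⟨ +-congʳ h ⟩
    k ⊕ neg b        ∎

  -- Sealed implies unfed, so the probability of the difference is the difference of two products
  -- over the star.
  ℙ-escape : ∀ c v W → Unique (v ∷ W) →
    ℙ (star v W) (escape c v W) ≡ chances unfed (map c W) ⊕ neg (chances sealed (map c W))
  ℙ-escape c v W u = ⊖-unique (begin
    ℙ (star v W) (escape c v W) ⊕ chances sealed (map c W)
      ≡⟨ +-congˡ (ℙ-star sealed c v W u) ⟨
    ℙ (star v W) (escape c v W) ⊕ ℙ (star v W) (onStar sealed c v W)
      ≡⟨ 𝔼-⊕ (star v W) _ _ ∅ ⟨
    𝔼 (star v W) (λ e → ⟦ escape c v W e ⟧ ⊕ ⟦ onStar sealed c v W e ⟧) ∅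
      ≡⟨ 𝔼-cong (star v W) (λ e → split (onStar unfed c v W e) (onStar sealed c v W e) (implies e)) ∅ ⟩
    ℙ (star v W) (onStar unfed c v W)
      ≡⟨ ℙ-star unfed c v W u ⟩
    chances unfed (map c W) ∎)
    where
    implies : ∀ e → onStar sealed c v W e ≡ true → onStar unfed c v W e ≡ true
    implies e h = all-true⁺ _ W λ w i → proj₂ (∧-true⁻ {not (e v w ∧ inA (c w))} (all-true⁻ _ h i))
    split : ∀ a b → (b ≡ true → a ≡ true) → ⟦ a ∧ not b ⟧ ⊕ ⟦ b ⟧ ≡ ⟦ a ⟧
    split true  true  h = +-identityˡ 𝟙
    split true  false h = +-identityʳ 𝟙
    split false true  h with () ← h refl
    split false false h = +-identityˡ 𝟘

  -- `M` holds the plain vertices of `A ∖ T` other than `v`, the only candidates for being cut off;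
  -- the vertices of `W` always remain.
  module _ (c : ℕ → Cls) (v : ℕ) (M W : List ℕ) (u : Unique (v ∷ M ++ W))
    (cM : ∀ {z} → z ∈ v ∷ M → c z ≡ plainA) (cW : ∀ {w} → w ∈ W → Core (c w)) where

    private
      V U : List ℕ
      V = v ∷ M ++ W
      U = M ++ W

      bypass : Digraph → ℕ → Bool
      bypass e = reach (reversed e) U (isK ∘ c)

      crossing : List ℕ → List ℕ → Digraph → Bool
      crossing Z M′ e = escape c v (M′ ++ W) e ∧ onCross sealed c Z (M′ ++ W) e

      factored : List ℕ → List ℕ → Digraph → Bool
      factored Z M′ e = event (v ∷ Z) (pieceCls v) e ∧ (crossing Z M′ e ∧ event (M′ ++ W) c e)

      module _ (Z M′ : List ℕ) (p : Z ++ M′ ↭ M) where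

        perm : V ↭ (v ∷ Z) ++ (M′ ++ W)
        perm = prep v (↭-sym (↭-trans (↭-sym (↭.++-assoc Z M′ W)) (↭.++⁺ʳ W p)))

        u′ : Unique ((v ∷ Z) ++ (M′ ++ W))
        u′ = Unique-↭ perm u

        Z⊆M : ∀ {z} → z ∈ Z → z ∈ M
        Z⊆M i = ∈-resp-↭ p (∈-++⁺ˡ i)

        U⊆ : ∀ {w} → w ∈ U → w ∈ Z ⊎ w ∈ M′ ++ W
        U⊆ i with ∈-++⁻ M i
        ... | inj₂ j = inj₂ (∈-++⁺ʳ M′ j)
        ... | inj₁ j with ∈-++⁻ Z (∈-resp-↭ (↭-sym p) j)
        ...   | inj₁ k = inj₁ k
        ...   | inj₂ k = inj₂ (∈-++⁺ˡ k)

        W⊆U : ∀ {w} → w ∈ M′ ++ W → w ∈ U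
        W⊆U i with ∈-++⁻ M′ i
        ... | inj₁ j = ∈-++⁺ˡ (∈-resp-↭ p (∈-++⁺ʳ Z j))
        ... | inj₂ j = ∈-++⁺ʳ M j

        cW′ : ∀ {w} → w ∈ M′ ++ W → c w ≡ plainA ⊎ Core (c w)
        cW′ i with ∈-++⁻ M′ i
        ... | inj₁ j = inj₁ (cM (there (∈-resp-↭ p (∈-++⁺ʳ Z j))))
        ... | inj₂ j = inj₂ (cW j)

        V⊆ : ∀ {w} → w ∈ V → w ≡ v ⊎ w ∈ U
        V⊆ (here p)  = inj₁ p
        V⊆ (there i) = inj₂ i

        Z⊆U : ∀ {z} → z ∈ Z → z ∈ U
        Z⊆U i = ∈-++⁺ˡ (Z⊆M i)

        cZ : ∀ {z} → z ∈ v ∷ Z → c z ≡ plainA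
        cZ (here p)  = cM (here p)
        cZ (there i) = cM (there (Z⊆M i))

        -- For a prescribed split, the event turns into conditions on disjoint sets of pairs.
        -- `Forward` and `Backward` give the two directions, the second one also returning the
        -- split.
        pointwise : ∀ e → event V c e ∧ (all (not ∘ bypass e) Z ∧ all (bypass e) M′) ≡ factored Z M′ e
        pointwise e = ≡true-ext to from
          where
          open Peel e c v {V} {U} {Z} {M′ ++ W} V⊆ (here refl) there U⊆ Z⊆U W⊆U cZ cW′
          core≢plainA : ∀ {k} → Core k → ¬ k ≡ plainA
          core≢plainA (inj₁ ()) refl
          core≢plainA (inj₂ ()) refl
          byW : all (bypass e) M′ ≡ true → ∀ w → w ∈ M′ ++ W → c w ≡ plainA → Reach (reversed e) U (isK ∘ c) w
          byW h w i k with ∈-++⁻ M′ i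
          ... | inj₁ j = reach⇒Reach (reversed e) U (isK ∘ c) (all-true⁻ (bypass e) h j)
          ... | inj₂ j = ⊥-elim (core≢plainA (cW j) k)
          gather : Pieces → factored Z M′ e ≡ true
          gather ps =
            ∧-true⁺ (event⁺ (v ∷ Z) (pieceCls v) e (piece ps))
              (∧-true⁺ (∧-true⁺ (∧-true⁺
                  (all-true⁺ _ (M′ ++ W) λ w i → not-true⁺ λ k → entry ps w i (∧-true⁻ {e w v} k))
                  (not-true⁺ λ k → exit ps λ w i → sealed-true⁻ {e} {c} {v} w
                     (all-true⁻ (λ w → sealed (c w) (e v w) (e w v)) k i)))
                (all-true⁺ _ Z λ z i → all-true⁺ _ (M′ ++ W) λ w j → sealed-true⁺ {e} {c} {z} w (sealZ ps z w i j)))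
                (event⁺ (M′ ++ W) c e (rest ps)))
          scatter : factored Z M′ e ≡ true → Pieces
          scatter h =
            let evZ , h₁ = ∧-true⁻ {event (v ∷ Z) (pieceCls v) e} h
                h₂ , evW = ∧-true⁻ {crossing Z M′ e} h₁
                h₃ , hC  = ∧-true⁻ {escape c v (M′ ++ W) e} h₂
                hE , hX  = ∧-true⁻ {onStar unfed c v (M′ ++ W) e} h₃
            in record
              { rest  = event⁻ (M′ ++ W) c e evW
              ; piece = event⁻ (v ∷ Z) (pieceCls v) e evZ
              ; sealZ = λ z w i j → sealed-true⁻ {e} {c} {z} w
                  (all-true⁻ (λ w → sealed (c w) (e z w) (e w z)) (all-true⁻ (λ z → onStar sealed c z (M′ ++ W) e) hC i) j)
              ; entry = λ w i (a , t) → not-true⁻ (all-true⁻ (λ w → unfed (c w) (e v w) (e w v)) hE i) (∧-true⁺ a t)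
              ; exit  = λ s → not-true⁻ hX (all-true⁺ _ (M′ ++ W) λ w i → sealed-true⁺ {e} {c} {v} w (s w i))
              }
          to : event V c e ∧ (all (not ∘ bypass e) Z ∧ all (bypass e) M′) ≡ true → factored Z M′ e ≡ true
          to h =
            let ev , h′ = ∧-true⁻ {event V c e} h
                hZ , hM = ∧-true⁻ {all (not ∘ bypass e) Z} h′
            in gather (Forward.forward (event⁻ V c e ev)
                 (λ z i r → not-true⁻ (all-true⁻ (not ∘ bypass e) hZ i)
                    (Reach⇒reach (reversed e) U (isK ∘ c) (∈-++⁺ˡ (Z⊆M i)) r)) (byW hM))
          from : factored Z M′ e ≡ true → event V c e ∧ (all (not ∘ bypass e) Z ∧ all (bypass e) M′) ≡ true
          from h = ∧-true⁺ (event⁺ V c e backward) (∧-true⁺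
              (all-true⁺ (not ∘ bypass e) Z λ z i → not-true⁺ λ k → bypass-Z z i (reach⇒Reach (reversed e) U (isK ∘ c) k))
              (all-true⁺ (bypass e) M′ λ w i → Reach⇒reach (reversed e) U (isK ∘ c) (W⊆U (∈-++⁺ˡ i))
                 (bypass-W w (∈-++⁺ˡ i) (cM (there (∈-resp-↭ p (∈-++⁺ʳ Z i)))))))
            where open Backward (scatter h)

        ℙ-factored : ℙ (edges V) (factored Z M′) ≡
          P (v ∷ Z) (pieceCls v) ⊗
          (((chances unfed (map c (M′ ++ W)) ⊕ neg (chances sealed (map c (M′ ++ W))))
             ⊗ chances sealed (map c (M′ ++ W)) ^ length Z)
           ⊗ P (M′ ++ W) c)
        ℙ-factored = begin
          ℙ (edges V) (factored Z M′)
            ≡⟨ ≋⇒≡ (edges-↭ perm) ext ∅ ⟩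
          ℙ (edges ((v ∷ Z) ++ W′)) (factored Z M′)
            ≡⟨ ℙ-blocks (v ∷ Z) W′ u′ (event-Local (v ∷ Z) (pieceCls v)) crossing-Local (event-Local W′ c) ⟩
          P (v ∷ Z) (pieceCls v) ⊗ (ℙ (star v W′ ++ cross Z W′) (crossing Z M′) ⊗ P W′ c)
            ≡⟨ *-congˡ (*-congʳ (ℙ-independent (star v W′) (cross Z W′) escape-Local (onCross-Local sealed c Z W′)
                 (proj₁ (star-avoids v Z W′ u′)) (proj₂ (star-avoids v Z W′ u′)))) ⟩
          P (v ∷ Z) (pieceCls v) ⊗ ((ℙ (star v W′) (escape c v W′) ⊗ ℙ (cross Z W′) (onCross sealed c Z W′)) ⊗ P W′ c)
            ≡⟨ *-congˡ (*-congʳ (*-cong (ℙ-escape c v W′ (Unique-drop-middle v Z W′ u′))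
                 (ℙ-cross sealed c Z W′ (AllPairs.tail u′)))) ⟩
          _ ∎
          where
          W′ = M′ ++ W
          escape-Local : ∀ e e′ → Agree (Between (v ∷ []) W′) e e′ → escape c v W′ e ≡ escape c v W′ e′
          escape-Local e e′ h = cong₂ (λ a b → a ∧ not b)
            (onStar-Local unfed c v W′ e e′ h) (onStar-Local sealed c v W′ e e′ h)
          crossing-Local : ∀ e e′ → Agree (Between (v ∷ Z) W′) e e′ → crossing Z M′ e ≡ crossing Z M′ e′
          crossing-Local e e′ h = cong₂ _∧_
            (escape-Local e e′ λ a b → λ { (inj₁ (here refl , j)) → h a b (inj₁ (here refl , j))
                                         ; (inj₂ (here refl , j)) → h a b (inj₂ (here refl , j)) })
            (onCross-Local sealed c Z W′ e e′ λ a b → λ { (inj₁ (i , j)) → h a b (inj₁ (there i , j))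
                                                        ; (inj₂ (i , j)) → h a b (inj₂ (there i , j)) })
          ext : Ext (λ e → ⟦ factored Z M′ e ⟧)
          ext e e′ h = cong ⟦_⟧ (cong₂ _∧_ (event-Local (v ∷ Z) (pieceCls v) e e′ (λ a b _ → h a b _))
            (cong₂ _∧_ (crossing-Local e e′ (λ a b _ → h a b _)) (event-Local W′ c e e′ (λ a b _ → h a b _))))

    -- The law of total probability, over the set of candidates that reach `a` only through `v`.
    P-peel : P V c ≡ Σsplit M λ Z M′ →
      P (v ∷ Z) (pieceCls v) ⊗
      (((chances unfed (map c (M′ ++ W)) ⊕ neg (chances sealed (map c (M′ ++ W))))
         ⊗ chances sealed (map c (M′ ++ W)) ^ length Z)
       ⊗ P (M′ ++ W) c)
    P-peel = begin
      ℙ (edges V) (event V c)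
        ≡⟨ 𝔼-cong (edges V) (λ e → Σsplit-unique (bypass e) (event V c e) M) ∅ ⟨
      𝔼 (edges V) (λ e → Σsplit M λ Z M′ → ⟦ event V c e ∧ (all (not ∘ bypass e) Z ∧ all (bypass e) M′) ⟧) ∅
        ≡⟨ 𝔼-Σsplit (edges V) M (λ Z M′ e → ⟦ event V c e ∧ (all (not ∘ bypass e) Z ∧ all (bypass e) M′) ⟧) ∅ ⟩
      Σsplit M (λ Z M′ → ℙ (edges V) (λ e → event V c e ∧ (all (not ∘ bypass e) Z ∧ all (bypass e) M′)))
        ≡⟨ Σsplit-cong M (λ Z M′ p → ≡.trans (ℙ-cong (edges V) (pointwise Z M′ p)) (ℙ-factored Z M′ p)) ⟩
      _ ∎

  -- `pairs` groups by the larger endpoint. Moving the last vertex to the front turns its group into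
  -- a star, up to the orientation of the pairs.
  edges-pairs : ∀ n → edges (upTo n) ≋ pairs n
  edges-pairs zero    = ≋-refl
  edges-pairs (suc n) = subst₂ _≋_ (cong edges (upTo-∷ʳ n)) pairs-suc
    (≋-trans (edges-↭ (↭.++-comm (upTo n) (n ∷ [])))
      (≋-trans (≋-++ (star-flip n (upTo n)) (edges-pairs n)) (↭⇒≋ (↭.++-comm (into n) (pairs n)))))
    where
    into : ℕ → List (ℕ × ℕ)
    into j = map (_, j) (upTo j)
    pairs-suc : pairs n ++ into n ≡ pairs (suc n)
    pairs-suc = ≡.trans (cong (pairs n ++_) (sym (++-identityʳ (into n))))
      (≡.trans (sym (concatMap-++ into (upTo n) (n ∷ []))) (cong (concatMap into) (upTo-∷ʳ n)))

  -- Sums over words and binomial sums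

  Σ< : ℕ → (ℕ → R) → R
  Σ< zero    f = 𝟘
  Σ< (suc n) f = f 0 ⊕ Σ< n (f ∘ suc)

  Σ<-cong : ∀ n {f g : ℕ → R} → (∀ i → i < n → f i ≡ g i) → Σ< n f ≡ Σ< n g
  Σ<-cong zero    h = refl
  Σ<-cong (suc n) h = +-cong (h 0 (s≤s z≤n)) (Σ<-cong n (λ i l → h (suc i) (s≤s l)))

  Σ<-⊕ : ∀ n (f g : ℕ → R) → Σ< n (λ i → f i ⊕ g i) ≡ Σ< n f ⊕ Σ< n g
  Σ<-⊕ zero    f g = sym (+-identityˡ 𝟘)
  Σ<-⊕ (suc n) f g = ≡.trans (+-congˡ (Σ<-⊕ n (f ∘ suc) (g ∘ suc))) (⊕-interchange _ _ _ _)

  Σ<-last : ∀ n (f : ℕ → R) → Σ< (suc n) f ≡ Σ< n f ⊕ f n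
  Σ<-last zero    f = +-comm _ _
  Σ<-last (suc n) f = ≡.trans (+-congˡ (Σ<-last n (f ∘ suc))) (sym (+-assoc _ _ _))

  ι : ℕ → R
  ι zero    = 𝟘
  ι (suc n) = 𝟙 ⊕ ι n

  ι-+ : ∀ m n → ι (m ℕ.+ n) ≡ ι m ⊕ ι n
  ι-+ zero    n = sym (+-identityˡ _)
  ι-+ (suc m) n = ≡.trans (+-congˡ (ι-+ m n)) (sym (+-assoc _ _ _))

  bin : ℕ → ℕ → R
  bin n k = ι (n C k)

  bin-pascal : ∀ n k → bin (suc n) (suc k) ≡ bin n k ⊕ bin n (suc k)
  bin-pascal n k = ≡.trans (cong ι (sym (nCk+nC[k+1]≡[n+1]C[k+1] n k))) (ι-+ (n C k) (n C suc k))

  -- The sum over all ways of deciding m times between two options, k and l counting the outcomes.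
  Bin : ℕ → (ℕ → ℕ → R) → R
  Bin zero    G = G 0 0
  Bin (suc m) G = Bin m (λ k l → G (suc k) l) ⊕ Bin m (λ k l → G k (suc l))

  Bin-cong : ∀ m {G H : ℕ → ℕ → R} → (∀ k l → k ℕ.+ l ≡ m → G k l ≡ H k l) → Bin m G ≡ Bin m H
  Bin-cong zero    h = h 0 0 refl
  Bin-cong (suc m) h = +-cong
    (Bin-cong m (λ k l p → h (suc k) l (cong suc p)))
    (Bin-cong m (λ k l p → h k (suc l) (≡.trans (ℕ.+-suc k l) (cong suc p))))

  Bin-⊕ : ∀ m (G H : ℕ → ℕ → R) → Bin m (λ k l → G k l ⊕ H k l) ≡ Bin m G ⊕ Bin m H
  Bin-⊕ zero    G H = refl
  Bin-⊕ (suc m) G H = ≡.trans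
    (+-cong (Bin-⊕ m (λ k l → G (suc k) l) (λ k l → H (suc k) l)) (Bin-⊕ m (λ k l → G k (suc l)) (λ k l → H k (suc l))))
    (⊕-interchange _ _ _ _)

  Bin-zero : ∀ m → Bin m (λ _ _ → 𝟘) ≡ 𝟘
  Bin-zero zero    = refl
  Bin-zero (suc m) = ≡.trans (+-cong (Bin-zero m) (Bin-zero m)) (+-identityˡ 𝟘)

  Bin-first : ∀ m (G : ℕ → ℕ → R) → (∀ k l → G (suc k) l ≡ 𝟘) → Bin m G ≡ G 0 m
  Bin-first zero    G h = refl
  Bin-first (suc m) G h = begin
    Bin m (λ k l → G (suc k) l) ⊕ Bin m (λ k l → G k (suc l))
      ≡⟨ +-cong (≡.trans (Bin-cong m (λ k l _ → h k l)) (Bin-zero m)) (Bin-first m (λ k l → G k (suc l)) (λ k l → h k (suc l))) ⟩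
    𝟘 ⊕ G 0 (suc m)
      ≡⟨ +-identityˡ _ ⟩
    G 0 (suc m) ∎

  -- Pascal's rule. The two sums are aligned by separating the term `k = 0` of the second and
  -- extending its tail by the index `m + 1`, where the coefficient vanishes.
  Bin≡Σ : ∀ m (G : ℕ → ℕ → R) → Bin m G ≡ Σ< (suc m) (λ k → bin m k ⊗ G k (m ∸ k))
  Bin≡Σ zero    G = sym (≡.trans (+-identityʳ _) (≡.trans (*-congʳ (+-identityʳ 𝟙)) (*-identityˡ _)))
  Bin≡Σ (suc m) G = begin
    Bin m (λ k l → G (suc k) l) ⊕ Bin m (λ k l → G k (suc l))
      ≡⟨ +-cong (Bin≡Σ m (λ k l → G (suc k) l)) (Bin≡Σ m (λ k l → G k (suc l))) ⟩
    Σ< (suc m) A ⊕ (bin m 0 ⊗ G 0 (suc m) ⊕ Σ< m (λ k → bin m (suc k) ⊗ G (suc k) (suc (m ∸ suc k))))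
      ≡⟨ +-congˡ (+-congˡ (Σ<-cong m (λ k l → cong (λ j → bin m (suc k) ⊗ G (suc k) j) (sym (ℕ.+-∸-assoc 1 l))))) ⟩
    Σ< (suc m) A ⊕ (bin m 0 ⊗ G 0 (suc m) ⊕ Σ< m B)
      ≡⟨ +-congˡ (+-congˡ last) ⟨
    Σ< (suc m) A ⊕ (bin m 0 ⊗ G 0 (suc m) ⊕ Σ< (suc m) B)
      ≡⟨ ≡.trans (sym (+-assoc _ _ _)) (≡.trans (+-congʳ (+-comm _ _)) (+-assoc _ _ _)) ⟩
    bin m 0 ⊗ G 0 (suc m) ⊕ (Σ< (suc m) A ⊕ Σ< (suc m) B)
      ≡⟨ +-congˡ (Σ<-⊕ (suc m) A B) ⟨
    bin (suc m) 0 ⊗ G 0 (suc m) ⊕ Σ< (suc m) (λ k → A k ⊕ B k)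
      ≡⟨ +-congˡ (Σ<-cong (suc m) (λ k _ → ≡.trans (sym (distribʳ (G (suc k) (m ∸ k)) _ _)) (*-congʳ (sym (bin-pascal m k))))) ⟩
    Σ< (suc (suc m)) (λ k → bin (suc m) k ⊗ G k (suc m ∸ k)) ∎
    where
    A B : ℕ → R
    A k = bin m k ⊗ G (suc k) (m ∸ k)
    B k = bin m (suc k) ⊗ G (suc k) (m ∸ k)
    last : Σ< (suc m) B ≡ Σ< m B
    last = ≡.trans (Σ<-last m B) (≡.trans (+-congˡ (≡.trans
      (*-congʳ (cong ι (k>n⇒nCk≡0 (ℕ.n<1+n m)))) (zeroˡ _))) (+-identityʳ _))

  Σsplit-lengths : ∀ M (G : ℕ → ℕ → R) → Σsplit M (λ Z W → G (length Z) (length W)) ≡ Bin (length M) G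
  Σsplit-lengths []      G = refl
  Σsplit-lengths (m ∷ M) G = +-cong (Σsplit-lengths M (λ k l → G (suc k) l)) (Σsplit-lengths M (λ k l → G k (suc l)))

  ΣL : List Cls → (Cls → R) → R
  ΣL []       f = 𝟘
  ΣL (k ∷ ks) f = f k ⊕ ΣL ks f

  ΣL-cong : ∀ ks {f g : Cls → R} → (∀ k → f k ≡ g k) → ΣL ks f ≡ ΣL ks g
  ΣL-cong []       h = refl
  ΣL-cong (k ∷ ks) h = +-cong (h k) (ΣL-cong ks h)

  ΣW : List Cls → ℕ → (List Cls → R) → R
  ΣW ks zero    F = F []
  ΣW ks (suc m) F = ΣL ks (λ k → ΣW ks m (λ w → F (k ∷ w)))

  ΣW-cong : ∀ ks m {F G : List Cls → R} → (∀ w → All (_∈ ks) w → length w ≡ m → F w ≡ G w) → ΣW ks m F ≡ ΣW ks m G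
  ΣW-cong ks zero    h = h [] [] refl
  ΣW-cong ks (suc m) {F} {G} h = go ks id
    where
    go : ∀ ls → (∀ {k} → k ∈ ls → k ∈ ks) →
      ΣL ls (λ k → ΣW ks m (λ w → F (k ∷ w))) ≡ ΣL ls (λ k → ΣW ks m (λ w → G (k ∷ w)))
    go []       i = refl
    go (k ∷ ls) i = +-cong (ΣW-cong ks m (λ w a p → h (k ∷ w) (i (here refl) ∷ a) (cong suc p))) (go ls (i ∘ there))

  ΣW-single : ∀ k m (F : List Cls → R) → ΣW (k ∷ []) m F ≡ F (replicate m k)
  ΣW-single k zero    F = refl
  ΣW-single k (suc m) F = ≡.trans (+-identityʳ _) (ΣW-single k m (λ w → F (k ∷ w)))

  Bin-ΣL : ∀ m ks (G : Cls → ℕ → ℕ → R) → ΣL ks (λ y → Bin m (G y)) ≡ Bin m (λ k l → ΣL ks (λ y → G y k l))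
  Bin-ΣL m []       G = sym (Bin-zero m)
  Bin-ΣL m (y ∷ ks) G = ≡.trans (+-congˡ (Bin-ΣL m ks G)) (sym (Bin-⊕ m (G y) (λ k l → ΣL ks (λ y → G y k l))))

  -- Permutation invariance lets all occurrences of one letter be moved to the front; `Bin` then
  -- counts the positions they came from.
  ΣW-letter : ∀ k ks m (F : List Cls → R) → (∀ {w w′} → w ↭ w′ → F w ≡ F w′) →
    ΣW (k ∷ ks) m F ≡ Bin m (λ i l → ΣW ks l (λ w → F (replicate i k ++ w)))
  ΣW-letter k ks zero    F h = refl
  ΣW-letter k ks (suc m) F h = +-cong
    (ΣW-letter k ks m (λ w → F (k ∷ w)) (h ∘ prep k))
    (begin
      ΣL ks (λ y → ΣW (k ∷ ks) m (λ w → F (y ∷ w)))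
        ≡⟨ ΣL-cong ks (λ y → ΣW-letter k ks m (λ w → F (y ∷ w)) (h ∘ prep y)) ⟩
      ΣL ks (λ y → Bin m (λ i l → ΣW ks l (λ w → F (y ∷ replicate i k ++ w))))
        ≡⟨ Bin-ΣL m ks (λ y i l → ΣW ks l (λ w → F (y ∷ replicate i k ++ w))) ⟩
      Bin m (λ i l → ΣL ks (λ y → ΣW ks l (λ w → F (y ∷ replicate i k ++ w))))
        ≡⟨ Bin-cong m (λ i l _ → ΣL-cong ks (λ y → ΣW-cong ks l (λ w _ _ → h (↭-sym (↭.shift y (replicate i k) w))))) ⟩
      Bin m (λ i l → ΣL ks (λ y → ΣW ks l (λ w → F (replicate i k ++ y ∷ w)))) ∎)

  -- Total probability

  𝔼-ΣL : ∀ L ks (F : Cls → Digraph → R) e → 𝔼 L (λ e → ΣL ks (λ k → F k e)) e ≡ ΣL ks (λ k → 𝔼 L (F k) e)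
  𝔼-ΣL L []       F e = 𝔼-const L 𝟘 e
  𝔼-ΣL L (k ∷ ks) F e = ≡.trans (𝔼-⊕ L (F k) (λ e → ΣL ks (λ k → F k e)) e) (+-congˡ (𝔼-ΣL L ks F e))

  𝔼-ΣW : ∀ L ks m (F : List Cls → Digraph → R) e → 𝔼 L (λ e → ΣW ks m (λ w → F w e)) e ≡ ΣW ks m (λ w → 𝔼 L (F w) e)
  𝔼-ΣW L ks zero    F e = refl
  𝔼-ΣW L ks (suc m) F e = ≡.trans (𝔼-ΣL L ks (λ k e → ΣW ks m (λ w → F (k ∷ w) e)) e)
    (ΣL-cong ks (λ k → 𝔼-ΣW L ks m (λ w → F (k ∷ w)) e))

  ΣW-zero : ∀ ks m → ΣW ks m (λ _ → 𝟘) ≡ 𝟘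
  ΣW-zero ks zero    = refl
  ΣW-zero ks (suc m) = go ks
    where
    go : ∀ ls → ΣL ls (λ _ → ΣW ks m (λ _ → 𝟘)) ≡ 𝟘
    go []       = refl
    go (_ ∷ ls) = ≡.trans (+-cong (ΣW-zero ks m) (go ls)) (+-identityˡ 𝟘)

  matches : (ℕ → Bool) → (ℕ → Bool) → ℕ → Cls → Bool
  matches ρ κ u k = eqBool (ρ u) (inT k) ∧ eqBool (κ u) (inA k)

  -- At each position exactly one of the four letters has the prescribed memberships in `T` and `A`.
  ΣW-letters : ∀ ρ κ m → ΣW letters m (λ w → ⟦ onWord (matches ρ κ) w ⟧) ≡ 𝟙
  ΣW-letters ρ κ zero    = refl
  ΣW-letters ρ κ (suc m) with ρ 0 | κ 0 | ΣW-letters (ρ ∘ suc) (κ ∘ suc) m | ΣW-zero letters m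
  ... | true  | true  | h | z rewrite h | z = collapse₁
    where
    collapse₁ : 𝟙 ⊕ (𝟘 ⊕ (𝟘 ⊕ (𝟘 ⊕ 𝟘))) ≡ 𝟙
    collapse₁ rewrite +-identityˡ 𝟘 | +-identityˡ 𝟘 | +-identityˡ 𝟘 = +-identityʳ 𝟙
  ... | true  | false | h | z rewrite h | z | +-identityˡ 𝟘 | +-identityˡ 𝟘 | +-identityʳ 𝟙 = +-identityˡ 𝟙
  ... | false | true  | h | z rewrite h | z | +-identityˡ 𝟘 | +-identityʳ 𝟙 | +-identityˡ 𝟙 = +-identityˡ 𝟙
  ... | false | false | h | z rewrite h | z | +-identityʳ 𝟙 | +-identityˡ 𝟙 | +-identityˡ 𝟙 = +-identityˡ 𝟙

  unmarked : ∀ {w} → All (_∈ letters) w → (∀ u → isS (nth w u) ≡ false) × (∀ u → isK (nth w u) ≡ false)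
  unmarked a = (λ u → proj₁ (go a u)) , (λ u → proj₂ (go a u))
    where
    letter : ∀ {k} → k ∈ letters → isS k ≡ false × isK k ≡ false
    letter (here refl)                             = refl , refl
    letter (there (here refl))                     = refl , refl
    letter (there (there (here refl)))             = refl , refl
    letter (there (there (there (here refl))))     = refl , refl
    go : ∀ {w} → All (_∈ letters) w → ∀ u → isS (nth w u) ≡ false × isK (nth w u) ≡ false
    go []      u       = refl , refl
    go (i ∷ a) zero    = letter i
    go (i ∷ a) (suc u) = go a u

  -- Here `t` is vertex 0 and `a` is vertex 1. Summing over the classes of all other vertices leaves
  -- only the conditions at these two.
  ΣW-Q : ∀ m k k′ → isS k ≡ true → isK k ≡ false → isS k′ ≡ false → isK k′ ≡ true →
    ΣW letters m (λ w → Q (k ∷ k′ ∷ w)) ≡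
    ℙ (edges (upTo (2 ℕ.+ m))) (λ e →
      matches (reach e (upTo (2 ℕ.+ m)) (_≡ᵇ 0)) (reach (reversed e) (upTo (2 ℕ.+ m)) (_≡ᵇ 1)) 0 k ∧
      matches (reach e (upTo (2 ℕ.+ m)) (_≡ᵇ 0)) (reach (reversed e) (upTo (2 ℕ.+ m)) (_≡ᵇ 1)) 1 k′)
  ΣW-Q m k k′ Sk Kk Sk′ Kk′ = begin
    ΣW letters m (λ w → Q (k ∷ k′ ∷ w))
      ≡⟨ ΣW-cong letters m (λ { w a refl → ℙ-cong (edges V) (λ e → pointwise e w a) }) ⟩
    ΣW letters m (λ w → 𝔼 (edges V) (λ e → ⟦ g e 0 k ∧ (g e 1 k′ ∧ onWord (g e ∘ suc ∘ suc) w) ⟧) ∅)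
      ≡⟨ 𝔼-ΣW (edges V) letters m (λ w e → ⟦ g e 0 k ∧ (g e 1 k′ ∧ onWord (g e ∘ suc ∘ suc) w) ⟧) ∅ ⟨
    𝔼 (edges V) (λ e → ΣW letters m (λ w → ⟦ g e 0 k ∧ (g e 1 k′ ∧ onWord (g e ∘ suc ∘ suc) w) ⟧)) ∅
      ≡⟨ 𝔼-cong (edges V) (λ e → sum e (g e 0 k) (g e 1 k′)) ∅ ⟩
    ℙ (edges V) (λ e → g e 0 k ∧ g e 1 k′) ∎
    where
    V = upTo (2 ℕ.+ m)
    g : Digraph → ℕ → Cls → Bool
    g e = matches (reach e V (_≡ᵇ 0)) (reach (reversed e) V (_≡ᵇ 1))
    sum : ∀ e a b → ΣW letters m (λ w → ⟦ a ∧ (b ∧ onWord (g e ∘ suc ∘ suc) w) ⟧) ≡ ⟦ a ∧ b ⟧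
    sum e false b     = ΣW-zero letters m
    sum e true  false = ΣW-zero letters m
    sum e true  true  = ΣW-letters (reach e V (_≡ᵇ 0) ∘ suc ∘ suc) (reach (reversed e) V (_≡ᵇ 1) ∘ suc ∘ suc) m
    pointwise : ∀ e w → All (_∈ letters) w → event (upTo (2 ℕ.+ length w)) (nth (k ∷ k′ ∷ w)) e ≡
      onWord (matches (reach e (upTo (2 ℕ.+ length w)) (_≡ᵇ 0)) (reach (reversed e) (upTo (2 ℕ.+ length w)) (_≡ᵇ 1))) (k ∷ k′ ∷ w)
    pointwise e w a = ≡.trans
      (event-pointwise V′ (nth (k ∷ k′ ∷ w)) e 0 1
        (λ { 0 → Sk ; 1 → Sk′ ; (suc (suc u)) → proj₁ (unmarked a) u })
        (λ { 0 → Kk ; 1 → Kk′ ; (suc (suc u)) → proj₂ (unmarked a) u }))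
      (all-onWord (matches (reach e V′ (_≡ᵇ 0)) (reach (reversed e) V′ (_≡ᵇ 1))) (k ∷ k′ ∷ w))
      where V′ = upTo (2 ℕ.+ length w)

  -- Whether `t` lies in `A` and whether `a` lies in `T` are the same question, a path from `t` to
  -- `a`. So two of the four combinations of classes exhaust the space.
  Q-total : ∀ m → ΣW letters m (λ w → Q (sourceB ∷ sinkB ∷ w)) ⊕ ΣW letters m (λ w → Q (sourceT ∷ sinkA ∷ w)) ≡ 𝟙
  Q-total m = begin
    ΣW letters m (λ w → Q (sourceB ∷ sinkB ∷ w)) ⊕ ΣW letters m (λ w → Q (sourceT ∷ sinkA ∷ w))
      ≡⟨ +-cong (ΣW-Q m sourceB sinkB refl refl refl refl) (ΣW-Q m sourceT sinkA refl refl refl refl) ⟩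
    𝔼 (edges V) (λ e → ⟦ connected e ⟧) ∅ ⊕ 𝔼 (edges V) (λ e → ⟦ disconnected e ⟧) ∅
      ≡⟨ 𝔼-⊕ (edges V) (λ e → ⟦ connected e ⟧) (λ e → ⟦ disconnected e ⟧) ∅ ⟨
    𝔼 (edges V) (λ e → ⟦ connected e ⟧ ⊕ ⟦ disconnected e ⟧) ∅
      ≡⟨ 𝔼-cong (edges V) dichotomy ∅ ⟩
    𝔼 (edges V) (λ _ → 𝟙) ∅
      ≡⟨ 𝔼-const (edges V) 𝟙 ∅ ⟩
    𝟙 ∎
    where
    V = upTo (2 ℕ.+ m)
    0∈V : 0 ∈ V
    0∈V = here refl
    1∈V : 1 ∈ V
    1∈V = there (here refl)
    ρ κ : Digraph → ℕ → Bool
    ρ e = reach e V (_≡ᵇ 0)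
    κ e = reach (reversed e) V (_≡ᵇ 1)
    connected disconnected : Digraph → Bool
    connected    e = matches (ρ e) (κ e) 0 sourceB ∧ matches (ρ e) (κ e) 1 sinkB
    disconnected e = matches (ρ e) (κ e) 0 sourceT ∧ matches (ρ e) (κ e) 1 sinkA
    cases : ∀ a b c d → a ≡ true → d ≡ true → b ≡ c →
      ⟦ (eqBool a true ∧ eqBool b true) ∧ (eqBool c true ∧ eqBool d true) ⟧ ⊕
      ⟦ (eqBool a true ∧ eqBool b false) ∧ (eqBool c false ∧ eqBool d true) ⟧ ≡ 𝟙
    cases true true  .true  true refl refl refl = +-identityʳ 𝟙
    cases true false .false true refl refl refl = +-identityˡ 𝟙
    dichotomy : ∀ e → ⟦ connected e ⟧ ⊕ ⟦ disconnected e ⟧ ≡ 𝟙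
    dichotomy e = cases (ρ e 0) (κ e 0) (ρ e 1) (κ e 1)
      (Reach⇒reach e V _ 0∈V (base refl)) (Reach⇒reach (reversed e) V _ 1∈V (base refl))
      (≡true-ext
        (λ h → Reach⇒reach e V _ 1∈V (Reach-reversed (reversed e) V 1 0 0∈V (reach⇒Reach (reversed e) V _ h)))
        (λ h → Reach⇒reach (reversed e) V _ 0∈V (Reach-reversed e V 0 1 1∈V (reach⇒Reach e V _ h))))

  P-impossible : ∀ V c {u} → (∀ {z} → z ∈ V → isK (c z) ≡ true → inT (c z) ≡ false) →
    u ∈ V → inT (c u) ≡ true → inA (c u) ≡ true → P V c ≡ 𝟘
  P-impossible V c hK i t a = ≡.trans (ℙ-cong (edges V) (λ e → event-impossible e hK i t a)) (𝔼-const (edges V) 𝟘 ∅)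

  Q-impossible : ∀ w → (∀ {k} → k ∈ w → isK k ≡ true → inT k ≡ false) → bothB ∈ w → Q w ≡ 𝟘
  Q-impossible w hK i with u , j , eq ← ∈-map⁻ (nth w) (subst (bothB ∈_) (sym (map-nth w)) i) =
    P-impossible (upTo (length w)) (nth w)
      (λ {z} l → hK (subst (nth w z ∈_) (map-nth w) (∈-map⁺ (nth w) l))) j (cong inT (sym eq)) (cong inA (sym eq))

  -- Peeling off a plain vertex of A ∖ T

  -- After renaming, a summand of `P-peel` depends on the split only through the sizes of its two
  -- parts.
  Q-peel : ∀ m w → All Core w → Q (plainA ∷ replicate m plainA ++ w) ≡ Bin m λ k l →
    Q (sinkA ∷ replicate k plainA) ⊗
    (((chances unfed (replicate l plainA ++ w) ⊕ neg (chances sealed (replicate l plainA ++ w)))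
       ⊗ chances sealed (replicate l plainA ++ w) ^ k)
     ⊗ Q (replicate l plainA ++ w))
  Q-peel m w core = go (upTo (length word)) (map-nth word) (upTo⁺ (length word))
    where
    word = plainA ∷ replicate m plainA ++ w
    c = nth word
    G : ℕ → ℕ → R
    G k l = Q (sinkA ∷ replicate k plainA) ⊗
      (((chances unfed (replicate l plainA ++ w) ⊕ neg (chances sealed (replicate l plainA ++ w)))
         ⊗ chances sealed (replicate l plainA ++ w) ^ k)
       ⊗ Q (replicate l plainA ++ w))
    go : ∀ V → map c V ≡ word → Unique V → P V c ≡ Bin m G
    go (v ∷ V) eq u with M , W , refl , eqM , eqW ← map-split c V (replicate m plainA) (∷-injectiveʳ eq) = begin
      P (v ∷ M ++ W) c
        ≡⟨ P-peel c v M W u cM cW ⟩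
      _
        ≡⟨ Σsplit-cong M summand ⟩
      Σsplit M (λ Z M′ → G (length Z) (length M′))
        ≡⟨ Σsplit-lengths M G ⟩
      Bin (length M) G
        ≡⟨ cong (λ n → Bin n G) (≡.trans (sym (length-map c M)) (≡.trans (cong length eqM) (length-replicate m))) ⟩
      Bin m G ∎
      where
      cM : ∀ {z} → z ∈ v ∷ M → c z ≡ plainA
      cM (here refl) = ∷-injectiveˡ eq
      cM (there i)   = ∈-replicate m (subst (_ ∈_) eqM (∈-map⁺ c i))
      cW : ∀ {z} → z ∈ W → Core (c z)
      cW i = All.lookup core (subst (_ ∈_) eqW (∈-map⁺ c i))
      module _ (Z M′ : List ℕ) (p : Z ++ M′ ↭ M) where
        word′ : map c (M′ ++ W) ≡ replicate (length M′) plainA ++ w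
        word′ = ≡.trans (map-++ c M′ W) (cong₂ _++_
          (map-const c plainA M′ (λ i → cM (there (∈-resp-↭ p (∈-++⁺ʳ Z i))))) eqW)
        u′ : Unique ((v ∷ Z) ++ (M′ ++ W))
        u′ = Unique-↭ (prep v (↭-sym (↭-trans (↭-sym (↭.++-assoc Z M′ W)) (↭.++⁺ʳ W p)))) u
        pieceWord : map (pieceCls v) (v ∷ Z) ≡ sinkA ∷ replicate (length Z) plainA
        pieceWord = cong₂ _∷_ (cong (cls false true false) (≡ᵇ-refl v))
          (map-const (pieceCls v) plainA Z (λ {z} i → cong (cls false true false)
            (≡ᵇ-false (λ eq → All.lookup (AllPairs.head u′) (∈-++⁺ˡ i) (sym eq)))))
        summand :
          P (v ∷ Z) (pieceCls v) ⊗
          (((chances unfed (map c (M′ ++ W)) ⊕ neg (chances sealed (map c (M′ ++ W))))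
             ⊗ chances sealed (map c (M′ ++ W)) ^ length Z)
           ⊗ P (M′ ++ W) c) ≡ G (length Z) (length M′)
        summand rewrite word′ = *-cong (P≡Q (Unique-++ˡ (v ∷ Z) u′) (↭-reflexive pieceWord))
          (*-congˡ (P≡Q (Unique-++ʳ (v ∷ Z) u′) (↭-reflexive word′)))

  -- Closed forms

  -- The probability that a pair carries no arc in one prescribed direction: no edge, or the
  -- opposite orientation.
  y : R
  y = q ⊕ x

  rate : Bool → Bool → R
  rate true  true  = q
  rate true  false = y
  rate false true  = y
  rate false false = 𝟙

  mean-rate : ∀ a b → mean (λ d → ⟦ not (isFwd d ∧ a) ∧ not (isBwd d ∧ b) ⟧) ≡ rate a b
  mean-rate a b = ≡.trans (mean-expand _) (value a b)
    where
    value : ∀ a b → q ⊗ 𝟙 ⊕ (x ⊗ ⟦ not a ∧ true ⟧ ⊕ x ⊗ ⟦ not b ⟧) ≡ rate a b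
    value true  true  = ≡.trans (+-cong (*-identityʳ q) (≡.trans (+-cong (zeroʳ x) (zeroʳ x)) (+-identityˡ 𝟘))) (+-identityʳ q)
    value true  false = +-cong (*-identityʳ q) (≡.trans (+-cong (zeroʳ x) (*-identityʳ x)) (+-identityˡ x))
    value false true  = +-cong (*-identityʳ q) (≡.trans (+-cong (*-identityʳ x) (zeroʳ x)) (+-identityʳ x))
    value false false = ≡.trans (+-cong (*-identityʳ q) (+-cong (*-identityʳ x) (*-identityʳ x))) total

  chance-sealed : ∀ k → chance sealed k ≡ rate (inA k) (inT k)
  chance-sealed k = mean-rate (inA k) (inT k)

  chance-unfed : ∀ k → chance unfed k ≡ rate false (inT k)
  chance-unfed k = ≡.trans
    (mean-cong λ d → cong (λ b → ⟦ not b ∧ not (isBwd d ∧ inT k) ⟧) (sym (∧-zeroʳ (isFwd d)))) (mean-rate false (inT k))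

  chances-++ : ∀ g v w → chances g (v ++ w) ≡ chances g v ⊗ chances g w
  chances-++ g []      w = sym (*-identityˡ _)
  chances-++ g (k ∷ v) w = ≡.trans (*-congˡ (chances-++ g v w)) (sym (*-assoc _ _ _))

  chances-replicate : ∀ g n k {a} → chance g k ≡ a → chances g (replicate n k) ≡ a ^ n
  chances-replicate g zero    k h = refl
  chances-replicate g (suc n) k h = *-cong h (chances-replicate g n k h)

  ^-+ : ∀ a m n → a ^ (m ℕ.+ n) ≡ (a ^ m) ⊗ (a ^ n)
  ^-+ a zero    n = sym (*-identityˡ _)
  ^-+ a (suc m) n = ≡.trans (*-congˡ (^-+ a m n)) (sym (*-assoc _ _ _))

  𝟙^ : ∀ n → 𝟙 ^ n ≡ 𝟙
  𝟙^ zero    = refl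
  𝟙^ (suc n) = ≡.trans (*-identityˡ _) (𝟙^ n)

  ⊗-interchange : ∀ a b c d → (a ⊗ b) ⊗ (c ⊗ d) ≡ (a ⊗ c) ⊗ (b ⊗ d)
  ⊗-interchange a b c d = begin
    (a ⊗ b) ⊗ (c ⊗ d)  ≡⟨ *-assoc a b _ ⟩
    a ⊗ (b ⊗ (c ⊗ d))  ≡⟨ *-congˡ (⊗-swap b c d) ⟩
    a ⊗ (c ⊗ (b ⊗ d))  ≡⟨ *-assoc a c _ ⟨
    (a ⊗ c) ⊗ (b ⊗ d)  ∎

  ⊗-^ : ∀ a b n → (a ⊗ b) ^ n ≡ (a ^ n) ⊗ (b ^ n)
  ⊗-^ a b zero    = sym (*-identityˡ 𝟙)
  ⊗-^ a b (suc n) = ≡.trans (*-congˡ (⊗-^ a b n)) (⊗-interchange _ _ _ _)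

  ^-^ : ∀ a m n → (a ^ n) ^ m ≡ a ^ (m ℕ.* n)
  ^-^ a zero    n = refl
  ^-^ a (suc m) n = ≡.trans (*-congˡ (^-^ a m n)) (sym (^-+ a n (m ℕ.* n)))

  -- The canonical configurations with |A ∩ T| = 2 + i and with A ∩ T = ∅.
  meeting : ℕ → ℕ → ℕ → ℕ → List Cls
  meeting i k l r = sourceB ∷ sinkB ∷
    replicate i bothB ++ (replicate k plainT ++ (replicate l plainA ++ replicate r nowhere))

  disjoint : ℕ → ℕ → ℕ → List Cls
  disjoint k l r = sourceT ∷ sinkA ∷ replicate k plainT ++ (replicate l plainA ++ replicate r nowhere)

  blocks : ∀ g k l {a b} → chance g plainT ≡ a → chance g plainA ≡ b →
    chances g (replicate k plainT ++ (replicate l plainA ++ [])) ≡ (a ^ k) ⊗ (b ^ l)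
  blocks g k l ha hb = ≡.trans (chances-++ g (replicate k plainT) _) (*-cong (chances-replicate g k plainT ha)
    (≡.trans (cong (chances g) (++-identityʳ (replicate l plainA))) (chances-replicate g l plainA hb)))

  -- A vertex of `A ∩ T` forbids both arcs, hence `q`; a vertex of exactly one of the sets forbids
  -- one, hence `y`.
  sealed-meeting : ∀ i k l → chances sealed (meeting i k l 0) ≡ (q ^ (2 ℕ.+ i)) ⊗ (y ^ (k ℕ.+ l))
  sealed-meeting i k l = begin
    chance sealed sourceB ⊗ (chance sealed sinkB ⊗ chances sealed (replicate i bothB ++ rest))
      ≡⟨ *-cong (chance-sealed sourceB) (*-cong (chance-sealed sinkB) (chances-++ sealed (replicate i bothB) rest)) ⟩
    q ⊗ (q ⊗ (chances sealed (replicate i bothB) ⊗ chances sealed rest))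
      ≡⟨ *-congˡ (*-congˡ (*-cong (chances-replicate sealed i bothB (chance-sealed bothB))
           (blocks sealed k l (chance-sealed plainT) (chance-sealed plainA)))) ⟩
    q ⊗ (q ⊗ ((q ^ i) ⊗ ((y ^ k) ⊗ (y ^ l))))
      ≡⟨ *-congˡ (*-congˡ (*-congˡ (^-+ y k l))) ⟨
    q ⊗ (q ⊗ ((q ^ i) ⊗ (y ^ (k ℕ.+ l))))
      ≡⟨ ≡.trans (*-congˡ (sym (*-assoc _ _ _))) (sym (*-assoc _ _ _)) ⟩
    (q ^ (2 ℕ.+ i)) ⊗ (y ^ (k ℕ.+ l)) ∎
    where rest = replicate k plainT ++ (replicate l plainA ++ [])

  sealed-disjoint : ∀ k l → chances sealed (disjoint k l 0) ≡ y ^ (2 ℕ.+ (k ℕ.+ l))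
  sealed-disjoint k l = *-cong (chance-sealed sourceT) (*-cong (chance-sealed sinkA)
    (≡.trans (blocks sealed k l (chance-sealed plainT) (chance-sealed plainA)) (sym (^-+ y k l))))

  unfed-blocks : ∀ k l → chances unfed (replicate k plainT ++ (replicate l plainA ++ [])) ≡ y ^ k
  unfed-blocks k l = ≡.trans (blocks unfed k l (chance-unfed plainT) (chance-unfed plainA))
    (≡.trans (*-congˡ (𝟙^ l)) (*-identityʳ _))

  -- Only the vertices of `T` forbid an arc, so the exponent is τ.
  unfed-meeting : ∀ i k l → chances unfed (meeting i k l 0) ≡ y ^ (2 ℕ.+ (i ℕ.+ k))
  unfed-meeting i k l = *-cong (chance-unfed sourceB) (*-cong (chance-unfed sinkB)
    (≡.trans (chances-++ unfed (replicate i bothB) _)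
      (≡.trans (*-cong (chances-replicate unfed i bothB (chance-unfed bothB)) (unfed-blocks k l)) (sym (^-+ y i k)))))

  unfed-disjoint : ∀ k l → chances unfed (disjoint k l 0) ≡ y ^ suc k
  unfed-disjoint k l = *-cong (chance-unfed sourceT)
    (≡.trans (*-congʳ (chance-unfed sinkA)) (≡.trans (*-identityˡ _) (unfed-blocks k l)))

  ∏-↭ : ∀ {as bs} → as ↭ bs → ∏ as ≡ ∏ bs
  ∏-↭ refl         = refl
  ∏-↭ (prep a p)   = *-congˡ (∏-↭ p)
  ∏-↭ (swap a b p) = ≡.trans (⊗-swap a b _) (*-congˡ (*-congˡ (∏-↭ p)))
  ∏-↭ (trans p r)  = ≡.trans (∏-↭ p) (∏-↭ r)

  chances-↭ : ∀ g {v w} → v ↭ w → chances g v ≡ chances g w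
  chances-↭ g p = ∏-↭ (↭.map⁺ (chance g) p)

  -- Vertices outside `A ∪ T` put no restriction on one another, so each of them contributes the
  -- same factor.
  Q-isolate-many : ∀ r w → Q (replicate r nowhere ++ w) ≡ Q w ⊗ chances sealed w ^ r
  Q-isolate-many zero    w = sym (*-identityʳ _)
  Q-isolate-many (suc r) w = begin
    Q (nowhere ∷ replicate r nowhere ++ w)
      ≡⟨ Q-isolate (replicate r nowhere ++ w) ⟩
    Q (replicate r nowhere ++ w) ⊗ chances sealed (replicate r nowhere ++ w)
      ≡⟨ *-cong (Q-isolate-many r w) (free r) ⟩
    (Q w ⊗ chances sealed w ^ r) ⊗ chances sealed w
      ≡⟨ ≡.trans (*-assoc _ _ _) (*-congˡ (*-comm _ _)) ⟩
    Q w ⊗ (chances sealed w ⊗ chances sealed w ^ r) ∎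
    where
    free : ∀ r → chances sealed (replicate r nowhere ++ w) ≡ chances sealed w
    free zero    = refl
    free (suc r) = ≡.trans (*-congʳ (chance-sealed nowhere)) (≡.trans (*-identityˡ _) (free r))

  nowhere-last : ∀ p s t u r → p ++ (s ++ (t ++ (u ++ replicate r nowhere))) ↭ replicate r nowhere ++ (p ++ (s ++ (t ++ (u ++ []))))
  nowhere-last p s t u r = ↭-trans (↭-reflexive lhs) (↭-trans (↭.++-comm (p ++ (s ++ (t ++ u))) (replicate r nowhere))
    (↭-reflexive (cong (replicate r nowhere ++_) (cong (λ z → p ++ (s ++ (t ++ z))) (sym (++-identityʳ u))))))
    where
    lhs : p ++ (s ++ (t ++ (u ++ replicate r nowhere))) ≡ (p ++ (s ++ (t ++ u))) ++ replicate r nowhere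
    lhs = ≡.trans (cong (λ z → p ++ (s ++ z)) (sym (++-assoc t u _)))
      (≡.trans (cong (p ++_) (sym (++-assoc s (t ++ u) _))) (sym (++-assoc p (s ++ (t ++ u)) _)))

  meeting-isolated : ∀ i k l r → Q (meeting i k l r) ≡
    Q (meeting i k l 0) ⊗ ((q ^ (r ℕ.* (2 ℕ.+ i))) ⊗ (y ^ (r ℕ.* (k ℕ.+ l))))
  meeting-isolated i k l r = begin
    Q (meeting i k l r)
      ≡⟨ Q-↭ (nowhere-last (sourceB ∷ sinkB ∷ []) (replicate i bothB) (replicate k plainT) (replicate l plainA) r) ⟩
    Q (replicate r nowhere ++ meeting i k l 0)
      ≡⟨ Q-isolate-many r (meeting i k l 0) ⟩
    Q (meeting i k l 0) ⊗ chances sealed (meeting i k l 0) ^ r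
      ≡⟨ *-congˡ (≡.trans (cong (_^ r) (sealed-meeting i k l)) (≡.trans (⊗-^ _ _ r) (*-cong (^-^ q r _) (^-^ y r _)))) ⟩
    _ ∎

  disjoint-isolated : ∀ k l r → Q (disjoint k l r) ≡ Q (disjoint k l 0) ⊗ (y ^ (r ℕ.* (2 ℕ.+ (k ℕ.+ l))))
  disjoint-isolated k l r = begin
    Q (disjoint k l r)
      ≡⟨ Q-↭ (nowhere-last (sourceT ∷ sinkA ∷ []) [] (replicate k plainT) (replicate l plainA) r) ⟩
    Q (replicate r nowhere ++ disjoint k l 0)
      ≡⟨ Q-isolate-many r (disjoint k l 0) ⟩
    Q (disjoint k l 0) ⊗ chances sealed (disjoint k l 0) ^ r
      ≡⟨ *-congˡ (≡.trans (cong (_^ r) (sealed-disjoint k l)) (^-^ y r _)) ⟩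
    _ ∎

  transpose-blocks : ∀ k l r → map transpose (replicate k plainT ++ (replicate l plainA ++ replicate r nowhere)) ≡
    replicate k plainA ++ (replicate l plainT ++ replicate r nowhere)
  transpose-blocks k l r = ≡.trans (map-++ transpose (replicate k plainT) _) (cong₂ _++_ (map-replicate transpose k plainT)
    (≡.trans (map-++ transpose (replicate l plainA) _) (cong₂ _++_ (map-replicate transpose l plainA) (map-replicate transpose r nowhere))))

  meeting-symmetric : ∀ i k l r → Q (meeting i k l r) ≡ Q (meeting i l k r)
  meeting-symmetric i k l r = ≡.trans (sym (Q-transpose (meeting i k l r)))
    (Q-↭ (↭-trans (swap sinkB sourceB (↭-reflexive (≡.trans (map-++ transpose (replicate i bothB) _)
                   (cong₂ _++_ (map-replicate transpose i bothB) (transpose-blocks k l r)))))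
                 (prep sourceB (prep sinkB (↭.++⁺ˡ (replicate i bothB) (↭.shifts (replicate k plainA) (replicate l plainT)))))))

  disjoint-symmetric : ∀ k l r → Q (disjoint k l r) ≡ Q (disjoint l k r)
  disjoint-symmetric k l r = ≡.trans (sym (Q-transpose (disjoint k l r)))
    (Q-↭ (↭-trans (swap sinkA sourceT (↭-reflexive (transpose-blocks k l r)))
                 (prep sourceT (prep sinkA (↭.shifts (replicate k plainA) (replicate l plainT))))))

  -- Reversal identifies the in-cluster of a removed piece with the out-cluster in the definition of
  -- d_p.
  cluster-symmetric : ∀ z → Q (sourceT ∷ replicate z plainT) ≡ Q (sinkA ∷ replicate z plainA)
  cluster-symmetric z = ≡.trans (sym (Q-transpose (sourceT ∷ replicate z plainT)))
    (cong (λ w → Q (sinkA ∷ w)) (map-replicate transpose z plainT))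

  A-last : ∀ l p s t → replicate l plainA ++ (p ++ (s ++ t)) ↭ p ++ (s ++ (t ++ (replicate l plainA ++ [])))
  A-last l p s t = ↭-trans (↭.++-comm (replicate l plainA) (p ++ (s ++ t)))
    (↭-reflexive (≡.trans (++-assoc p (s ++ t) _) (cong (p ++_) (≡.trans (++-assoc s t _)
      (cong (λ z → s ++ (t ++ z)) (sym (++-identityʳ _)))))))

  peel-summand : ∀ {w v} → w ↭ v → ∀ {a b k} → chances unfed v ≡ a → chances sealed v ≡ b → ∀ {d} z → b ^ z ≡ k →
    d ⊗ (((chances unfed w ⊕ neg (chances sealed w)) ⊗ chances sealed w ^ z) ⊗ Q w) ≡
    d ⊗ (((a ⊕ neg b) ⊗ k) ⊗ Q v)
  peel-summand p refl refl z refl rewrite chances-↭ unfed p | chances-↭ sealed p | Q-↭ p = refl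

  meeting-peel : ∀ i k m → Q (meeting i k (suc m) 0) ≡ Bin m λ z l →
    Q (sinkA ∷ replicate z plainA) ⊗
    (((y ^ (2 ℕ.+ (i ℕ.+ k)) ⊕ neg ((q ^ (2 ℕ.+ i)) ⊗ (y ^ (k ℕ.+ l))))
       ⊗ ((q ^ (z ℕ.* (2 ℕ.+ i))) ⊗ (y ^ (z ℕ.* (k ℕ.+ l)))))
     ⊗ Q (meeting i k l 0))
  meeting-peel i k m = begin
    Q (meeting i k (suc m) 0)
      ≡⟨ Q-↭ (↭-sym (A-last (suc m) (sourceB ∷ sinkB ∷ []) (replicate i bothB) (replicate k plainT))) ⟩
    Q (plainA ∷ replicate m plainA ++ core)
      ≡⟨ Q-peel m core allCore ⟩
    _
      ≡⟨ Bin-cong m (λ z l _ → peel-summand (A-last l (sourceB ∷ sinkB ∷ []) (replicate i bothB) (replicate k plainT))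
           (unfed-meeting i k l) (sealed-meeting i k l) z
           (≡.trans (⊗-^ _ _ z) (*-cong (^-^ q z _) (^-^ y z _)))) ⟩
    _ ∎
    where
    core = sourceB ∷ sinkB ∷ replicate i bothB ++ replicate k plainT
    allCore : All Core core
    allCore = inj₁ refl ∷ inj₁ refl ∷ All.tabulate λ j → [ (λ l → inj₁ (cong inT (∈-replicate i l))) , (λ l → inj₁ (cong inT (∈-replicate k l))) ]′ (∈-++⁻ (replicate i bothB) j)

  disjoint-peel : ∀ k m → Q (disjoint k (suc m) 0) ≡ Bin m λ z l →
    Q (sinkA ∷ replicate z plainA) ⊗
    (((y ^ suc k ⊕ neg (y ^ (2 ℕ.+ (k ℕ.+ l)))) ⊗ (y ^ (z ℕ.* (2 ℕ.+ (k ℕ.+ l)))))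
     ⊗ Q (disjoint k l 0))
  disjoint-peel k m = begin
    Q (disjoint k (suc m) 0)
      ≡⟨ Q-↭ (↭-sym (A-last (suc m) (sourceT ∷ sinkA ∷ []) [] (replicate k plainT))) ⟩
    Q (plainA ∷ replicate m plainA ++ core)
      ≡⟨ Q-peel m core allCore ⟩
    _
      ≡⟨ Bin-cong m (λ z l _ → peel-summand (A-last l (sourceT ∷ sinkA ∷ []) [] (replicate k plainT))
           (unfed-disjoint k l) (sealed-disjoint k l) z (^-^ y z _)) ⟩
    _ ∎
    where
    core = sourceT ∷ sinkA ∷ replicate k plainT
    allCore : All Core core
    -- Here `a` lies outside `T`; it belongs to the core by its mark.
    allCore = inj₁ refl ∷ inj₂ refl ∷ All.tabulate λ j → inj₁ (cong inT (∈-replicate k j))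

  ΣW-blocks : ∀ m (F : List Cls → R) → (∀ {w w′} → w ↭ w′ → F w ≡ F w′) →
    ΣW (plainT ∷ plainA ∷ nowhere ∷ []) m F ≡
    Bin m λ k m′ → Bin m′ λ l r → F (replicate k plainT ++ (replicate l plainA ++ replicate r nowhere))
  ΣW-blocks m F h = ≡.trans (ΣW-letter plainT _ m F h) (Bin-cong m λ k m′ _ →
    ≡.trans (ΣW-letter plainA _ m′ _ (h ∘ ↭.++⁺ˡ (replicate k plainT))) (Bin-cong m′ λ l r _ →
      ΣW-single nowhere r (λ w → F (replicate k plainT ++ (replicate l plainA ++ w)))))

  total-canonical :
    ∀ m → Bin m (λ i m₁ → Bin m₁ λ k m₂ → Bin m₂ λ l r → Q (meeting i k l r)) ⊕
          Bin m (λ k m₂ → Bin m₂ λ l r → Q (disjoint k l r)) ≡ 𝟙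
  total-canonical m = begin
    Bin m (λ i m₁ → Bin m₁ λ k m₂ → Bin m₂ λ l r → Q (meeting i k l r)) ⊕
    Bin m (λ k m₂ → Bin m₂ λ l r → Q (disjoint k l r))
      ≡⟨ +-cong both apart ⟨
    ΣW letters m (λ w → Q (sourceB ∷ sinkB ∷ w)) ⊕ ΣW letters m (λ w → Q (sourceT ∷ sinkA ∷ w))
      ≡⟨ Q-total m ⟩
    𝟙 ∎
    where
    both : ΣW letters m (λ w → Q (sourceB ∷ sinkB ∷ w)) ≡
      Bin m (λ i m₁ → Bin m₁ λ k m₂ → Bin m₂ λ l r → Q (meeting i k l r))
    both = ≡.trans (ΣW-letter bothB _ m _ (λ p → Q-↭ (prep _ (prep _ p)))) (Bin-cong m λ i m₁ _ →
      ΣW-blocks m₁ (λ w → Q (sourceB ∷ sinkB ∷ replicate i bothB ++ w))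
        (λ p → Q-↭ (prep _ (prep _ (↭.++⁺ˡ (replicate i bothB) p)))))
    -- Since `a` lies outside `T`, no vertex can lie in `A ∩ T`; only the words without `bothB`
    -- survive.
    avoidB : ∀ i l → ΣW (plainT ∷ plainA ∷ nowhere ∷ []) l (λ w → Q (sourceT ∷ sinkA ∷ bothB ∷ replicate i bothB ++ w)) ≡ 𝟘
    avoidB i l = ≡.trans (ΣW-cong _ l (λ w a _ → Q-impossible _ (sinks w a) (there (there (here refl))))) (ΣW-zero _ l)
      where
      letter : ∀ {k} → k ∈ plainT ∷ plainA ∷ nowhere ∷ [] → isK k ≡ false
      letter (here refl)                 = refl
      letter (there (here refl))         = refl
      letter (there (there (here refl))) = refl
      sinks : ∀ w → All (_∈ plainT ∷ plainA ∷ nowhere ∷ []) w →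
        ∀ {k} → k ∈ sourceT ∷ sinkA ∷ bothB ∷ replicate i bothB ++ w → isK k ≡ true → inT k ≡ false
      sinks w a (here refl) ()
      sinks w a (there (here refl)) h = refl
      sinks w a (there (there j)) h with ∈-++⁻ (replicate (suc i) bothB) j
      ... | inj₁ j′ = ⊥-elim (true≢false h (cong isK (∈-replicate (suc i) j′)))
      ... | inj₂ j′ = ⊥-elim (true≢false h (letter (All.lookup a j′)))
    apart : ΣW letters m (λ w → Q (sourceT ∷ sinkA ∷ w)) ≡ Bin m (λ k m₂ → Bin m₂ λ l r → Q (disjoint k l r))
    apart = ≡.trans (ΣW-letter bothB _ m _ (λ p → Q-↭ (prep _ (prep _ p)))) (≡.trans
      (Bin-first m (λ i l → ΣW (plainT ∷ plainA ∷ nowhere ∷ []) l (λ w → Q (sourceT ∷ sinkA ∷ replicate i bothB ++ w))) avoidB)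
      (ΣW-blocks m (λ w → Q (sourceT ∷ sinkA ∷ w)) (λ p → Q-↭ (prep _ (prep _ p)))))

  -- Total probability as nested binomial sums

  Σ<-bin : ℕ → (ℕ → ℕ → R) → R
  Σ<-bin m G = Σ< (suc m) (λ k → bin m k ⊗ G k (m ∸ k))

  -- The index `i = m` puts every vertex in `A ∩ T`. Its single word is the quantity to be solved
  -- for, so it is detached from the sum.
  total-binomial : ∀ m →
    (Σ< m (λ i → bin m i ⊗ Σ<-bin (m ∸ i) λ k m₂ → Σ<-bin m₂ λ l r → Q (meeting i k l r))
      ⊕ Q (meeting m 0 0 0)) ⊕ Σ<-bin m (λ k m₂ → Σ<-bin m₂ λ l r → Q (disjoint k l r)) ≡ 𝟙
  total-binomial m = begin
    (Σ< m F ⊕ Q (meeting m 0 0 0)) ⊕ Σ<-bin m (λ k m₂ → Σ<-bin m₂ λ l r → Q (disjoint k l r))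
      ≡⟨ +-cong (+-congˡ top) refl ⟨
    (Σ< m F ⊕ F m) ⊕ Σ<-bin m (λ k m₂ → Σ<-bin m₂ λ l r → Q (disjoint k l r))
      ≡⟨ +-congʳ (Σ<-last m F) ⟨
    Σ<-bin m (λ i m₁ → Σ<-bin m₁ λ k m₂ → Σ<-bin m₂ λ l r → Q (meeting i k l r)) ⊕
    Σ<-bin m (λ k m₂ → Σ<-bin m₂ λ l r → Q (disjoint k l r))
      ≡⟨ +-cong (to m λ i m₁ → to m₁ λ k m₂ → Bin≡Σ m₂ _) (to m λ k m₂ → Bin≡Σ m₂ _) ⟨
    Bin m (λ i m₁ → Bin m₁ λ k m₂ → Bin m₂ λ l r → Q (meeting i k l r)) ⊕
    Bin m (λ k m₂ → Bin m₂ λ l r → Q (disjoint k l r))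
      ≡⟨ total-canonical m ⟩
    𝟙 ∎
    where
    F : ℕ → R
    F i = bin m i ⊗ Σ<-bin (m ∸ i) λ k m₂ → Σ<-bin m₂ λ l r → Q (meeting i k l r)
    to : ∀ m {G H : ℕ → ℕ → R} → (∀ k l → G k l ≡ H k l) → Bin m G ≡ Σ<-bin m H
    to m {H = H} h = ≡.trans (Bin-cong m (λ k l _ → h k l)) (Bin≡Σ m H)
    trivial : ∀ (G : ℕ → ℕ → R) → Σ<-bin 0 G ≡ G 0 0
    trivial G = sym (Bin≡Σ 0 G)
    top : F m ≡ Q (meeting m 0 0 0)
    top rewrite nCn≡1 m | ℕ.n∸n≡0 m = ≡.trans (*-congʳ (+-identityʳ 𝟙)) (≡.trans (*-identityˡ _)
      (≡.trans (trivial (λ k m₂ → Σ<-bin m₂ λ l r → Q (meeting m k l r))) (trivial (λ l r → Q (meeting m 0 l r)))))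

  -- Rearranging the factors of a summand

  gather : ∀ b N D E Y → ((b ⊗ N) ⊗ D) ⊗ (Y ⊗ E) ≡ b ⊗ (D ⊗ ((E ⊗ Y) ⊗ N))
  gather b N D E Y = begin
    ((b ⊗ N) ⊗ D) ⊗ (Y ⊗ E)   ≡⟨ ≡.trans (*-assoc _ _ _) (*-assoc _ _ _) ⟩
    b ⊗ (N ⊗ (D ⊗ (Y ⊗ E)))   ≡⟨ *-congˡ (⊗-swap N D _) ⟩
    b ⊗ (D ⊗ (N ⊗ (Y ⊗ E)))   ≡⟨ *-congˡ (*-congˡ (≡.trans (*-comm _ _) (*-congʳ (*-comm _ _)))) ⟩
    b ⊗ (D ⊗ ((E ⊗ Y) ⊗ N))   ∎

  gather-meeting : ∀ b N D a c E → ((((b ⊗ N) ⊗ D) ⊗ a) ⊗ c) ⊗ E ≡ b ⊗ (D ⊗ ((E ⊗ (a ⊗ c)) ⊗ N))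
  gather-meeting b N D a c E =
    ≡.trans (≡.trans (*-congʳ (*-assoc _ _ _)) (*-assoc _ _ _)) (gather b N D E (a ⊗ c))

  gather-disjoint : ∀ b N D a t u {E} → t ⊗ u ≡ E → ((((b ⊗ N) ⊗ D) ⊗ a) ⊗ t) ⊗ u ≡ b ⊗ (D ⊗ ((E ⊗ a) ⊗ N))
  gather-disjoint b N D a t u refl =
    ≡.trans (≡.trans (*-assoc _ _ _) (*-assoc _ _ _)) (gather b N D (t ⊗ u) a)

  ⊗-neg : ∀ a b → a ⊗ neg b ≡ neg (a ⊗ b)
  ⊗-neg a b = ≡.trans (⊖-unique (≡.trans (sym (distribˡ a (neg b) b))
    (≡.trans (*-congˡ (≡.trans (+-comm _ _) (-‿inverseʳ b))) (zeroʳ a)))) (+-identityˡ _)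

  -- For `a = y`, `suc k` is τ and `suc l` is α - ζ: the factored form for disjoint clusters is the
  -- difference that peeling produces.
  ^-difference : ∀ a k l → (a ^ suc k) ⊗ (𝟙 ⊕ neg (a ^ suc l)) ≡ (a ^ suc k) ⊕ neg (a ^ (2 ℕ.+ (k ℕ.+ l)))
  ^-difference a k l = begin
    (a ^ suc k) ⊗ (𝟙 ⊕ neg (a ^ suc l))
      ≡⟨ ≡.trans (distribˡ _ _ _) (+-cong (*-identityʳ _) (⊗-neg _ _)) ⟩
    (a ^ suc k) ⊕ neg ((a ^ suc k) ⊗ (a ^ suc l))
      ≡⟨ cong (λ b → (a ^ suc k) ⊕ neg b) (≡.trans (sym (^-+ a (suc k) (suc l))) (cong (λ s → a ^ suc s) (ℕ.+-suc k l))) ⟩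
    (a ^ suc k) ⊕ neg (a ^ (2 ℕ.+ (k ℕ.+ l))) ∎

  last-summand : ∀ {a b d} → (a ⊕ b) ⊕ d ≡ 𝟙 → b ≡ (𝟙 ⊕ neg a) ⊕ neg d
  last-summand {a} {b} {d} h = ⊖-unique (⊖-unique (≡.trans (+-comm (b ⊕ d) a) (≡.trans (sym (+-assoc a b d)) h)))

-- Canonical vertex classes

≤ᵇ-true : ∀ {m n} → m ≤ n → (m ≤ᵇ n) ≡ true
≤ᵇ-true {m} {n} h with m ≤ᵇ n in eq
... | true  = refl
... | false = ⊥-elim (subst T eq (ℕ.≤⇒≤ᵇ h))

≤ᵇ-false : ∀ {m n} → n < m → (m ≤ᵇ n) ≡ false
≤ᵇ-false {m} {n} h with m ≤ᵇ n in eq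
... | false = refl
... | true  = ⊥-elim (ℕ.<⇒≱ h (ℕ.≤ᵇ⇒≤ m n (subst T (sym eq) tt)))

<ᵇ-true : ∀ {m n} → m < n → (m <ᵇ n) ≡ true
<ᵇ-true {m} {suc n} (s≤s h) = ≤ᵇ-true′ m h
  where
  ≤ᵇ-true′ : ∀ m {n} → m ≤ n → (m <ᵇ suc n) ≡ true
  ≤ᵇ-true′ zero    h       = refl
  ≤ᵇ-true′ (suc m) (s≤s h) = ≤ᵇ-true′ m h

<ᵇ-false : ∀ {m n} → n ≤ m → (m <ᵇ n) ≡ false
<ᵇ-false z≤n     = refl
<ᵇ-false (s≤s h) = <ᵇ-false h

∧-falseˡ : ∀ {a b} → a ≡ false → a ∧ b ≡ false
∧-falseˡ refl = refl

-- Repeats the tests of `TOf` and `AOf` with `j`, `t` and `a` as parameters, so that their computed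
-- values can be substituted.
config : ℕ → ℕ → ℕ → ℕ → ℕ → ℕ → Cls
config τ α j t a u =
  cls (u <ᵇ τ) ((u <ᵇ j) ∨ ((τ ≤ᵇ u) ∧ (u <ᵇ (τ +ℕ α) ∸ j))) (u ≡ᵇ t) (u ≡ᵇ a)

applyUpTo-+ : ∀ {X : Set} (f : ℕ → X) m n → applyUpTo f (m +ℕ n) ≡ applyUpTo f m ++ applyUpTo (λ u → f (m +ℕ u)) n
applyUpTo-+ f zero    n = refl
applyUpTo-+ f (suc m) n = cong (f 0 ∷_) (applyUpTo-+ (f ∘ suc) m n)

applyUpTo-const : ∀ {X : Set} (f : ℕ → X) n {y} → (∀ u → u < n → f u ≡ y) → applyUpTo f n ≡ replicate n y
applyUpTo-const f zero    h = refl
applyUpTo-const f (suc n) h = cong₂ _∷_ (h 0 (s≤s z≤n)) (applyUpTo-const (f ∘ suc) n (λ u l → h (suc u) (s≤s l)))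

cls-cong : ∀ {a a′ b b′ c c′ d d′} → a ≡ a′ → b ≡ b′ → c ≡ c′ → d ≡ d′ → cls a b c d ≡ cls a′ b′ c′ d′
cls-cong refl refl refl refl = refl

meeting-config : ∀ i k l r → map (config (2 +ℕ (i +ℕ k)) (2 +ℕ (i +ℕ l)) (2 +ℕ i) 0 1) (upTo (2 +ℕ (i +ℕ (k +ℕ (l +ℕ r))))) ≡
  sourceB ∷ sinkB ∷ replicate i bothB ++ (replicate k plainT ++ (replicate l plainA ++ replicate r nowhere))
meeting-config i k l r = ≡.trans (map-upTo c (2 +ℕ (i +ℕ (k +ℕ (l +ℕ r))))) (cong₂ _∷_ refl (cong₂ _∷_ refl
  (≡.trans (applyUpTo-+ f i _) (cong₂ _++_ (applyUpTo-const f i block₁)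
  (≡.trans (applyUpTo-+ (λ u → f (i +ℕ u)) k _) (cong₂ _++_ (applyUpTo-const _ k block₂)
  (≡.trans (applyUpTo-+ (λ u → f (i +ℕ (k +ℕ u))) l _) (cong₂ _++_ (applyUpTo-const _ l block₃) (applyUpTo-const _ r block₄)))))))))
  where
  c f : ℕ → Cls
  c = config (2 +ℕ (i +ℕ k)) (2 +ℕ (i +ℕ l)) (2 +ℕ i) 0 1
  f u = c (2 +ℕ u)
  end : (2 +ℕ (i +ℕ k)) +ℕ (2 +ℕ (i +ℕ l)) ∸ (2 +ℕ i) ≡ 2 +ℕ (i +ℕ (k +ℕ l))
  end = ≡.trans (cong (_∸ (2 +ℕ i)) (lem i k l)) (ℕ.m+n∸m≡n (2 +ℕ i) _)
    where
    lem : ∀ i k l → (2 +ℕ (i +ℕ k)) +ℕ (2 +ℕ (i +ℕ l)) ≡ (2 +ℕ i) +ℕ (2 +ℕ (i +ℕ (k +ℕ l)))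
    lem = solve-∀
  block₁ : ∀ u → u < i → f u ≡ bothB
  block₁ u h = cls-cong (<ᵇ-true (ℕ.<-≤-trans h (ℕ.m≤m+n i k))) (∨-true⁺ˡ (<ᵇ-true h)) refl refl
  block₂ : ∀ u → u < k → f (i +ℕ u) ≡ plainT
  block₂ u h = cls-cong (<ᵇ-true (ℕ.+-monoʳ-< i h))
    (cong₂ _∨_ (<ᵇ-false (ℕ.m≤m+n i u)) (∧-falseˡ (≤ᵇ-false (s≤s (s≤s (ℕ.+-monoʳ-< i h)))))) refl refl
  block₃ : ∀ u → u < l → f (i +ℕ (k +ℕ u)) ≡ plainA
  block₃ u h = cls-cong (<ᵇ-false (ℕ.+-monoʳ-≤ i (ℕ.m≤m+n k u)))
    (cong₂ _∨_ (<ᵇ-false (ℕ.m≤m+n i _)) (cong₂ _∧_ (≤ᵇ-true (s≤s (s≤s (ℕ.+-monoʳ-≤ i (ℕ.m≤m+n k u)))))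
      (≡.trans (cong (2 +ℕ (i +ℕ (k +ℕ u)) <ᵇ_) end) (<ᵇ-true (ℕ.+-monoʳ-< i (ℕ.+-monoʳ-< k h)))))) refl refl
  block₄ : ∀ u → u < r → f (i +ℕ (k +ℕ (l +ℕ u))) ≡ nowhere
  block₄ u h = cls-cong (<ᵇ-false (ℕ.+-monoʳ-≤ i (ℕ.m≤m+n k _)))
    (cong₂ _∨_ (<ᵇ-false (ℕ.m≤m+n i _)) (≡.trans (cong ((2 +ℕ (i +ℕ k) ≤ᵇ 2 +ℕ (i +ℕ (k +ℕ (l +ℕ u)))) ∧_)
      (≡.trans (cong (2 +ℕ (i +ℕ (k +ℕ (l +ℕ u))) <ᵇ_) end) (<ᵇ-false (ℕ.+-monoʳ-≤ i (ℕ.+-monoʳ-≤ k (ℕ.m≤m+n l u))))))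
      (∧-zeroʳ _))) refl refl

disjoint-config : ∀ k l r → map (config (suc k) (suc l) 0 0 (suc k)) (upTo (suc k +ℕ (suc l +ℕ r))) ≡
  (sourceT ∷ replicate k plainT) ++ (sinkA ∷ replicate l plainA) ++ replicate r nowhere
disjoint-config k l r = ≡.trans (map-upTo c (suc k +ℕ (suc l +ℕ r)))
  (≡.trans (applyUpTo-+ c (suc k) _) (cong₂ _++_
    (cong₂ _∷_ refl (applyUpTo-const (c ∘ suc) k block₁))
    (≡.trans (applyUpTo-+ d (suc l) r) (cong₂ _++_ (cong₂ _∷_ sink (applyUpTo-const (d ∘ suc) l block₂))
      (applyUpTo-const _ r block₃)))))
  where
  c d : ℕ → Cls
  c = config (suc k) (suc l) 0 0 (suc k)
  d u = c (suc k +ℕ u)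
  block₁ : ∀ u → u < k → c (suc u) ≡ plainT
  block₁ u h = cls-cong (<ᵇ-true h) (∧-falseˡ (≤ᵇ-false (s≤s h))) refl (≡ᵇ-false (ℕ.<⇒≢ h))
  beyond : ∀ u → inT (d u) ≡ false
  beyond u = <ᵇ-false (ℕ.m≤m+n k u)
  inside : ∀ u → u < suc l → inA (d u) ≡ true
  inside u h = cong₂ _∧_ (≤ᵇ-true (ℕ.m≤m+n (suc k) u)) (<ᵇ-true (ℕ.+-monoʳ-< k h))
  sink : d 0 ≡ sinkA
  sink = cls-cong (beyond 0) (inside 0 (s≤s z≤n)) refl (≡.trans (cong (_≡ᵇ k) (ℕ.+-identityʳ k)) (≡ᵇ-refl k))
  later : ∀ u → (k +ℕ suc u ≡ᵇ k) ≡ false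
  later u = ≡ᵇ-false (λ eq → ℕ.m≢1+m+n k (≡.trans (sym eq) (ℕ.+-suc k u)))
  block₂ : ∀ u → u < l → d (suc u) ≡ plainA
  block₂ u h = cls-cong (beyond (suc u)) (inside (suc u) (s≤s h)) refl (later u)
  block₃ : ∀ u → u < r → d (suc l +ℕ u) ≡ nowhere
  block₃ u h = cls-cong (beyond (suc l +ℕ u)) (≡.trans (cong ((suc k ≤ᵇ suc k +ℕ (suc l +ℕ u)) ∧_)
    (<ᵇ-false (ℕ.+-monoʳ-≤ k (ℕ.m≤m+n (suc l) u)))) (∧-zeroʳ _)) refl (later (l +ℕ u))

-- With `A` empty and no vertex marked as `a`, the in-cluster half of the event holds trivially.
dP-config : ℕ → ℕ → Cls
dP-config k u = cls (u <ᵇ k) false (u ≡ᵇ 0) false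

dP-config-word : ∀ z → map (dP-config (suc z)) (upTo (suc z)) ≡ sourceT ∷ replicate z plainT
dP-config-word z = ≡.trans (map-upTo (dP-config (suc z)) (suc z))
  (cong (_ ∷_) (applyUpTo-const _ z (λ u h → cls-cong (<ᵇ-true h) refl refl refl)))

reachWithin≡within : ∀ e n k v u → reachWithin e n k v u ≡ within e (upTo n) (_≡ᵇ v) k u
reachWithin≡within e n zero    v u = refl
reachWithin≡within e n (suc k) v u = cong₂ _∨_ (reachWithin≡within e n k v u)
  (cong or (map-cong (λ w → cong (_∧ e w u) (reachWithin≡within e n k v w)) (upTo n)))

sameSet≡isCluster : ∀ e n v T → sameSet n (reachWithin e n n v) T ≡ isCluster e (upTo n) (_≡ᵇ v) T
sameSet≡isCluster e n v T = cong and (map-cong (λ u → cong (λ b → eqBool b (T u))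
  (≡.trans (reachWithin≡within e n n v u) (cong (λ k → within e (upTo n) (_≡ᵇ v) k u) (sym (length-upTo n))))) (upTo n))

-- The probability space over ℚ

xOf+yOf : ∀ p → qOf p + (xOf p + xOf p) ≡ 1ℚ
xOf+yOf p = begin
  (1ℚ - p) + (p * ½ + p * ½)  ≡⟨ cong ((1ℚ - p) +_) (ℚ.*-distribˡ-+ p ½ ½) ⟨
  (1ℚ - p) + p * (½ + ½)      ≡⟨ cong ((1ℚ - p) +_) (ℚ.*-identityʳ p) ⟩
  (1ℚ - p) + p                ≡⟨ ℚ.+-assoc 1ℚ (- p) p ⟩
  1ℚ + (- p + p)              ≡⟨ cong (1ℚ +_) (ℚ.+-inverseˡ p) ⟩
  1ℚ                          ∎
  where open ≡-Reasoning

qOf+xOf : ∀ p → qOf p + xOf p ≡ yOf p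
qOf+xOf p = begin
  qOf p + xOf p                                  ≡⟨ ℚ.+-identityʳ _ ⟨
  (qOf p + xOf p) + 0ℚ                           ≡⟨ cong ((qOf p + xOf p) +_) (ℚ.+-inverseʳ (xOf p)) ⟨
  (qOf p + xOf p) + (xOf p - xOf p)              ≡⟨ ℚ.+-assoc (qOf p + xOf p) (xOf p) (- xOf p) ⟨
  ((qOf p + xOf p) + xOf p) - xOf p              ≡⟨ cong (_- xOf p) (ℚ.+-assoc (qOf p) (xOf p) (xOf p)) ⟩
  (qOf p + (xOf p + xOf p)) - xOf p              ≡⟨ cong (_- xOf p) (xOf+yOf p) ⟩
  yOf p                                          ∎
  where open ≡-Reasoning

-- Both sides are fractions in lowest terms; without normalisation the equation is one of integers.
ℕ→ℚ-suc : ∀ n → ℕ→ℚ (suc n) ≡ 1ℚ + ℕ→ℚ n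
ℕ→ℚ-suc n = ℚ.toℚᵘ-injective (begin-equality
  toℚᵘ (fromℚᵘ (mkℚᵘ (ℤ.+ suc n) 0))          ≃⟨ ℚ.toℚᵘ-fromℚᵘ (mkℚᵘ (ℤ.+ suc n) 0) ⟩
  mkℚᵘ (ℤ.+ suc n) 0                          ≃⟨ *≡* (cong (ℤ._* ℤ.+ 1) lem) ⟩
  toℚᵘ 1ℚ ℚᵘ.+ mkℚᵘ (ℤ.+ n) 0                 ≃⟨ ℚᵘ.+-congʳ (toℚᵘ 1ℚ) (ℚ.toℚᵘ-fromℚᵘ (mkℚᵘ (ℤ.+ n) 0)) ⟨
  toℚᵘ 1ℚ ℚᵘ.+ toℚᵘ (ℕ→ℚ n)                   ≃⟨ ℚ.toℚᵘ-homo-+ 1ℚ (ℕ→ℚ n) ⟨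
  toℚᵘ (1ℚ + ℕ→ℚ n)                           ∎)
  where
  open ℚᵘ.≤-Reasoning
  lem : ℤ.+ suc n ≡ ℤ.+ 1 ℤ.* ℤ.+ 1 ℤ.+ ℤ.+ n ℤ.* ℤ.+ 1
  lem rewrite ℤ.*-identityʳ (ℤ.+ n) = refl

-- Parameters expressed by block sizes

core-size : ∀ j k l r → (j +ℕ (k +ℕ (l +ℕ r))) ∸ r ≡ j +ℕ (k +ℕ l)
core-size j k l r = ≡.trans (cong (_∸ r) (lem j k l r)) (ℕ.m+n∸n≡m _ r)
  where
  lem : ∀ j k l r → j +ℕ (k +ℕ (l +ℕ r)) ≡ (j +ℕ (k +ℕ l)) +ℕ r
  lem = solve-∀

jOf-canonical : ∀ j k l r → jOf (j +ℕ (k +ℕ (l +ℕ r))) (j +ℕ k) (j +ℕ l) r ≡ j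
jOf-canonical j k l r = ≡.trans (cong₂ _∸_ (lem j k l) (core-size j k l r)) (ℕ.m+n∸n≡m j (j +ℕ (k +ℕ l)))
  where
  lem : ∀ j k l → (j +ℕ k) +ℕ (j +ℕ l) ≡ j +ℕ (j +ℕ (k +ℕ l))
  lem = solve-∀

tOf-jOf : ∀ n τ α r {j} → jOf n τ α r ≡ j → tOf n τ α r ≡ (if (j ≡ᵇ 1) ∧ (α ≡ᵇ 1) then 1 else 0)
tOf-jOf n τ α r refl = refl

aOf-jOf : ∀ n τ α r {j} → jOf n τ α r ≡ j →
  aOf n τ α r ≡ (if 2 ≤ᵇ j then 1 else if (j ≡ᵇ 1) ∧ (α ≡ᵇ 1) then 0 else τ)
aOf-jOf n τ α r refl = refl

validN-canonical : ∀ j k l r → (j ≡ᵇ 1) ≡ false → 1 ≤ j +ℕ k → 1 ≤ j +ℕ l → 2 ≤ j +ℕ (k +ℕ l) →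
  validN (j +ℕ (k +ℕ (l +ℕ r))) (j +ℕ k) (j +ℕ l) r ≡ true
validN-canonical j k l r h a b c = ∧-true⁺ (≤ᵇ-true (ℕ.≤-trans c core≤n)) (∧-true⁺ (≤ᵇ-true a) (∧-true⁺ (≤ᵇ-true b)
  (∧-true⁺ (<ᵇ-true r<n)
  (∧-true⁺ (bounded _ (ℕ.+-monoʳ-≤ j (ℕ.m≤m+n k l))) (∧-true⁺ (bounded _ (ℕ.+-monoʳ-≤ j (ℕ.m≤n+m l k)))
  (∧-true⁺ (≤ᵇ-true (subst (_≤ (j +ℕ k) +ℕ (j +ℕ l)) (sym (core-size j k l r)) union))
    (cong not (∧-falseˡ (≡.trans (cong (_≡ᵇ 1) (jOf-canonical j k l r)) h)))))))))
  where
  n = j +ℕ (k +ℕ (l +ℕ r))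
  bounded : ∀ s → s ≤ j +ℕ (k +ℕ l) → (s ≤ᵇ (n ∸ r)) ≡ true
  bounded s h = ≤ᵇ-true (subst (s ≤_) (sym (core-size j k l r)) h)
  core≤n : j +ℕ (k +ℕ l) ≤ n
  core≤n = subst (_≤ n) (core-size j k l r) (ℕ.m∸n≤m n r)
  r<n : r < n
  r<n = subst (r <_) (lem j k l r) (ℕ.≤-trans (s≤s (ℕ.m≤n+m r _)) (ℕ.+-monoˡ-≤ r c))
    where
    lem : ∀ j k l r → (j +ℕ (k +ℕ l)) +ℕ r ≡ j +ℕ (k +ℕ (l +ℕ r))
    lem = solve-∀
  union : j +ℕ (k +ℕ l) ≤ (j +ℕ k) +ℕ (j +ℕ l)
  union = subst (_≤ (j +ℕ k) +ℕ (j +ℕ l)) (ℕ.+-assoc j k l) (ℕ.+-monoʳ-≤ (j +ℕ k) (ℕ.m≤n+m l j))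

∸-solve : ∀ a b c → a ≡ b +ℕ c → a ∸ b ≡ c
∸-solve _ b c refl = ℕ.m+n∸m≡n b c

-- The sizes of `A ∩ T`, `T ∖ A` and `A ∖ T`. In these terms every truncated subtraction of the
-- theorem cancels exactly.
record Parameters (n τ α r : ℕ) : Set where
  constructor parameters
  field
    j k l : ℕ
    n≡ : n ≡ j +ℕ (k +ℕ (l +ℕ r))
    τ≡ : τ ≡ j +ℕ k
    α≡ : α ≡ j +ℕ l

findParameters : ∀ n τ α r → 1 ≤ τ → τ ≤ n ∸ r → α ≤ n ∸ r → n ∸ r ≤ τ +ℕ α → Parameters n τ α r
findParameters n τ α r 1≤τ τ≤N α≤N N≤ = parameters j k l n≡ τ≡ α≡
  where
  open ≡-Reasoning
  N = n ∸ r
  j = (τ +ℕ α) ∸ N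
  k = N ∸ α
  l = N ∸ τ
  N+j : N +ℕ j ≡ τ +ℕ α
  N+j = ℕ.m+[n∸m]≡n N≤
  α+k : α +ℕ k ≡ N
  α+k = ℕ.m+[n∸m]≡n α≤N
  τ+l : τ +ℕ l ≡ N
  τ+l = ℕ.m+[n∸m]≡n τ≤N
  τ≡ : τ ≡ j +ℕ k
  τ≡ = ℕ.+-cancelˡ-≡ α τ (j +ℕ k) (begin
    α +ℕ τ          ≡⟨ ℕ.+-comm α τ ⟩
    τ +ℕ α          ≡⟨ N+j ⟨
    N +ℕ j          ≡⟨ cong (_+ℕ j) α+k ⟨
    (α +ℕ k) +ℕ j   ≡⟨ ≡.trans (ℕ.+-assoc α k j) (cong (α +ℕ_) (ℕ.+-comm k j)) ⟩
    α +ℕ (j +ℕ k)   ∎)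
  α≡ : α ≡ j +ℕ l
  α≡ = ℕ.+-cancelˡ-≡ τ α (j +ℕ l) (begin
    τ +ℕ α          ≡⟨ N+j ⟨
    N +ℕ j          ≡⟨ cong (_+ℕ j) τ+l ⟨
    (τ +ℕ l) +ℕ j   ≡⟨ ≡.trans (ℕ.+-assoc τ l j) (cong (τ +ℕ_) (ℕ.+-comm l j)) ⟩
    τ +ℕ (j +ℕ l)   ∎)
  r≤n : r ≤ n
  -- If `r` exceeded `n`, then `n ∸ r` would be 0 by truncation, against `1 ≤ τ ≤ n ∸ r`.
  r≤n = ℕ.≮⇒≥ λ n<r → ℕ.<⇒≱ 1≤τ (ℕ.≤-trans τ≤N (ℕ.≤-reflexive (ℕ.m≤n⇒m∸n≡0 (ℕ.<⇒≤ n<r))))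
  n≡ : n ≡ j +ℕ (k +ℕ (l +ℕ r))
  n≡ = begin
    n                        ≡⟨ ℕ.m∸n+n≡m r≤n ⟨
    N +ℕ r                   ≡⟨ cong (_+ℕ r) τ+l ⟨
    (τ +ℕ l) +ℕ r            ≡⟨ cong (λ t → (t +ℕ l) +ℕ r) τ≡ ⟩
    ((j +ℕ k) +ℕ l) +ℕ r     ≡⟨ ≡.trans (ℕ.+-assoc (j +ℕ k) l r) (ℕ.+-assoc j k (l +ℕ r)) ⟩
    j +ℕ (k +ℕ (l +ℕ r))     ∎

-- The finite sum over outcomes as an iterated expectation

module Recurrences (p : ℚ) where

  open Expectation ℚ.+-*-isCommutativeRing (qOf p) (xOf p) (xOf+yOf p)

  private
    sumOver : (Outcome → ℚ) → List Outcome → ℚ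
    sumOver f = foldr (λ o acc → f o + acc) 0ℚ

    join : Digraph → Outcome → Digraph
    join e o u v = e u v ∨ arc o u v

  sumOver-cong : ∀ {f g} os → (∀ o → f o ≡ g o) → sumOver f os ≡ sumOver g os
  sumOver-cong []       h = refl
  sumOver-cong (o ∷ os) h = cong₂ _+_ (h o) (sumOver-cong os h)

  sumOver-++ : ∀ f os os′ → sumOver f (os ++ os′) ≡ sumOver f os + sumOver f os′
  sumOver-++ f []       os′ = sym (ℚ.+-identityˡ _)
  sumOver-++ f (o ∷ os) os′ = ≡.trans (cong (f o +_) (sumOver-++ f os os′)) (sym (ℚ.+-assoc (f o) _ _))

  sumOver-map : ∀ {X : Set} f f′ (g h : X → Outcome) k xs → (∀ x → f (g x) ≡ k * f′ (h x)) →
    sumOver f (map g xs) ≡ k * sumOver f′ (map h xs)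
  sumOver-map f f′ g h k []       eq = sym (ℚ.*-zeroʳ k)
  sumOver-map f f′ g h k (x ∷ xs) eq =
    ≡.trans (cong₂ _+_ (eq x) (sumOver-map f f′ g h k xs eq)) (sym (ℚ.*-distribˡ-+ k _ _))

  private
    term : (Digraph → Bool) → Digraph → Outcome → ℚ
    term F e o = weight p o * ⟦ F (join e o) ⟧

  -- Induction on the pairs: the weight of the first state factors out, and the state itself moves
  -- into the digraph `e` revealed so far.
  sumOver-𝔼 : ∀ L F → (∀ e e′ → Agree Everywhere e e′ → F e ≡ F e′) → ∀ e →
    sumOver (term F e) (map (zip L) (dirLists (length L))) ≡ 𝔼 L (λ e → ⟦ F e ⟧) e
  sumOver-𝔼 []      F ext e = ≡.trans (ℚ.+-identityʳ _) (≡.trans (ℚ.*-identityˡ _)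
    (cong ⟦_⟧ (ext (join e []) e (λ u v _ → ∨-identityʳ (e u v)))))
  sumOver-𝔼 (a ∷ L) F ext e = begin
    sumOver f (map (zip (a ∷ L)) (prepend none ++ (prepend fwd ++ (prepend bwd ++ []))))
      ≡⟨ cong (sumOver f) (map-++ (zip (a ∷ L)) (prepend none) _) ⟩
    sumOver f (zipped none ++ map (zip (a ∷ L)) (prepend fwd ++ (prepend bwd ++ [])))
      ≡⟨ ≡.trans (sumOver-++ f (zipped none) _) (cong (sumOver f (zipped none) +_) (cong (sumOver f) (map-++ (zip (a ∷ L)) (prepend fwd) _))) ⟩
    sumOver f (zipped none) + sumOver f (zipped fwd ++ map (zip (a ∷ L)) (prepend bwd ++ []))
      ≡⟨ cong (sumOver f (zipped none) +_) (≡.trans (sumOver-++ f (zipped fwd) _)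
           (cong (λ ds → sumOver f (zipped fwd) + sumOver f (map (zip (a ∷ L)) ds)) (++-identityʳ (prepend bwd)))) ⟩
    sumOver f (zipped none) + (sumOver f (zipped fwd) + sumOver f (zipped bwd))
      ≡⟨ cong₂ _+_ (block none) (cong₂ _+_ (block fwd) (block bwd)) ⟩
    weightDir p none * 𝔼 L (λ e → ⟦ F e ⟧) (link a none e) +
    (weightDir p fwd * 𝔼 L (λ e → ⟦ F e ⟧) (link a fwd e) + weightDir p bwd * 𝔼 L (λ e → ⟦ F e ⟧) (link a bwd e))
      ≡⟨ mean-expand (λ d → 𝔼 L (λ e → ⟦ F e ⟧) (link a d e)) ⟨
    mean (λ d → 𝔼 L (λ e → ⟦ F e ⟧) (link a d e)) ∎
    where
    open ≡-Reasoning
    D = dirLists (length L)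
    f = term F e
    prepend : Dir → List (List Dir)
    prepend d = map (d ∷_) D
    zipped : Dir → List Outcome
    zipped d = map (zip (a ∷ L)) (prepend d)
    factor : ∀ d o → f ((a , d) ∷ o) ≡ weightDir p d * term F (link a d e) o
    factor d o = ≡.trans (ℚ.*-assoc (weightDir p d) (weight p o) _) (cong (λ b → weightDir p d * (weight p o * ⟦ b ⟧))
      (ext (join e ((a , d) ∷ o)) (join (link a d e) o) (λ u v _ → sym (∨-assoc (e u v) (arrow a d u v) (arc o u v)))))
    block : ∀ d → sumOver f (zipped d) ≡ weightDir p d * 𝔼 L (λ e → ⟦ F e ⟧) (link a d e)
    block d = begin
      sumOver f (map (zip (a ∷ L)) (map (d ∷_) D))
        ≡⟨ cong (sumOver f) (map-∘ D) ⟨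
      sumOver f (map (λ ds → (a , d) ∷ zip L ds) D)
        ≡⟨ sumOver-map f (term F (link a d e)) (λ ds → (a , d) ∷ zip L ds) (zip L) (weightDir p d) D (λ ds → factor d (zip L ds)) ⟩
      weightDir p d * sumOver (term F (link a d e)) (map (zip L) D)
        ≡⟨ cong (weightDir p d *_) (sumOver-𝔼 L F ext (link a d e)) ⟩
      weightDir p d * 𝔼 L (λ e → ⟦ F e ⟧) (link a d e) ∎

  Prob≡ℙ : ∀ n (E : Outcome → Bool) F → (∀ e e′ → Agree Everywhere e e′ → F e ≡ F e′) → (∀ o → E o ≡ F (arc o)) →
    Prob p n E ≡ ℙ (edges (upTo n)) F
  Prob≡ℙ n E F ext h = begin
    sumOver (λ o → if E o then weight p o else 0ℚ) (outcomes n)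
      ≡⟨ sumOver-cong (outcomes n) (λ o → select (E o) (F (arc o)) (weight p o) (h o)) ⟩
    sumOver (term F ∅) (outcomes n)
      ≡⟨ sumOver-𝔼 (pairs n) F ext ∅ ⟩
    ℙ (pairs n) F
      ≡⟨ ≋⇒≡ (edges-pairs n) (λ e e′ a → cong ⟦_⟧ (ext e e′ a)) ∅ ⟨
    ℙ (edges (upTo n)) F ∎
    where
    open ≡-Reasoning
    select : ∀ b b′ w → b ≡ b′ → (if b then w else 0ℚ) ≡ w * ⟦ b′ ⟧
    select true  .true  w refl = sym (ℚ.*-identityʳ w)
    select false .false w refl = sym (ℚ.*-zeroʳ w)

  event-ext′ : ∀ V c e e′ → Agree Everywhere e e′ → event V c e ≡ event V c e′
  event-ext′ V c e e′ h = event-Local V c e e′ (λ u v _ → h u v tt)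

  -- NP and dP as probabilities of words of classes

  NP≡P : ∀ n τ α r {j t a} → jOf n τ α r ≡ j → tOf n τ α r ≡ t → aOf n τ α r ≡ a →
    NP p n τ α r ≡ (if validN n τ α r then P (upTo n) (config τ α j t a) else 0ℚ)
  NP≡P n τ α r refl refl refl = cong (λ z → if validN n τ α r then z else 0ℚ)
    (Prob≡ℙ n _ (event (upTo n) c) (event-ext′ (upTo n) c) λ o → ≡.trans
      (cong₂ _∧_ (sameSet≡isCluster (arc o) n (tOf n τ α r) (TOf n τ α r))
                 (sameSet≡isCluster (reversed (arc o)) n (aOf n τ α r) (AOf n τ α r)))
      (sym (event-def (upTo n) c (arc o))))
    where c = config τ α (jOf n τ α r) (tOf n τ α r) (aOf n τ α r)

  NP≡Q : ∀ n τ α r {j t a w} → jOf n τ α r ≡ j → tOf n τ α r ≡ t → aOf n τ α r ≡ a → validN n τ α r ≡ true →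
    map (config τ α j t a) (upTo n) ↭ w → NP p n τ α r ≡ Q w
  NP≡Q n τ α r {j} {t} {a} hj ht ha hv hw = ≡.trans (NP≡P n τ α r hj ht ha)
    (≡.trans (cong (λ b → if b then P (upTo n) (config τ α j t a) else 0ℚ) hv) (P≡Q (upTo⁺ n) hw))

  NP-meeting : ∀ i k l r → NP p (2 +ℕ (i +ℕ (k +ℕ (l +ℕ r)))) (2 +ℕ (i +ℕ k)) (2 +ℕ (i +ℕ l)) r ≡ Q (meeting i k l r)
  NP-meeting i k l r = NP≡Q n τ α r hj (tOf-jOf n τ α r hj) (aOf-jOf n τ α r hj)
    (validN-canonical (2 +ℕ i) k l r refl (s≤s z≤n) (s≤s z≤n) (s≤s (s≤s z≤n)))
    (↭-reflexive (meeting-config i k l r))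
    where
    n = 2 +ℕ (i +ℕ (k +ℕ (l +ℕ r)))
    τ = 2 +ℕ (i +ℕ k)
    α = 2 +ℕ (i +ℕ l)
    hj = jOf-canonical (2 +ℕ i) k l r

  NP-disjoint : ∀ k l r → NP p (suc k +ℕ (suc l +ℕ r)) (suc k) (suc l) r ≡ Q (disjoint k l r)
  NP-disjoint k l r = NP≡Q n (suc k) (suc l) r hj (tOf-jOf n (suc k) (suc l) r hj) (aOf-jOf n (suc k) (suc l) r hj)
    (validN-canonical 0 (suc k) (suc l) r refl (s≤s z≤n) (s≤s z≤n) (s≤s (subst (1 ≤_) (sym (ℕ.+-suc k l)) (s≤s z≤n))))
    -- The canonical numbering places `a` after all of `T`; one shift brings it to second position.
    (↭-trans (↭-reflexive (disjoint-config k l r)) (prep sourceT (↭.shift sinkA (replicate k plainT) _)))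
    where
    n = suc k +ℕ (suc l +ℕ r)
    hj = jOf-canonical 0 (suc k) (suc l) r

  if-zero : ∀ b {z} → z ≡ 0ℚ → (if b then z else 0ℚ) ≡ 0ℚ
  if-zero true  h = h
  if-zero false h = refl

  -- A single common vertex. The canonical choice then has `a` outside `T`, or `t` outside `A` when
  -- `α = 1`, so the event is impossible, the second case after reversal. Rejected parameters give 0
  -- as well.
  NP-touching : ∀ k l r → NP p (1 +ℕ (k +ℕ (l +ℕ r))) (1 +ℕ k) (1 +ℕ l) r ≡ 0ℚ
  NP-touching k (suc l) r = ≡.trans (NP≡P n τ α r hj (tOf-jOf n τ α r hj) (aOf-jOf n τ α r hj))
    (if-zero (validN n τ α r) (P-impossible (upTo n) (config τ α 1 0 τ) {0}
      (λ {z} _ h → <ᵇ-false (ℕ.≤-reflexive (sym (≡ᵇ-true z τ h)))) (here refl) refl refl))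
    where
    n = 1 +ℕ (k +ℕ (suc l +ℕ r))
    τ = 1 +ℕ k
    α = 2 +ℕ l
    hj = jOf-canonical 1 k (suc l) r
  NP-touching k zero r = ≡.trans (NP≡P n τ 1 r hj (tOf-jOf n τ 1 r hj) (aOf-jOf n τ 1 r hj))
    (if-zero (validN n τ 1 r) (≡.trans (sym (P-transpose (upTo n) c))
      (P-impossible (upTo n) (transpose ∘ c) {0} (λ {z} _ h → notInA z (≡ᵇ-true z 1 h)) (here refl) refl refl)))
    where
    n = 1 +ℕ (k +ℕ r)
    τ = 1 +ℕ k
    c = config τ 1 1 1 0
    hj = jOf-canonical 1 k 0 r
    notInA : ∀ z → z ≡ 1 → inA (c z) ≡ false
    notInA _ refl = outside k
      where
      outside : ∀ k → ((suc k ≤ᵇ 1) ∧ (1 <ᵇ (suc k +ℕ 1) ∸ 1)) ≡ false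
      outside zero    = refl
      outside (suc k) = refl

  dP≡Q : ∀ z → dP p (suc z) (suc z) ≡ Q (sinkA ∷ replicate z plainA)
  dP≡Q z = ≡.trans (Prob≡ℙ n _ (event (upTo n) c) (event-ext′ (upTo n) c) pointwise)
    (≡.trans (P≡Q (upTo⁺ n) (↭-reflexive (dP-config-word z))) (cluster-symmetric z))
    where
    n = suc z
    c = dP-config n
    noSink : ∀ e → isCluster e (upTo n) (λ _ → false) (λ _ → false) ≡ true
    noSink e = isCluster⁺ e (upTo n) _ _ (cluster (λ _ r → ⊥-elim (unreachable r)) (λ _ ()))
      where
      unreachable : ∀ {u} → ¬ Reach e (upTo n) (λ _ → false) u
      unreachable (step r _ _) = unreachable r
    pointwise : ∀ o → sameSet n (outCluster n o 0) (λ u → u <ᵇ n) ≡ event (upTo n) c (arc o)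
    pointwise o = ≡.trans (sameSet≡isCluster (arc o) n 0 (λ u → u <ᵇ n)) (sym (≡.trans (event-def (upTo n) c (arc o))
      (≡.trans (cong (isCluster (arc o) (upTo n) (_≡ᵇ 0) (λ u → u <ᵇ n) ∧_) (noSink (reversed (arc o)))) (∧-identityʳ _))))

  ^≡^ℚ : ∀ a n → a ^ n ≡ a ^ℚ n
  ^≡^ℚ a zero    = refl
  ^≡^ℚ a (suc n) = cong (a *_) (^≡^ℚ a n)

  bin≡binom : ∀ n k → bin n k ≡ binom n k
  bin≡binom n k = go (n C k)
    where
    go : ∀ m → ι m ≡ ℕ→ℚ m
    go zero    = refl
    go (suc m) = ≡.trans (cong (1ℚ +_) (go m)) (sym (ℕ→ℚ-suc m))

  sumFromTo≡Σ< : ∀ lo hi f → sumFromTo lo hi f ≡ Σ< (suc hi ∸ lo) (λ i → f (lo +ℕ i))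
  sumFromTo≡Σ< lo hi f = go (suc hi ∸ lo) id
    where
    go : ∀ m (g : ℕ → ℕ) → foldr (λ i acc → f (lo +ℕ i) + acc) 0ℚ (applyUpTo g m) ≡ Σ< m (λ i → f (lo +ℕ g i))
    go zero    g = refl
    go (suc m) g = cong (f (lo +ℕ g 0) +_) (go m (g ∘ suc))

  y^≡ : ∀ n → y ^ n ≡ yOf p ^ℚ n
  y^≡ n = ≡.trans (cong (_^ n) (qOf+xOf p)) (^≡^ℚ (yOf p) n)

  q^≡ : ∀ n → qOf p ^ n ≡ qOf p ^ℚ n
  q^≡ n = ^≡^ℚ (qOf p) n

  -- Vertices outside A ∪ T, and exchanging the two clusters

  isolated : ∀ j k l r {v} →
    NP p (j +ℕ (k +ℕ (l +ℕ r))) (j +ℕ k) (j +ℕ l) r ≡ v ⊗ ((qOf p ^ (r *ℕ j)) ⊗ (y ^ (r *ℕ (k +ℕ l)))) →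
    NP p (j +ℕ (k +ℕ (l +ℕ 0))) (j +ℕ k) (j +ℕ l) 0 ≡ v →
    let n = j +ℕ (k +ℕ (l +ℕ r)); τ = j +ℕ k; α = j +ℕ l in
    NP p n τ α r ≡ NP p (n ∸ r) τ α 0
      * (qOf p ^ℚ (r *ℕ ((r +ℕ τ +ℕ α) ∸ n)))
      * (yOf p ^ℚ (r *ℕ ((2 *ℕ n) ∸ (2 *ℕ r +ℕ τ +ℕ α))))
  isolated j k l r {v} h h₀ = begin
    NP p n τ α r
      ≡⟨ h ⟩
    v ⊗ ((qOf p ^ (r *ℕ j)) ⊗ (y ^ (r *ℕ (k +ℕ l))))
      ≡⟨ *-assoc v (qOf p ^ (r *ℕ j)) (y ^ (r *ℕ (k +ℕ l))) ⟨
    (v ⊗ (qOf p ^ (r *ℕ j))) ⊗ (y ^ (r *ℕ (k +ℕ l)))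
      ≡⟨ cong₂ _*_ (cong₂ _*_ (sym h₀′) (≡.trans (q^≡ (r *ℕ j)) (cong (λ s → qOf p ^ℚ (r *ℕ s)) (sym qExp))))
           (≡.trans (y^≡ (r *ℕ (k +ℕ l))) (cong (λ s → yOf p ^ℚ (r *ℕ s)) (sym yExp))) ⟩
    _ ∎
    where
    open ≡-Reasoning
    n = j +ℕ (k +ℕ (l +ℕ r))
    τ = j +ℕ k
    α = j +ℕ l
    h₀′ : NP p (n ∸ r) τ α 0 ≡ v
    h₀′ = ≡.trans (cong (λ s → NP p s τ α 0) (≡.trans (core-size j k l r) (cong (λ s → j +ℕ (k +ℕ s)) (sym (ℕ.+-identityʳ l))))) h₀
    qExp : (r +ℕ τ +ℕ α) ∸ n ≡ j
    qExp = ∸-solve (r +ℕ τ +ℕ α) n j (lem j k l r)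
      where
      lem : ∀ j k l r → r +ℕ (j +ℕ k) +ℕ (j +ℕ l) ≡ (j +ℕ (k +ℕ (l +ℕ r))) +ℕ j
      lem = solve-∀
    yExp : (2 *ℕ n) ∸ (2 *ℕ r +ℕ τ +ℕ α) ≡ k +ℕ l
    yExp = ∸-solve (2 *ℕ n) (2 *ℕ r +ℕ τ +ℕ α) (k +ℕ l) (lem j k l r)
      where
      lem : ∀ j k l r → 2 *ℕ (j +ℕ (k +ℕ (l +ℕ r))) ≡ (2 *ℕ r +ℕ (j +ℕ k) +ℕ (j +ℕ l)) +ℕ (k +ℕ l)
      lem = solve-∀

  -- For `j = 0` the power of `q` is 1, and for `j = 1` both sides are zero.
  part-i : ∀ j k l r → 1 ≤ j +ℕ k → 1 ≤ j +ℕ l →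
    let n = j +ℕ (k +ℕ (l +ℕ r)); τ = j +ℕ k; α = j +ℕ l in
    NP p n τ α r ≡ NP p (n ∸ r) τ α 0
      * (qOf p ^ℚ (r *ℕ ((r +ℕ τ +ℕ α) ∸ n)))
      * (yOf p ^ℚ (r *ℕ ((2 *ℕ n) ∸ (2 *ℕ r +ℕ τ +ℕ α))))
  part-i 0 (suc k) (suc l) r _ _ = isolated 0 (suc k) (suc l) r
    (≡.trans (NP-disjoint k l r) (≡.trans (disjoint-isolated k l r) (cong (Q (disjoint k l 0) *_) (sym powers))))
    (NP-disjoint k l 0)
    where
    powers : (qOf p ^ (r *ℕ 0)) ⊗ (y ^ (r *ℕ (suc k +ℕ suc l))) ≡ y ^ (r *ℕ (2 +ℕ (k +ℕ l)))
    powers = ≡.trans (cong₂ (λ s t → (qOf p ^ s) ⊗ (y ^ (r *ℕ suc t))) (ℕ.*-zeroʳ r) (ℕ.+-suc k l))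
      (*-identityˡ (y ^ (r *ℕ (2 +ℕ (k +ℕ l)))))
  part-i 1 k l r _ _ = isolated 1 k l r
    (≡.trans (NP-touching k l r) (sym (zeroˡ ((qOf p ^ (r *ℕ 1)) ⊗ (y ^ (r *ℕ (k +ℕ l))))))) (NP-touching k l 0)
  part-i (suc (suc i)) k l r _ _ = isolated (2 +ℕ i) k l r
    (≡.trans (NP-meeting i k l r) (meeting-isolated i k l r)) (NP-meeting i k l 0)

  part-ii : ∀ j k l r → 1 ≤ j +ℕ k → 1 ≤ j +ℕ l →
    NP p (j +ℕ (k +ℕ (l +ℕ r))) (j +ℕ k) (j +ℕ l) r ≡ NP p (j +ℕ (k +ℕ (l +ℕ r))) (j +ℕ l) (j +ℕ k) r
  part-ii j k l r a b = ≡.trans (go j k l a b) (cong (λ n → NP p n (j +ℕ l) (j +ℕ k) r) (lem j k l r))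
    where
    lem : ∀ j k l r → j +ℕ (l +ℕ (k +ℕ r)) ≡ j +ℕ (k +ℕ (l +ℕ r))
    lem = solve-∀
    go : ∀ j k l → 1 ≤ j +ℕ k → 1 ≤ j +ℕ l →
      NP p (j +ℕ (k +ℕ (l +ℕ r))) (j +ℕ k) (j +ℕ l) r ≡ NP p (j +ℕ (l +ℕ (k +ℕ r))) (j +ℕ l) (j +ℕ k) r
    go 0 (suc k) (suc l) _ _ = ≡.trans (NP-disjoint k l r) (≡.trans (disjoint-symmetric k l r) (sym (NP-disjoint l k r)))
    go 1 k l _ _ = ≡.trans (NP-touching k l r) (sym (NP-touching l k r))
    go (suc (suc i)) k l _ _ = ≡.trans (NP-meeting i k l r) (≡.trans (meeting-symmetric i k l r) (sym (NP-meeting i l k r)))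

  -- The two peeling recurrences

  termIII : ℕ → ℕ → ℕ → ℕ → ℚ
  termIII n τ α ζ =
    binom ((n ∸ τ) ∸ 1) (ζ ∸ 1)
      * NP p (n ∸ ζ) τ (α ∸ ζ) 0
      * dP p ζ ζ
      * (qOf p ^ℚ ((ζ ∸ 1) *ℕ ((α +ℕ τ) ∸ n)))
      * (yOf p ^ℚ ((ζ ∸ 1) *ℕ ((2 *ℕ n) ∸ (τ +ℕ α +ℕ ζ))))
      * ((yOf p ^ℚ τ) - (yOf p ^ℚ ((2 *ℕ n) ∸ (α +ℕ τ +ℕ ζ))) * (qOf p ^ℚ ((α +ℕ τ) ∸ n)))

  termIII-eval : ∀ n τ α ζ {b N D c w w′ j} →
    binom ((n ∸ τ) ∸ 1) (ζ ∸ 1) ≡ b → NP p (n ∸ ζ) τ (α ∸ ζ) 0 ≡ N → dP p ζ ζ ≡ D → (α +ℕ τ) ∸ n ≡ j →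
    (2 *ℕ n) ∸ (τ +ℕ α +ℕ ζ) ≡ w → (2 *ℕ n) ∸ (α +ℕ τ +ℕ ζ) ≡ w′ → ζ ∸ 1 ≡ c →
    termIII n τ α ζ ≡ b * N * D * (qOf p ^ℚ (c *ℕ j)) * (yOf p ^ℚ (c *ℕ w)) *
      ((yOf p ^ℚ τ) - (yOf p ^ℚ w′) * (qOf p ^ℚ j))
  termIII-eval n τ α ζ refl refl refl refl refl refl refl = refl

  -- `ζ = 1 + z`, the 1 standing for `v`, and `l` vertices of `A ∖ T` survive. So `k + l` counts the
  -- surviving vertices in exactly one of `T` and `A`, which is 2n - τ - α - ζ.
  summandIII : ∀ i k z l m → z +ℕ l ≡ m →
    bin m z ⊗ (Q (sinkA ∷ replicate z plainA) ⊗
      (((y ^ (2 +ℕ (i +ℕ k)) ⊕ - ((qOf p ^ (2 +ℕ i)) ⊗ (y ^ (k +ℕ l))))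
         ⊗ ((qOf p ^ (z *ℕ (2 +ℕ i))) ⊗ (y ^ (z *ℕ (k +ℕ l)))))
       ⊗ Q (meeting i k l 0))) ≡
    termIII (2 +ℕ (i +ℕ (k +ℕ (suc m +ℕ 0)))) (2 +ℕ (i +ℕ k)) (2 +ℕ (i +ℕ suc m)) (suc z)
  summandIII i k z l m refl = sym (begin
    termIII n τ α (suc z)
      ≡⟨ termIII-eval n τ α (suc z) b≡ N≡ (dP≡Q z) j≡ w≡ w′≡ refl ⟩
    b * N * D * (qOf p ^ℚ (z *ℕ (2 +ℕ i))) * (yOf p ^ℚ (z *ℕ (k +ℕ l))) *
      ((yOf p ^ℚ τ) - (yOf p ^ℚ (k +ℕ l)) * (qOf p ^ℚ (2 +ℕ i)))
      ≡⟨ convert (q^≡ (z *ℕ (2 +ℕ i))) (y^≡ (z *ℕ (k +ℕ l))) (y^≡ τ)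
           (≡.trans (*-comm (qOf p ^ (2 +ℕ i)) (y ^ (k +ℕ l))) (cong₂ _*_ (y^≡ (k +ℕ l)) (q^≡ (2 +ℕ i)))) ⟨
    b * N * D * (qOf p ^ (z *ℕ (2 +ℕ i))) * (y ^ (z *ℕ (k +ℕ l))) *
      ((y ^ τ) - (qOf p ^ (2 +ℕ i)) * (y ^ (k +ℕ l)))
      ≡⟨ gather-meeting b N D (qOf p ^ (z *ℕ (2 +ℕ i))) (y ^ (z *ℕ (k +ℕ l))) ((y ^ τ) - (qOf p ^ (2 +ℕ i)) * (y ^ (k +ℕ l))) ⟩
    b * (D * ((((y ^ τ) - (qOf p ^ (2 +ℕ i)) * (y ^ (k +ℕ l)))
      * ((qOf p ^ (z *ℕ (2 +ℕ i))) * (y ^ (z *ℕ (k +ℕ l))))) * N)) ∎)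
    where
    open ≡-Reasoning
    n = 2 +ℕ (i +ℕ (k +ℕ (suc m +ℕ 0)))
    τ = 2 +ℕ (i +ℕ k)
    α = 2 +ℕ (i +ℕ suc m)
    b = bin m z
    N = Q (meeting i k l 0)
    D = Q (sinkA ∷ replicate z plainA)
    convert : ∀ {a a′ c c′ t t′ s s′} → a ≡ a′ → c ≡ c′ → t ≡ t′ → s ≡ s′ →
      b * N * D * a * c * (t - s) ≡ b * N * D * a′ * c′ * (t′ - s′)
    convert refl refl refl refl = refl
    b≡ : binom ((n ∸ τ) ∸ 1) z ≡ bin m z
    b≡ = ≡.trans (cong (λ s → binom (s ∸ 1) z) (∸-solve n τ (suc m) (lem i k m))) (sym (bin≡binom m z))
      where
      lem : ∀ i k m → 2 +ℕ (i +ℕ (k +ℕ (suc m +ℕ 0))) ≡ (2 +ℕ (i +ℕ k)) +ℕ suc m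
      lem = solve-∀
    N≡ : NP p (n ∸ suc z) τ (α ∸ suc z) 0 ≡ Q (meeting i k l 0)
    N≡ = ≡.trans (cong₂ (λ s t → NP p s τ t 0) (∸-solve n (suc z) (2 +ℕ (i +ℕ (k +ℕ (l +ℕ 0)))) (lem i k z l)) (∸-solve α (suc z) (2 +ℕ (i +ℕ l)) (lem′ i z l)))
      (NP-meeting i k l 0)
      where
      lem : ∀ i k z l → 2 +ℕ (i +ℕ (k +ℕ (suc (z +ℕ l) +ℕ 0))) ≡ suc z +ℕ (2 +ℕ (i +ℕ (k +ℕ (l +ℕ 0))))
      lem = solve-∀
      lem′ : ∀ i z l → 2 +ℕ (i +ℕ suc (z +ℕ l)) ≡ suc z +ℕ (2 +ℕ (i +ℕ l))
      lem′ = solve-∀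
    j≡ : (α +ℕ τ) ∸ n ≡ 2 +ℕ i
    j≡ = ∸-solve (α +ℕ τ) n (2 +ℕ i) (lem i k m)
      where
      lem : ∀ i k m → (2 +ℕ (i +ℕ suc m)) +ℕ (2 +ℕ (i +ℕ k)) ≡ (2 +ℕ (i +ℕ (k +ℕ (suc m +ℕ 0)))) +ℕ (2 +ℕ i)
      lem = solve-∀
    w≡ : (2 *ℕ n) ∸ (τ +ℕ α +ℕ suc z) ≡ k +ℕ l
    w≡ = ∸-solve (2 *ℕ n) (τ +ℕ α +ℕ suc z) (k +ℕ l) (lem i k z l)
      where
      lem : ∀ i k z l → 2 *ℕ (2 +ℕ (i +ℕ (k +ℕ (suc (z +ℕ l) +ℕ 0)))) ≡
        ((2 +ℕ (i +ℕ k)) +ℕ (2 +ℕ (i +ℕ suc (z +ℕ l))) +ℕ suc z) +ℕ (k +ℕ l)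
      lem = solve-∀
    w′≡ : (2 *ℕ n) ∸ (α +ℕ τ +ℕ suc z) ≡ k +ℕ l
    w′≡ = ≡.trans (cong (λ s → (2 *ℕ n) ∸ (s +ℕ suc z)) (ℕ.+-comm α τ)) w≡

  part-iii : ∀ i k m →
    let n = 2 +ℕ (i +ℕ (k +ℕ (suc m +ℕ 0))); τ = 2 +ℕ (i +ℕ k); α = 2 +ℕ (i +ℕ suc m) in
    NP p n τ α 0 ≡ sumFromTo 1 (n ∸ τ) (termIII n τ α)
  part-iii i k m = begin
    NP p n τ α 0
      ≡⟨ NP-meeting i k (suc m) 0 ⟩
    Q (meeting i k (suc m) 0)
      ≡⟨ ≡.trans (meeting-peel i k m) (Bin≡Σ m G) ⟩
    Σ< (suc m) (λ z → bin m z ⊗ G z (m ∸ z))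
      ≡⟨ Σ<-cong (suc m) {λ z → bin m z ⊗ G z (m ∸ z)} {λ z → termIII n τ α (suc z)} (λ z h → summandIII i k z (m ∸ z) m (ℕ.m+[n∸m]≡n (ℕ.s≤s⁻¹ h))) ⟩
    Σ< (suc m) (λ z → termIII n τ α (suc z))
      ≡⟨ cong (λ s → Σ< s (λ z → termIII n τ α (suc z))) (∸-solve n τ (suc m) (lem i k m)) ⟨
    Σ< (n ∸ τ) (λ z → termIII n τ α (suc z))
      ≡⟨ sumFromTo≡Σ< 1 (n ∸ τ) (termIII n τ α) ⟨
    sumFromTo 1 (n ∸ τ) (termIII n τ α) ∎
    where
    open ≡-Reasoning
    n = 2 +ℕ (i +ℕ (k +ℕ (suc m +ℕ 0)))
    τ = 2 +ℕ (i +ℕ k)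
    α = 2 +ℕ (i +ℕ suc m)
    G : ℕ → ℕ → ℚ
    G z l = Q (sinkA ∷ replicate z plainA) ⊗
      (((y ^ (2 +ℕ (i +ℕ k)) ⊕ - ((qOf p ^ (2 +ℕ i)) ⊗ (y ^ (k +ℕ l))))
         ⊗ ((qOf p ^ (z *ℕ (2 +ℕ i))) ⊗ (y ^ (z *ℕ (k +ℕ l)))))
       ⊗ Q (meeting i k l 0))
    lem : ∀ i k m → 2 +ℕ (i +ℕ (k +ℕ (suc m +ℕ 0))) ≡ (2 +ℕ (i +ℕ k)) +ℕ suc m
    lem = solve-∀

  termIV : ℕ → ℕ → ℕ → ℕ → ℚ
  termIV n τ α ζ =
    binom (α ∸ 2) (ζ ∸ 1)
      * NP p (n ∸ ζ) τ (α ∸ ζ) 0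
      * dP p ζ ζ
      * (yOf p ^ℚ ((ζ ∸ 1) *ℕ ((τ +ℕ α) ∸ ζ)))
      * (yOf p ^ℚ τ)
      * (1ℚ - yOf p ^ℚ (α ∸ ζ))

  termIV-eval : ∀ n τ α ζ {b N D c w s} →
    binom (α ∸ 2) (ζ ∸ 1) ≡ b → NP p (n ∸ ζ) τ (α ∸ ζ) 0 ≡ N → dP p ζ ζ ≡ D →
    (τ +ℕ α) ∸ ζ ≡ w → α ∸ ζ ≡ s → ζ ∸ 1 ≡ c →
    termIV n τ α ζ ≡ b * N * D * (yOf p ^ℚ (c *ℕ w)) * (yOf p ^ℚ τ) * (1ℚ - yOf p ^ℚ s)
  termIV-eval n τ α ζ refl refl refl refl refl refl = refl

  -- `α = 2 + m`, since `v` and `a` are both set apart from the `m` candidates. The survivors of `A`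
  -- are `a` and `l` plain vertices, hence α - ζ = `suc l`.
  summandIV : ∀ k z l m → z +ℕ l ≡ m →
    bin m z ⊗ (Q (sinkA ∷ replicate z plainA) ⊗
      (((y ^ suc k ⊕ - (y ^ (2 +ℕ (k +ℕ l)))) ⊗ (y ^ (z *ℕ (2 +ℕ (k +ℕ l))))) ⊗ Q (disjoint k l 0))) ≡
    termIV (suc k +ℕ (suc (suc m) +ℕ 0)) (suc k) (suc (suc m)) (suc z)
  summandIV k z l m refl = sym (begin
    termIV n τ α (suc z)
      ≡⟨ termIV-eval n τ α (suc z) (sym (bin≡binom m z)) N≡ (dP≡Q z) w≡ s≡ refl ⟩
    b * N * D * (yOf p ^ℚ (z *ℕ (2 +ℕ (k +ℕ l)))) * (yOf p ^ℚ τ) * (1ℚ - yOf p ^ℚ suc l)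
      ≡⟨ convert (y^≡ (z *ℕ (2 +ℕ (k +ℕ l)))) (y^≡ τ) (y^≡ (suc l)) ⟨
    b * N * D * (y ^ (z *ℕ (2 +ℕ (k +ℕ l)))) * (y ^ τ) * (1ℚ - y ^ suc l)
      ≡⟨ gather-disjoint b N D (y ^ (z *ℕ (2 +ℕ (k +ℕ l)))) (y ^ τ) (1ℚ - y ^ suc l) (^-difference y k l) ⟩
    b * (D * ((((y ^ τ) - (y ^ (2 +ℕ (k +ℕ l)))) * (y ^ (z *ℕ (2 +ℕ (k +ℕ l))))) * N)) ∎)
    where
    open ≡-Reasoning
    n = suc k +ℕ (suc (suc m) +ℕ 0)
    τ = suc k
    α = suc (suc m)
    b = bin m z
    N = Q (disjoint k l 0)
    D = Q (sinkA ∷ replicate z plainA)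
    convert : ∀ {a a′ t t′ s s′} → a ≡ a′ → t ≡ t′ → s ≡ s′ →
      b * N * D * a * t * (1ℚ - s) ≡ b * N * D * a′ * t′ * (1ℚ - s′)
    convert refl refl refl = refl
    s≡ : α ∸ suc z ≡ suc l
    s≡ = ∸-solve α (suc z) (suc l) (cong suc (sym (ℕ.+-suc z l)))
    w≡ : (τ +ℕ α) ∸ suc z ≡ 2 +ℕ (k +ℕ l)
    w≡ = ∸-solve (τ +ℕ α) (suc z) (2 +ℕ (k +ℕ l)) (lem k z l)
      where
      lem : ∀ k z l → suc k +ℕ suc (suc (z +ℕ l)) ≡ suc z +ℕ (2 +ℕ (k +ℕ l))
      lem = solve-∀
    N≡ : NP p (n ∸ suc z) τ (α ∸ suc z) 0 ≡ Q (disjoint k l 0)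
    N≡ = ≡.trans (cong₂ (λ s t → NP p s τ t 0) (∸-solve n (suc z) (suc k +ℕ (suc l +ℕ 0)) (lem k z l)) s≡) (NP-disjoint k l 0)
      where
      lem : ∀ k z l → suc k +ℕ (suc (suc (z +ℕ l)) +ℕ 0) ≡ suc z +ℕ (suc k +ℕ (suc l +ℕ 0))
      lem = solve-∀

  part-iv : ∀ k m →
    let n = suc k +ℕ (suc (suc m) +ℕ 0); τ = suc k; α = suc (suc m) in
    NP p n τ α 0 ≡ sumFromTo 1 (α ∸ 1) (termIV n τ α)
  part-iv k m = begin
    NP p n τ α 0
      ≡⟨ NP-disjoint k (suc m) 0 ⟩
    Q (disjoint k (suc m) 0)
      ≡⟨ ≡.trans (disjoint-peel k m) (Bin≡Σ m G) ⟩
    Σ< (suc m) (λ z → bin m z ⊗ G z (m ∸ z))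
      ≡⟨ Σ<-cong (suc m) {λ z → bin m z ⊗ G z (m ∸ z)} {λ z → termIV n τ α (suc z)} (λ z h → summandIV k z (m ∸ z) m (ℕ.m+[n∸m]≡n (ℕ.s≤s⁻¹ h))) ⟩
    Σ< (suc m) (λ z → termIV n τ α (suc z))
      ≡⟨ sumFromTo≡Σ< 1 (suc m) (termIV n τ α) ⟨
    sumFromTo 1 (suc m) (termIV n τ α) ∎
    where
    open ≡-Reasoning
    n = suc k +ℕ (suc (suc m) +ℕ 0)
    τ = suc k
    α = suc (suc m)
    G : ℕ → ℕ → ℚ
    G z l = Q (sinkA ∷ replicate z plainA) ⊗
      (((y ^ suc k ⊕ - (y ^ (2 +ℕ (k +ℕ l)))) ⊗ (y ^ (z *ℕ (2 +ℕ (k +ℕ l))))) ⊗ Q (disjoint k l 0))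

  -- Total probability in the original parameters

  sumFromTo-bin : ∀ lo hi m f (G : ℕ → ℕ → ℚ) → suc hi ∸ lo ≡ suc m →
    (∀ k l → k +ℕ l ≡ m → f (lo +ℕ k) ≡ binom m k * G k l) → sumFromTo lo hi f ≡ Σ<-bin m G
  sumFromTo-bin lo hi m f G eq h = begin
    sumFromTo lo hi f
      ≡⟨ sumFromTo≡Σ< lo hi f ⟩
    Σ< (suc hi ∸ lo) (λ k → f (lo +ℕ k))
      ≡⟨ cong (λ s → Σ< s (λ k → f (lo +ℕ k))) eq ⟩
    Σ< (suc m) (λ k → f (lo +ℕ k))
      ≡⟨ Σ<-cong (suc m) {λ k → f (lo +ℕ k)} {λ k → bin m k ⊗ G k (m ∸ k)} (λ k l →
           ≡.trans (h k (m ∸ k) (ℕ.m+[n∸m]≡n (ℕ.s≤s⁻¹ l))) (cong (_* G k (m ∸ k)) (sym (bin≡binom m k)))) ⟩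
    Σ<-bin m G ∎
    where open ≡-Reasoning

  meetingCell : ℕ → ℕ → ℕ → ℕ → ℚ
  meetingCell n j τ α = binom (n ∸ τ) (α ∸ j) * NP p n τ α ((n +ℕ j) ∸ (α +ℕ τ))

  meetingRow : ℕ → ℕ → ℕ → ℚ
  meetingRow n j τ = binom (n ∸ j) (τ ∸ j) * sumFromTo j ((n ∸ τ) +ℕ j) (meetingCell n j τ)

  meetingTerm : ℕ → ℕ → ℚ
  meetingTerm n j = binom (n ∸ 2) (j ∸ 2) * sumFromTo j n (meetingRow n j)

  disjointCell : ℕ → ℕ → ℕ → ℚ
  disjointCell n τ α = binom ((n ∸ τ) ∸ 1) (α ∸ 1) * NP p n τ α ((n ∸ α) ∸ τ)

  disjointTerm : ℕ → ℕ → ℚ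
  disjointTerm n τ = binom (n ∸ 2) (τ ∸ 1) * sumFromTo 1 (n ∸ τ) (disjointCell n τ)

  innerMeeting : ∀ i m₁ → let n = 2 +ℕ (i +ℕ m₁); j = 2 +ℕ i in
    sumFromTo j n (meetingRow n j) ≡ Σ<-bin m₁ λ k m₂ → Σ<-bin m₂ λ l r → Q (meeting i k l r)
  innerMeeting i m₁ = sumFromTo-bin j n m₁ (meetingRow n j) (λ k m₂ → Σ<-bin m₂ λ l r → Q (meeting i k l r))
    (∸-solve (suc n) j (suc m₁) (lem i m₁)) outer
    where
    n = 2 +ℕ (i +ℕ m₁)
    j = 2 +ℕ i
    lem : ∀ i m → 3 +ℕ (i +ℕ m) ≡ (2 +ℕ i) +ℕ suc m
    lem = solve-∀
    outer : ∀ k m₂ → k +ℕ m₂ ≡ m₁ →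
      meetingRow n j (j +ℕ k) ≡ binom m₁ k * (Σ<-bin m₂ λ l r → Q (meeting i k l r))
    outer k m₂ refl = cong₂ _*_ (cong₂ binom (ℕ.m+n∸m≡n j (k +ℕ m₂)) (ℕ.m+n∸m≡n j k))
      (sumFromTo-bin j ((n ∸ τ) +ℕ j) m₂ (meetingCell n j τ) (λ l r → Q (meeting i k l r))
        (≡.trans (cong (λ s → suc (s +ℕ j) ∸ j) n∸τ) (ℕ.m+n∸n≡m (suc m₂) j)) inner)
      where
      τ = j +ℕ k
      n∸τ : n ∸ τ ≡ m₂
      n∸τ = ∸-solve n τ m₂ (lem′ i k m₂)
        where
        lem′ : ∀ i k m → 2 +ℕ (i +ℕ (k +ℕ m)) ≡ ((2 +ℕ i) +ℕ k) +ℕ m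
        lem′ = solve-∀
      inner : ∀ l r → l +ℕ r ≡ m₂ → meetingCell n j τ (j +ℕ l) ≡ binom m₂ l * Q (meeting i k l r)
      inner l r refl = cong₂ _*_ (cong₂ binom n∸τ (ℕ.m+n∸m≡n j l))
        (≡.trans (cong (NP p n τ (j +ℕ l)) (∸-solve (n +ℕ j) ((j +ℕ l) +ℕ τ) r (lem″ i k l r))) (NP-meeting i k l r))
        where
        lem″ : ∀ i k l r → 2 +ℕ (i +ℕ (k +ℕ (l +ℕ r))) +ℕ (2 +ℕ i) ≡ (((2 +ℕ i) +ℕ l) +ℕ ((2 +ℕ i) +ℕ k)) +ℕ r
        lem″ = solve-∀

  innerDisjoint : ∀ k m₂ → let n = 2 +ℕ (k +ℕ m₂) in
    sumFromTo 1 (n ∸ suc k) (disjointCell n (suc k)) ≡ Σ<-bin m₂ λ l r → Q (disjoint k l r)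
  innerDisjoint k m₂ =
    sumFromTo-bin 1 (n ∸ suc k) m₂ (disjointCell n (suc k)) (λ l r → Q (disjoint k l r)) n∸τ inner
    where
    n = 2 +ℕ (k +ℕ m₂)
    n∸τ : n ∸ suc k ≡ suc m₂
    n∸τ = ∸-solve n (suc k) (suc m₂) (cong suc (sym (ℕ.+-suc k m₂)))
    inner : ∀ l r → l +ℕ r ≡ m₂ → disjointCell n (suc k) (suc l) ≡ binom m₂ l * Q (disjoint k l r)
    inner l r refl = cong₂ _*_ (cong (λ s → binom (s ∸ 1) l) n∸τ) (≡.trans
      (cong₂ (λ s t → NP p s (suc k) (suc l) t) (lem k l r)
        (≡.trans (ℕ.∸-+-assoc n (suc l) (suc k)) (∸-solve n (suc l +ℕ suc k) r (lem′ k l r)))) (NP-disjoint k l r))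
      where
      lem : ∀ k l r → 2 +ℕ (k +ℕ (l +ℕ r)) ≡ suc k +ℕ (suc l +ℕ r)
      lem = solve-∀
      lem′ : ∀ k l r → 2 +ℕ (k +ℕ (l +ℕ r)) ≡ (suc l +ℕ suc k) +ℕ r
      lem′ = solve-∀

  sumMeeting sumDisjoint : ℕ → ℚ
  sumMeeting n = sumFromTo 2 (n ∸ 1) (meetingTerm n)
  sumDisjoint n = sumFromTo 1 n (disjointTerm n)

  -- The upper limit n - 1 stops just before `i = m`, the case of the full intersection.
  sumMeeting≡ : ∀ m → sumMeeting (2 +ℕ m) ≡
    Σ< m (λ i → bin m i ⊗ Σ<-bin (m ∸ i) λ k m₂ → Σ<-bin m₂ λ l r → Q (meeting i k l r))
  sumMeeting≡ m = ≡.trans (sumFromTo≡Σ< 2 (suc m) (meetingTerm (2 +ℕ m)))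
    (Σ<-cong m {λ i → meetingTerm (2 +ℕ m) (2 +ℕ i)} {λ i → bin m i ⊗ row i (m ∸ i)} λ i h →
      at i (m ∸ i) (ℕ.m+[n∸m]≡n (ℕ.<⇒≤ h)))
    where
    row : ℕ → ℕ → ℚ
    row i m₁ = Σ<-bin m₁ λ k m₂ → Σ<-bin m₂ λ l r → Q (meeting i k l r)
    at : ∀ i m₁ → i +ℕ m₁ ≡ m → meetingTerm (2 +ℕ m) (2 +ℕ i) ≡ bin m i ⊗ row i m₁
    at i m₁ refl = cong₂ _*_ (sym (bin≡binom m i)) (innerMeeting i m₁)

  -- The last term, τ = n, vanishes because its binomial coefficient does.
  sumDisjoint≡ : ∀ m → sumDisjoint (2 +ℕ m) ≡ Σ<-bin m λ k m₂ → Σ<-bin m₂ λ l r → Q (disjoint k l r)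
  sumDisjoint≡ m = begin
    sumDisjoint n
      ≡⟨ sumFromTo≡Σ< 1 n (disjointTerm n) ⟩
    Σ< (suc (suc m)) f
      ≡⟨ Σ<-last (suc m) f ⟩
    Σ< (suc m) f + f (suc m)
      ≡⟨ cong (Σ< (suc m) f +_) (≡.trans (cong (_* tail) (cong ℕ→ℚ (k>n⇒nCk≡0 (ℕ.n<1+n m)))) (zeroˡ tail)) ⟩
    Σ< (suc m) f + 0ℚ
      ≡⟨ +-identityʳ (Σ< (suc m) f) ⟩
    Σ< (suc m) f
      ≡⟨ Σ<-cong (suc m) {f} {λ k → bin m k ⊗ row k (m ∸ k)} (λ k h → at k (m ∸ k) (ℕ.m+[n∸m]≡n (ℕ.s≤s⁻¹ h))) ⟩
    (Σ<-bin m λ k m₂ → Σ<-bin m₂ λ l r → Q (disjoint k l r)) ∎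
    where
    open ≡-Reasoning
    n = 2 +ℕ m
    f : ℕ → ℚ
    f k = disjointTerm n (suc k)
    tail : ℚ
    tail = sumFromTo 1 (n ∸ n) (disjointCell n n)
    row : ℕ → ℕ → ℚ
    row k m₂ = Σ<-bin m₂ λ l r → Q (disjoint k l r)
    at : ∀ k m₂ → k +ℕ m₂ ≡ m → f k ≡ bin m k ⊗ row k m₂
    at k m₂ refl = cong₂ _*_ (sym (bin≡binom m k)) (innerDisjoint k m₂)

  part-v : ∀ m → let n = 2 +ℕ m in NP p n n n 0 ≡ 1ℚ - sumMeeting n - sumDisjoint n
  part-v m = last-summand {M} {N} {D} total′
    where
    M = sumMeeting (2 +ℕ m)
    D = sumDisjoint (2 +ℕ m)
    N = NP p (2 +ℕ m) (2 +ℕ m) (2 +ℕ m) 0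
    top : N ≡ Q (meeting m 0 0 0)
    top = ≡.trans (cong₂ (λ s t → NP p (2 +ℕ s) (2 +ℕ t) (2 +ℕ t) 0) (sym (ℕ.+-identityʳ m)) (sym (ℕ.+-identityʳ m)))
      (NP-meeting m 0 0 0)
    total′ : (M + N) + D ≡ 1ℚ
    total′ = ≡.trans (cong₂ _+_ (cong₂ _+_ (sumMeeting≡ m) top) (sumDisjoint≡ m)) (total-binomial m)

theorem5p2 : (p : ℚ) → 0ℚ ≤ℚ p → p ≤ℚ 1ℚ →
    (n : ℕ) → 2 ≤ n →
    (NP p n n n 0 ≡ 1ℚ
    - (sumFromTo 2 (n ∸ 1) λ j → binom (n ∸ 2) (j ∸ 2)
    * sumFromTo j n λ τ → binom (n ∸ j) (τ ∸ j)
    * sumFromTo j ((n ∸ τ) +ℕ j) λ α → binom (n ∸ τ) (α ∸ j)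
    * NP p n τ α ((n +ℕ j) ∸ (α +ℕ τ)))
    - (sumFromTo 1 n λ τ → binom (n ∸ 2) (τ ∸ 1)
    * sumFromTo 1 (n ∸ τ) λ α → binom ((n ∸ τ) ∸ 1) (α ∸ 1)
    * NP p n τ α ((n ∸ α) ∸ τ)))
    ×
    ((τ α r : ℕ) → 1 ≤ τ → 1 ≤ α →
    τ ≤ n ∸ r → α ≤ n ∸ r → n ∸ r ≤ τ +ℕ α →
    (0 < r → NP p n τ α r
    ≡ NP p (n ∸ r) τ α 0
    * (qOf p ^ℚ (r *ℕ ((r +ℕ τ +ℕ α) ∸ n)))
    * (yOf p ^ℚ (r *ℕ ((2 *ℕ n) ∸ (2 *ℕ r +ℕ τ +ℕ α)))))
    ×
    (NP p n τ α r ≡ NP p n α τ r)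
    ×
    (r ≡ 0 → τ < n → α ≤ n → 2 ≤ α → 2 ≤ jOf n τ α r →
    NP p n τ α 0
    ≡ sumFromTo 1 (n ∸ τ) λ ζ →
    binom ((n ∸ τ) ∸ 1) (ζ ∸ 1)
    * NP p (n ∸ ζ) τ (α ∸ ζ) 0
    * dP p ζ ζ
    * (qOf p ^ℚ ((ζ ∸ 1) *ℕ ((α +ℕ τ) ∸ n)))
    * (yOf p ^ℚ ((ζ ∸ 1) *ℕ ((2 *ℕ n) ∸ (τ +ℕ α +ℕ ζ))))
    * ((yOf p ^ℚ τ) - (yOf p ^ℚ ((2 *ℕ n) ∸ (α +ℕ τ +ℕ ζ))) * (qOf p ^ℚ ((α +ℕ τ) ∸ n))))
    ×
    (r ≡ 0 → 2 ≤ α → n ≡ τ +ℕ α →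
    NP p n τ α 0
    ≡ sumFromTo 1 (α ∸ 1) λ ζ →
    binom (α ∸ 2) (ζ ∸ 1)
    * NP p (n ∸ ζ) τ (α ∸ ζ) 0
    * dP p ζ ζ
    * (yOf p ^ℚ ((ζ ∸ 1) *ℕ ((τ +ℕ α) ∸ ζ)))
    * (yOf p ^ℚ τ)
    * (1ℚ - yOf p ^ℚ (α ∸ ζ))))
theorem5p2 p _ _ (suc (suc m)) (s≤s (s≤s z≤n)) = part-v m , λ τ α r 1≤τ 1≤α τ≤ α≤ N≤ →
  recurrences (suc (suc m)) τ α r 1≤τ 1≤α (findParameters (suc (suc m)) τ α r 1≤τ τ≤ α≤ N≤)
  where
  open Recurrences p
  recurrences : ∀ n τ α r → 1 ≤ τ → 1 ≤ α → Parameters n τ α r →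
    (0 < r → NP p n τ α r ≡ NP p (n ∸ r) τ α 0
      * (qOf p ^ℚ (r *ℕ ((r +ℕ τ +ℕ α) ∸ n)))
      * (yOf p ^ℚ (r *ℕ ((2 *ℕ n) ∸ (2 *ℕ r +ℕ τ +ℕ α)))))
    × (NP p n τ α r ≡ NP p n α τ r)
    × (r ≡ 0 → τ < n → α ≤ n → 2 ≤ α → 2 ≤ jOf n τ α r → NP p n τ α 0 ≡ sumFromTo 1 (n ∸ τ) (termIII n τ α))
    × (r ≡ 0 → 2 ≤ α → n ≡ τ +ℕ α → NP p n τ α 0 ≡ sumFromTo 1 (α ∸ 1) (termIV n τ α))
  recurrences _ _ _ r 1≤τ 1≤α (parameters j k l refl refl refl) =
    (λ _ → part-i j k l r 1≤τ 1≤α) , part-ii j k l r 1≤τ 1≤α , iii j l , iv j k l 1≤τ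
    where
    iii : ∀ j l → let n = j +ℕ (k +ℕ (l +ℕ r)); τ = j +ℕ k; α = j +ℕ l in
      r ≡ 0 → τ < n → α ≤ n → 2 ≤ α → 2 ≤ jOf n τ α r → NP p n τ α 0 ≡ sumFromTo 1 (n ∸ τ) (termIII n τ α)
    iii j l refl τ<n _ _ 2≤j = go j l (subst (2 ≤_) (jOf-canonical j k l 0) 2≤j) τ<n
      where
      go : ∀ j l → 2 ≤ j → let n = j +ℕ (k +ℕ (l +ℕ 0)); τ = j +ℕ k; α = j +ℕ l in
        τ < n → NP p n τ α 0 ≡ sumFromTo 1 (n ∸ τ) (termIII n τ α)
      -- With `r = 0` and nothing in `A ∖ T`, the set `T` is everything, which `τ < n` excludes.
      go (suc (suc i)) zero    (s≤s (s≤s z≤n)) τ<n =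
        ⊥-elim (ℕ.<-irrefl (cong (λ s → 2 +ℕ (i +ℕ s)) (sym (ℕ.+-identityʳ k))) τ<n)
      go (suc (suc i)) (suc l) (s≤s (s≤s z≤n)) _   = part-iii i k l
    iv : ∀ j k l → 1 ≤ j +ℕ k → let n = j +ℕ (k +ℕ (l +ℕ r)); τ = j +ℕ k; α = j +ℕ l in
      r ≡ 0 → 2 ≤ α → n ≡ τ +ℕ α → NP p n τ α 0 ≡ sumFromTo 1 (α ∸ 1) (termIV n τ α)
    -- From `n = τ + α` the intersection has size `(τ + α) ∸ n = 0`.
    iv j k l 1≤τ refl 2≤α n≡ = go j k l 1≤τ 2≤α (≡.trans (sym (jOf-canonical j k l 0))
      (≡.trans (cong ((j +ℕ k +ℕ (j +ℕ l)) ∸_) n≡) (ℕ.n∸n≡0 (j +ℕ k +ℕ (j +ℕ l)))))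
      where
      go : ∀ j k l → 1 ≤ j +ℕ k → 2 ≤ j +ℕ l → j ≡ 0 → let n = j +ℕ (k +ℕ (l +ℕ 0)); τ = j +ℕ k; α = j +ℕ l in
        NP p n τ α 0 ≡ sumFromTo 1 (α ∸ 1) (termIV n τ α)
      go zero (suc k) (suc (suc l)) _ _        refl = part-iv k l
      go zero (suc k) 1             _ (s≤s ()) refl
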